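{- Let $G=(V,E)$ be a graph with $|V|\ge 3$ and let $k\ge 2$ be an integer. The minimum cardinality $\gamma$ of a set $F$ of edges such that $(V,E\cup F)$ is $(2k,k)$-connected is equal to $$\alpha=\left\lceil \frac12\max\left\{\sum_{\mathsf{X}\in\mathcal{X}}\bigl(2k-f_G(\mathsf{X})\bigr)\right\}\right\rceil,$$ where the maximum is taken over all families $\mathcal{X}$ of non-trivial pairwise innerly-disjoint bi-sets of $V$.
   Context: All graphs are finite and undirected; loops and parallel edges are allowed (in particular the new edges in $F$ may be parallel to each other or to edges of $E$, and $E\cup F$ is understood with multiplicities). A graph is $\ell$-edge-connected if deleting any fewer than $\ell$ edges leaves it connected. A graph $G=(V,E)$ is $(2k,k)$-connected if $|V|\ge 3$, $G$ is $2k$-edge-connected, and $G-v$ is $k$-edge-connected for every $v\in V$. A bi-set of $V$ is $\mathsf{X}=(X_O,X_I)$ with $X_I\subseteq X_O\subseteq V$; its wall is $w(\mathsf{X})=X_O\setminus X_I$. It is trivial if $X_I=\emptyset$ or $X_O=V$, and non-trivial otherwise. Bi-sets $\mathsf{X},\mathsf{Y}$ are innerly-disjoint if $X_I\cap Y_I=\emptyset$. An edge enters $\mathsf{X}$ if one end-vertex is in $X_I$ and the other is not in $X_O$; $\hat d_G(\mathsf{X})$ is the number of edges of $G$ entering $\mathsf{X}$, and $f_G(\mathsf{X})=\hat d_G(\mathsf{X})+k|w(\mathsf{X})|$. The family $\mathcal{X}$ may be empty, in which case the sum is $0$. -}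

module Defs where

open import Data.Fin using (Fin)
open import Data.Fin.Properties using (_≟_)
open import Data.Fin.Subset using (Subset; _∈_; _∉_; _⊆_; _∩_; _─_; _-_; ∣_∣; ⊤; ⊥; Empty)
open import Data.Fin.Subset.Properties using (_∈?_)
open import Data.Integer as ℤ using (ℤ; +_)
open import Data.List using (List; length; filter; map; foldr; _++_)
open import Data.List.Membership.Propositional renaming (_∈_ to _∈ˡ_) using ()
open import Data.List.Relation.Ternary.Interleaving.Propositional using (Interleaving)
open import Data.List.Relation.Unary.All using (All)
open import Data.List.Relation.Unary.AllPairs using (AllPairs)
open import Data.Nat using (ℕ; _+_; _*_; _≤_; _<_)
open import Data.Product using (∃; _×_; _,_)
open import Data.Sum using (_⊎_)
open import Relation.Binary.Construct.Closure.Equivalence using (EqClosure)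
open import Relation.Binary.PropositionalEquality using (_≡_)
open import Relation.Nullary using (¬_)
open import Relation.Nullary.Decidable using (Dec; ¬?; _×-dec_; _⊎-dec_)

private
  variable
    n : ℕ

-- An undirected edge is given by listing its two ends in either order; all
-- notions below are insensitive to that order.  Equal ends make a loop.
Edge : ℕ → Set
Edge n = Fin n × Fin n

-- A graph with vertex set Fin n is its list of edges, with multiplicity, so
-- that (V , E ∪ F) is E ++ F and the cardinality of F is length F.
Graph : ℕ → Set
Graph n = List (Edge n)

Joined : Graph n → Fin n → Fin n → Set
Joined G = EqClosure (λ u v → (u , v) ∈ˡ G)

-- Connectivity of the graph with vertex set S and edges G; it is only used
-- when all ends of the edges in G belong to S.
ConnectedOn : Subset n → Graph n → Set
ConnectedOn S G = ∀ {u v} → u ∈ S → v ∈ S → Joined G u v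

-- Interleaving D R G says that deleting the edges D from G leaves R.
EdgeConnectedOn : Subset n → ℕ → Graph n → Set
EdgeConnectedOn S ℓ G =
  ∀ {D R} → Interleaving D R G → length D < ℓ → ConnectedOn S R

Incident : Fin n → Edge n → Set
Incident v (x , y) = x ≡ v ⊎ y ≡ v

incident? : (v : Fin n) (e : Edge n) → Dec (Incident v e)
incident? v (x , y) = (x ≟ v) ⊎-dec (y ≟ v)

-- The edges of G - v, whose vertex set is ⊤ - v.
deleteVertex : Fin n → Graph n → Graph n
deleteVertex v = filter (λ e → ¬? (incident? v e))

record [2k,k]-Connected (k : ℕ) (G : Graph n) : Set where
  field
    3≤∣V∣             : 3 ≤ n
    edgeConnected     : EdgeConnectedOn ⊤ (2 * k) G
    edgeConnected-del : ∀ v → EdgeConnectedOn (⊤ - v) k (deleteVertex v G)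

record BiSet (n : ℕ) : Set where
  field
    outer       : Subset n
    inner       : Subset n
    inner⊆outer : inner ⊆ outer

open BiSet public

wall : BiSet n → Subset n
wall X = outer X ─ inner X

Trivial : BiSet n → Set
Trivial X = inner X ≡ ⊥ ⊎ outer X ≡ ⊤

NonTrivial : BiSet n → Set
NonTrivial X = ¬ Trivial X

InnerlyDisjoint : BiSet n → BiSet n → Set
InnerlyDisjoint X Y = Empty (inner X ∩ inner Y)

Enters : BiSet n → Edge n → Set
Enters X (x , y) = (x ∈ inner X × y ∉ outer X) ⊎ (y ∈ inner X × x ∉ outer X)

enters? : (X : BiSet n) (e : Edge n) → Dec (Enters X e)
enters? X (x , y) =
  ((x ∈? inner X) ×-dec ¬? (y ∈? outer X)) ⊎-dec
  ((y ∈? inner X) ×-dec ¬? (x ∈? outer X))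

d̂ : Graph n → BiSet n → ℕ
d̂ G X = length (filter (enters? X) G)

f : ℕ → Graph n → BiSet n → ℕ
f k G X = d̂ G X + k * ∣ wall X ∣

-- A list represents a family without ambiguity here: non-trivial bi-sets have
-- non-empty inner sets, so pairwise inner disjointness excludes repetitions.
record Admissible (𝒳 : List (BiSet n)) : Set where
  field
    nonTrivial      : All NonTrivial 𝒳
    innerlyDisjoint : AllPairs InnerlyDisjoint 𝒳

totalDeficiency : ℕ → Graph n → List (BiSet n) → ℤ
totalDeficiency k G 𝒳 =
  foldr ℤ._+_ (+ 0) (map (λ X → + (2 * k) ℤ.- + f k G X) 𝒳)

IsMinimum : (ℕ → Set) → ℕ → Set
IsMinimum P m = P m × (∀ {j} → P j → m ≤ j)

IsMaximum : (ℤ → Set) → ℤ → Set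
IsMaximum P m = P m × (∀ {j} → P j → j ℤ.≤ m)

AugmentationSize : ℕ → Graph n → ℕ → Set
AugmentationSize {n} k E m =
  ∃ λ (F : List (Edge n)) → [2k,k]-Connected k (E ++ F) × length F ≡ m

FamilyValue : ℕ → Graph n → ℤ → Set
FamilyValue {n} k E s =
  ∃ λ (𝒳 : List (BiSet n)) → Admissible 𝒳 × totalDeficiency k E 𝒳 ≡ s

module Submission where

-- Add a vertex s joined to each v ∈ V by m v edges, with m minimal such that
-- f(X) + m(X_I) ≥ 2k for every non-trivial bi-set X.  By minimality every v with
-- m v > 0 lies in the inner set of a tight bi-set, and uncrossing the tight
-- bi-sets yields an innerly-disjoint family of total deficiency m(V); so μ = m(V).
-- The edges at s are then split off in pairs.  This never increases the value of
-- a bi-set, hence tight bi-sets stay tight.  Suppose that no pair at s can be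
-- split although m(V) ≠ 3.  Then, for a suitable u, maximal dangerous bi-sets
-- (value at most 2k + 1) with u in their inner sets cross each other; three of
-- them contradict an uncrossing inequality for triples, which is where k ≥ 2
-- enters, and if two of them contain all the remaining edges at s in their inner
-- sets, a third dangerous bi-set on their differences carries too much weight.
-- Three final edges at s are replaced by a path of two edges through a centre
-- that is not the common wall of two tight bi-sets.

open import Defs
open import Data.Bool using (Bool; true; false; T; _∧_)
open import Data.Bool.Properties using (T-∧)
open import Data.Empty using (⊥; ⊥-elim)
open import Data.Fin using (Fin; zero; suc)
open import Data.Fin.Properties using (_≟_; any?; all?)
import Data.Fin.Properties as Finₚ
open import Data.Fin.Subset using (Subset; _∈_; _∉_; _─_; _-_; ∣_∣; Side; ⁅_⁆) renaming (⊤ to full)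
open import Data.Fin.Subset.Properties using (_∈?_; ∈⊤; ∉⊥; Empty-unique; nonempty?; ⊆-antisym; x∈p∩q⁺; x∈p∩q⁻; x∈p∧x∉q⇒x∈p─q; p─q⊆p; x∈p∧x≢y⇒x∈p-y; x∈⁅x⁆)
open import Data.Integer as ℤ using (ℤ)
import Data.Integer.Properties as ℤ
open import Data.List using (List; []; _∷_; _++_; length; map; allFin)
open import Data.List.Membership.Propositional renaming (_∈_ to _∈ˡ_) using ()
open import Data.List.Membership.Propositional.Properties using (∈-filter⁻; ∈-allFin)
open import Data.List.Properties using (filter-accept; filter-reject; map-∘)
open import Data.List.Relation.Binary.Permutation.Propositional using (_↭_; prep; ↭-trans; ↭-refl) renaming (swap to ↭-swap)
open import Data.List.Relation.Binary.Permutation.Propositional.Properties using (map⁺; All-resp-↭; Any-resp-↭)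
open import Data.List.Relation.Ternary.Interleaving.Propositional using (Interleaving; []; consˡ; consʳ)
open import Data.List.Relation.Unary.All as All using (All; []; _∷_)
import Data.List.Relation.Unary.All.Properties as All
open import Data.List.Relation.Unary.AllPairs as AllPairs using (AllPairs; []; _∷_)
import Data.List.Relation.Unary.AllPairs.Properties as AllPairs
open import Data.List.Relation.Unary.Any using (Any; here; there)
open import Data.Nat using (ℕ; zero; suc; _+_; _*_; _∸_; _≤_; _<_; _≤ᵇ_; _≤?_; _<?_; z≤n; s≤s; ⌈_/2⌉)
open import Data.Nat.Coprimality using (Coprime; 1-coprimeTo; coprime-+) renaming (sym to coprime-sym)
import Data.Nat.DivMod as ℕ
open import Data.Nat.Divisibility using (n∣m*n)
open import Data.Nat.ListAction using () renaming (sum to sumˡ)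
open import Data.Nat.ListAction.Properties using (sum-↭)
open import Data.Nat.Properties as ℕ hiding (_≟_)
open import Algebra.Properties.CommutativeSemigroup ℕ.+-commutativeSemigroup using (interchange)
open import Data.Product using (∃; ∃₂; _×_; _,_; proj₁; proj₂)
open import Data.Rational using (mkℚ; _/_; ceiling)
import Data.Rational.Properties as ℚ
open import Data.Rational.Unnormalised using (mkℚᵘ; *≡*)
open import Data.Sum using (_⊎_; inj₁; inj₂; [_,_]′)
open import Data.Unit using (tt)
open import Data.Vec using (Vec; []; _∷_; here; there; lookup; replicate; tabulate; zipWith) renaming (map to mapᵛ)
open import Data.Vec.Properties using (lookup∘tabulate; []=⇒lookup; lookup⇒[]=)
open import Function using (_∘_; id; case_of_)
open import Function.Bundles using (Equivalence)
open import Relation.Binary.Construct.Closure.ReflexiveTransitive using (ε; _◅_; _◅◅_)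
open import Relation.Binary.Construct.Closure.Symmetric using (SymClosure; fwd; bwd)
open import Relation.Binary.PropositionalEquality
open import Relation.Nullary using (¬_; contradiction; ¬?)
open import Relation.Nullary.Decidable using (Dec; yes; no; map′; True; toWitness; _×-dec_; _⊎-dec_; _→-dec_; T?; decidable-stable)

-- Two uncrossings carry the argument. Passing to `meet` and `join` needs a vertex outside both
-- outer sets; passing to the two differences needs, in each bi-set, an inner vertex outside the
-- other. Both can fail at once, when the outer sets cover V. `covering-pair` handles this case, but
-- only for walls of at most one vertex; such walls are guaranteed as soon as the inner weight
-- exceeds the slack above 2k. This is why inner weights are tracked everywhere. The tight bi-sets
-- with a given vertex u of positive weight in their inner sets have a greatest member, the hull of
-- u. Hulls absorb tight obstacles to splitting, so that for a well-chosen u only dangerous ones are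
-- left. Both bounds of the min-max formula come from one duality: any weights satisfying `Valid`
-- bound the deficiency of every innerly-disjoint family by their total. The degrees of an
-- augmenting edge set are such weights, with total twice its cardinality; minimal weights attain
-- equality.

private
  variable
    n : ℕ

-- Linear arithmetic over ℕ

infixl 8 _⊕_
infix 6 _⊑_

data Lin (n : ℕ) : Set where
  var  : Fin n → Lin n
  con  : ℕ → Lin n
  _⊕_  : Lin n → Lin n → Lin n
  _⊗_  : ℕ → Lin n → Lin n

infixl 9 _⊗_

data Ineq (n : ℕ) : Set where
  _⊑_ : Lin n → Lin n → Ineq n

module _ {n : ℕ} where

  ⟦_⟧ : Lin n → Vec ℕ n → ℕ
  ⟦ var i ⟧ ρ = lookup ρ i
  ⟦ con c ⟧ ρ = c
  ⟦ a ⊕ b ⟧ ρ = ⟦ a ⟧ ρ + ⟦ b ⟧ ρ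
  ⟦ c ⊗ a ⟧ ρ = c * ⟦ a ⟧ ρ

  Holds : Vec ℕ n → Ineq n → Set
  Holds ρ (a ⊑ b) = ⟦ a ⟧ ρ ≤ ⟦ b ⟧ ρ

  lhs rhs : Ineq n → Lin n
  lhs (a ⊑ b) = a
  rhs (a ⊑ b) = b

  NF : Set
  NF = ℕ × Vec ℕ n

  dot : ∀ {m} → Vec ℕ m → Vec ℕ m → ℕ
  dot [] [] = 0
  dot (c ∷ cs) (x ∷ xs) = c * x + dot cs xs

  evalNF : NF → Vec ℕ n → ℕ
  evalNF (c , cs) ρ = c + dot cs ρ

  unit : ∀ {m} → Fin m → Vec ℕ m
  unit zero    = 1 ∷ replicate _ 0
  unit (suc i) = 0 ∷ unit i

  nf : Lin n → NF
  nf (var i) = 0 , unit i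
  nf (con c) = c , replicate _ 0
  nf (a ⊕ b) = proj₁ (nf a) + proj₁ (nf b) , zipWith _+_ (proj₂ (nf a)) (proj₂ (nf b))
  nf (c ⊗ a) = c * proj₁ (nf a) , mapᵛ (c *_) (proj₂ (nf a))

  dot-0 : ∀ {m} (xs : Vec ℕ m) → dot (replicate m 0) xs ≡ 0
  dot-0 [] = refl
  dot-0 (x ∷ xs) = dot-0 xs

  dot-unit : ∀ {m} (i : Fin m) (xs : Vec ℕ m) → dot (unit i) xs ≡ lookup xs i
  dot-unit zero (x ∷ xs) = trans (cong₂ _+_ (+-identityʳ x) (dot-0 xs)) (+-identityʳ x)
  dot-unit (suc i) (x ∷ xs) = dot-unit i xs

  dot-+ : ∀ {m} (as bs xs : Vec ℕ m) → dot (zipWith _+_ as bs) xs ≡ dot as xs + dot bs xs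
  dot-+ [] [] [] = refl
  dot-+ (a ∷ as) (b ∷ bs) (x ∷ xs) =
    trans (cong₂ _+_ (*-distribʳ-+ x a b) (dot-+ as bs xs)) (interchange (a * x) (b * x) _ _)

  dot-* : ∀ {m} c (as xs : Vec ℕ m) → dot (mapᵛ (c *_) as) xs ≡ c * dot as xs
  dot-* c [] [] = sym (*-zeroʳ c)
  dot-* c (a ∷ as) (x ∷ xs) =
    trans (cong₂ _+_ (*-assoc c a x) (dot-* c as xs)) (sym (*-distribˡ-+ c (a * x) _))

  nf-correct : ∀ a ρ → evalNF (nf a) ρ ≡ ⟦ a ⟧ ρ
  nf-correct (var i) ρ = dot-unit i ρ
  nf-correct (con c) ρ = trans (cong (c +_) (dot-0 ρ)) (+-identityʳ c)
  nf-correct (a ⊕ b) ρ =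
    trans (cong (proj₁ (nf a) + proj₁ (nf b) +_) (dot-+ (proj₂ (nf a)) (proj₂ (nf b)) ρ))
      (trans (interchange (proj₁ (nf a)) (proj₁ (nf b)) _ _)
             (cong₂ _+_ (nf-correct a ρ) (nf-correct b ρ)))
  nf-correct (c ⊗ a) ρ =
    trans (cong (c * proj₁ (nf a) +_) (dot-* c (proj₂ (nf a)) ρ))
      (trans (sym (*-distribˡ-+ c (proj₁ (nf a)) _)) (cong (c *_) (nf-correct a ρ)))

  _≤ᵇᵛ_ : ∀ {m} → Vec ℕ m → Vec ℕ m → Bool
  [] ≤ᵇᵛ [] = Bool.true
  (a ∷ as) ≤ᵇᵛ (b ∷ bs) = (a ≤ᵇ b) ∧ (as ≤ᵇᵛ bs)

  dot-mono : ∀ {m} (as bs xs : Vec ℕ m) → T (as ≤ᵇᵛ bs) → dot as xs ≤ dot bs xs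
  dot-mono [] [] [] _ = z≤n
  dot-mono (a ∷ as) (b ∷ bs) (x ∷ xs) p =
    let q , r = Equivalence.to T-∧ p in
    +-mono-≤ (*-monoˡ-≤ x (≤ᵇ⇒≤ a b q)) (dot-mono as bs xs r)

  combine : (Ineq n → Lin n) → List (Ineq n) → List ℕ → Lin n
  combine side hs []             = con 0
  combine side [] (c ∷ cs)       = con 0
  combine side (h ∷ hs) (c ∷ cs) = c ⊗ side h ⊕ combine side hs cs

  Contradictory : List (Ineq n) → List ℕ → Set
  Contradictory hs cs =
    let l = nf (combine lhs hs cs)
        r = nf (combine rhs hs cs)
    in T ((suc (proj₁ r) ≤ᵇ proj₁ l) ∧ (proj₂ r ≤ᵇᵛ proj₂ l))

  -- Curried into ⊥, so that the hypotheses become successive arguments. With the negated goal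
  -- placed last and not supplied, the result is the negation that `≮⇒≥` turns into the goal.
  HoldAll : Vec ℕ n → List (Ineq n) → Set
  HoldAll ρ [] = ⊥
  HoldAll ρ (h ∷ hs) = Holds ρ h → HoldAll ρ hs

  private
    go : ∀ ρ (hs : List (Ineq n)) cs {a b} →
         (⟦ combine lhs hs cs ⟧ ρ + a ≤ ⟦ combine rhs hs cs ⟧ ρ + b → ⊥) →
         a ≤ b → HoldAll ρ hs
    go ρ [] [] f p = f p
    go ρ [] (c ∷ cs) f p = f p
    go ρ (h ∷ hs) [] f p = λ _ → go ρ hs [] f p
    go ρ ((l ⊑ r) ∷ hs) (c ∷ cs) {a} {b} f p = λ q →
      go ρ hs cs (λ s → f (subst₂ _≤_ (eq l (combine lhs hs cs) a) (eq r (combine rhs hs cs) b) s))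
        (+-mono-≤ (*-monoʳ-≤ c q) p)
      where
      eq : ∀ l X a → ⟦ X ⟧ ρ + (c * ⟦ l ⟧ ρ + a) ≡ c * ⟦ l ⟧ ρ + ⟦ X ⟧ ρ + a
      eq l X a = trans (sym (+-assoc (⟦ X ⟧ ρ) (c * ⟦ l ⟧ ρ) a)) (cong (_+ a) (+-comm (⟦ X ⟧ ρ) _))

  -- The hypotheses, multiplied by the given Farkas coefficients and added up,
  -- give an inequality that fails coefficientwise.
  refute : (ρ : Vec ℕ n) (problem : Vec (Lin n) n → List (Ineq n)) (cs : List ℕ) →
           {Contradictory (problem (tabulate var)) cs} → HoldAll ρ (problem (tabulate var))
  refute ρ problem cs {contra} = go ρ hs cs absurd (z≤n {0})
    where
    hs = problem (tabulate var)
    l = combine lhs hs cs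
    r = combine rhs hs cs
    absurd : ⟦ l ⟧ ρ + 0 ≤ ⟦ r ⟧ ρ + 0 → ⊥
    absurd p =
      let q , s = Equivalence.to T-∧ contra in
      <⇒≱ (+-mono-<-≤ (≤ᵇ⇒≤ _ _ q) (dot-mono (proj₂ (nf r)) (proj₂ (nf l)) ρ s))
        (subst₂ _≤_ (trans (+-identityʳ _) (sym (nf-correct l ρ)))
                    (trans (+-identityʳ _) (sym (nf-correct r ρ))) p)

private
  variable
    r : ℕ

-- Bi-sets as labellings: I marks the inner set, W the wall, and O the
-- complement of the outer set.

data Lab : Set where
  I W O : Lab

Labelling : ℕ → Set
Labelling n = Fin n → Lab

infix 4 _≟ᴸ_
_≟ᴸ_ : (a b : Lab) → Dec (a ≡ b)
I ≟ᴸ I = yes refl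
I ≟ᴸ W = no λ ()
I ≟ᴸ O = no λ ()
W ≟ᴸ I = no λ ()
W ≟ᴸ W = yes refl
W ≟ᴸ O = no λ ()
O ≟ᴸ I = no λ ()
O ≟ᴸ W = no λ ()
O ≟ᴸ O = yes refl

isI isW isO : Lab → ℕ
isI I = 1
isI _ = 0
isW W = 1
isW _ = 0
isO O = 1
isO _ = 0

rank : Lab → ℕ
rank I = 2
rank W = 1
rank O = 0

∁ : Lab → Lab
∁ I = O
∁ W = W
∁ O = I

infixr 7 _⋏_
infixr 6 _⋎_

-- Minimum and maximum of the chain O < W < I. Pointwise they intersect, or unite, the inner sets
-- and the outer sets simultaneously.
_⋏_ _⋎_ : Lab → Lab → Lab
I ⋏ b = b
O ⋏ b = O
W ⋏ O = O
W ⋏ b = W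
I ⋎ b = I
O ⋎ b = b
W ⋎ I = I
W ⋎ b = W

core : Lab → Lab
core I = I
core _ = O

enters : Lab → Lab → ℕ
enters I O = 1
enters O I = 1
enters _ _ = 0

⋏-zeroʳ : ∀ a → a ⋏ O ≡ O
⋏-zeroʳ I = refl
⋏-zeroʳ W = refl
⋏-zeroʳ O = refl

⋎-zeroʳ : ∀ a → a ⋎ I ≡ I
⋎-zeroʳ I = refl
⋎-zeroʳ W = refl
⋎-zeroʳ O = refl

enters≤1 : ∀ a b → enters a b ≤ 1
enters≤1 I I = z≤n
enters≤1 I W = z≤n
enters≤1 I O = ≤-refl
enters≤1 W b = z≤n
enters≤1 O I = ≤-refl
enters≤1 O W = z≤n
enters≤1 O O = z≤n

enters≤inner-ends : ∀ a b → enters a b ≤ isI a + isI b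
enters≤inner-ends I b = ≤-trans (enters≤1 I b) (m≤m+n 1 (isI b))
enters≤inner-ends W b = z≤n
enters≤inner-ends O I = ≤-refl
enters≤inner-ends O W = z≤n
enters≤inner-ends O O = z≤n

-- The difference takes the outer set of Y away from the inner set of X, and the inner set of Y away
-- from the outer set of X.
meet join diff : Labelling n → Labelling n → Labelling n
meet X Y v = X v ⋏ Y v
join X Y v = X v ⋎ Y v
diff X Y v = X v ⋏ ∁ (Y v)

comp inside outside : Labelling n → Labelling n
comp X v = ∁ (X v)
inside X v = core (X v)
outside X v = core (∁ (X v))

infix 4 _⊴_
_⊴_ : Labelling n → Labelling n → Set
X ⊴ Y = ∀ v → rank (X v) ≤ rank (Y v)

_⊴?_ : (X Y : Labelling n) → Dec (X ⊴ Y)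
X ⊴? Y = all? λ v → rank (X v) ≤? rank (Y v)

⊴-trans : ∀ {X Y Z : Labelling n} → X ⊴ Y → Y ⊴ Z → X ⊴ Z
⊴-trans p q v = ≤-trans (p v) (q v)

NonTriv : Labelling n → Set
NonTriv X = ∃ (λ v → X v ≡ I) × ∃ (λ v → X v ≡ O)

nonTriv? : (X : Labelling n) → Dec (NonTriv X)
nonTriv? X = any? (λ v → X v ≟ᴸ I) ×-dec any? (λ v → X v ≟ᴸ O)

-- Exhaustive checks over labels

allLab? : {P : Lab → Set} → (∀ a → Dec (P a)) → Dec (∀ a → P a)
allLab? P? = map′ (λ { (p , q , r) I → p ; (p , q , r) W → q ; (p , q , r) O → r })
                  (λ f → f I , f W , f O)
                  (P? I ×-dec P? W ×-dec P? O)

allLabs? : ∀ {r} {P : Vec Lab r → Set} → (∀ a → Dec (P a)) → Dec (∀ a → P a)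
allLabs? {zero} P? = map′ (λ { p [] → p }) (λ f → f []) (P? [])
allLabs? {suc r} P? = map′ (λ { f (a ∷ as) → f a as }) (λ f a as → f (a ∷ as))
                           (allLab? λ a → allLabs? λ as → P? (a ∷ as))

-- Labellings are functions and pointwise equal ones need not be identical, hence the condition that
-- P respects pointwise equality. This search makes maximal bi-sets and violated bi-sets available
-- constructively.
searchLabelling : ∀ {n} {P : Labelling n → Set} →
                  (∀ {X Y} → (∀ v → X v ≡ Y v) → P X → P Y) →
                  (∀ X → Dec (P X)) → Dec (∃ P)
searchLabelling {zero} {P} resp P? = map′ (empty ,_) (λ { (X , p) → resp (λ ()) p }) (P? empty)
  where
  empty : Labelling 0
  empty ()
searchLabelling {suc n} {P} resp P? =
  map′ (λ { (inj₁ (X , p)) → _ , p ; (inj₂ (inj₁ (X , p))) → _ , p ; (inj₂ (inj₂ (X , p))) → _ , p })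
       (λ { (X , p) → split X (X zero) refl p })
       (at I ⊎-dec at W ⊎-dec at O)
  where
  cons : Lab → Labelling n → Labelling (suc n)
  cons a X zero    = a
  cons a X (suc v) = X v
  cons-cong : ∀ a {X Y : Labelling n} → (∀ v → X v ≡ Y v) → ∀ v → cons a X v ≡ cons a Y v
  cons-cong a e zero    = refl
  cons-cong a e (suc v) = e v
  at : ∀ a → Dec (∃ λ X → P (cons a X))
  at a = searchLabelling (λ e → resp (cons-cong a e)) (λ X → P? (cons a X))
  eta : ∀ (X : Labelling (suc n)) {a} → X zero ≡ a → ∀ v → X v ≡ cons a (X ∘ suc) v
  eta X e zero    = e
  eta X e (suc v) = refl
  split : ∀ X a → X zero ≡ a → P X →
          (∃ λ X → P (cons I X)) ⊎ (∃ λ X → P (cons W X)) ⊎ (∃ λ X → P (cons O X))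
  split X I e p = inj₁ (_ , resp (eta X e) p)
  split X W e p = inj₂ (inj₁ (_ , resp (eta X e) p))
  split X O e p = inj₂ (inj₂ (_ , resp (eta X e) p))

-- Sums over vertices and edges

-- The separate clause for one element avoids a trailing zero, so that the inequalities obtained
-- below have exactly the sums that are wanted.
tot : {A : Set} → (A → ℕ) → List A → ℕ
tot f []           = 0
tot f (x ∷ [])     = f x
tot f (x ∷ y ∷ ys) = f x + tot f (y ∷ ys)

tot-+ : {A : Set} (f g : A → ℕ) (xs : List A) → tot (λ x → f x + g x) xs ≡ tot f xs + tot g xs
tot-+ f g []           = refl
tot-+ f g (x ∷ [])     = refl
tot-+ f g (x ∷ y ∷ ys) =
  trans (cong (f x + g x +_) (tot-+ f g (y ∷ ys))) (interchange (f x) (g x) _ _)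

∑ : (Fin n → ℕ) → ℕ
∑ {zero}  f = 0
∑ {suc n} f = f zero + ∑ (f ∘ suc)

∑-+ : (f g : Fin n → ℕ) → ∑ (λ v → f v + g v) ≡ ∑ f + ∑ g
∑-+ {zero}  f g = refl
∑-+ {suc n} f g = trans (cong (f zero + g zero +_) (∑-+ (f ∘ suc) (g ∘ suc))) (interchange (f zero) (g zero) _ _)

∑-mono : {f g : Fin n → ℕ} → (∀ v → f v ≤ g v) → ∑ f ≤ ∑ g
∑-mono {zero}  h = z≤n
∑-mono {suc n} h = +-mono-≤ (h zero) (∑-mono (h ∘ suc))

∑-mono-< : {f g : Fin n → ℕ} → (∀ v → f v ≤ g v) → ∀ v → f v < g v → ∑ f < ∑ g
∑-mono-< h zero    s = +-mono-<-≤ s (∑-mono (h ∘ suc))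
∑-mono-< h (suc v) s = +-mono-≤-< (h zero) (∑-mono-< (h ∘ suc) v s)

∑-cong : {f g : Fin n → ℕ} → (∀ v → f v ≡ g v) → ∑ f ≡ ∑ g
∑-cong {zero}  e = refl
∑-cong {suc n} e = cong₂ _+_ (e zero) (∑-cong (e ∘ suc))

∑-zero : {f : Fin n → ℕ} → (∀ v → f v ≡ 0) → ∑ f ≡ 0
∑-zero {zero}  h = refl
∑-zero {suc n} h = cong₂ _+_ (h zero) (∑-zero (h ∘ suc))

term≤∑ : (f : Fin n → ℕ) (v : Fin n) → f v ≤ ∑ f
term≤∑ f zero    = m≤m+n _ _
term≤∑ f (suc v) = ≤-trans (term≤∑ (f ∘ suc) v) (m≤n+m _ _)

two-terms≤∑ : (f : Fin n → ℕ) {u v : Fin n} → u ≢ v → f u + f v ≤ ∑ f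
two-terms≤∑ f {zero} {zero} ne = contradiction refl ne
two-terms≤∑ f {zero} {suc v} ne = +-monoʳ-≤ (f zero) (term≤∑ (f ∘ suc) v)
two-terms≤∑ f {suc u} {zero} ne =
  ≤-trans (≤-reflexive (+-comm (f (suc u)) _)) (+-monoʳ-≤ (f zero) (term≤∑ (f ∘ suc) u))
two-terms≤∑ f {suc u} {suc v} ne = ≤-trans (two-terms≤∑ (f ∘ suc) (ne ∘ cong suc)) (m≤n+m _ _)

∑-unique : (f : Fin n → ℕ) (u : Fin n) → (∀ v → v ≢ u → f v ≡ 0) → ∑ f ≡ f u
∑-unique f zero h = trans (cong (f zero +_) (∑-zero (λ v → h (suc v) λ ()))) (+-identityʳ _)
∑-unique f (suc u) h =
  cong₂ _+_ (h zero λ ()) (∑-unique (f ∘ suc) u (λ v ne → h (suc v) (ne ∘ Finₚ.suc-injective)))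

∑-positive : (f : Fin n → ℕ) → 0 < ∑ f → ∃ λ v → 0 < f v
∑-positive f p with any? (λ v → 0 <? f v)
... | yes q = q
... | no ¬q = contradiction (∑-zero λ v → n≤0⇒n≡0 (≮⇒≥ λ s → ¬q (v , s))) (>⇒≢ p)

∑-tot : {A : Set} (f : A → Fin n → ℕ) (xs : List A) →
        tot (λ a → ∑ (f a)) xs ≡ ∑ (λ v → tot (λ a → f a v) xs)
∑-tot {n} f []       = sym (∑-zero {n} {λ _ → 0} λ _ → refl)
∑-tot f (x ∷ [])     = refl
∑-tot f (x ∷ y ∷ ys) = trans (cong (∑ (f x) +_) (∑-tot f (y ∷ ys))) (sym (∑-+ (f x) _))

tot-* : {A : Set} (c : ℕ) (f : A → ℕ) (xs : List A) → tot (λ a → c * f a) xs ≡ c * tot f xs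
tot-* c f []           = sym (*-zeroʳ c)
tot-* c f (x ∷ [])     = refl
tot-* c f (x ∷ y ∷ ys) = trans (cong (c * f x +_) (tot-* c f (y ∷ ys))) (sym (*-distribˡ-+ c (f x) _))

E : Graph n → Labelling n → ℕ
E []            X = 0
E ((x , y) ∷ G) X = enters (X x) (X y) + E G X

E-++ : (G H : Graph n) (X : Labelling n) → E (G ++ H) X ≡ E G X + E H X
E-++ []            H X = refl
E-++ ((x , y) ∷ G) H X =
  trans (cong (enters (X x) (X y) +_) (E-++ G H X)) (sym (+-assoc (enters (X x) (X y)) _ _))

E-cong : (G : Graph n) {X Y : Labelling n} → (∀ v → X v ≡ Y v) → E G X ≡ E G Y
E-cong []            e = refl
E-cong ((x , y) ∷ G) e = cong₂ _+_ (cong₂ enters (e x) (e y)) (E-cong G e)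

labels : Vec (Labelling n) r → Fin n → Vec Lab r
labels Xs v = mapᵛ (λ X → X v) Xs

-- An inequality between sums over all vertices or all edges is proved by
-- checking it on every combination of labels permitted by `ok`.
module _ (Xs : Vec (Labelling n) r) (ok : Vec Lab r → Bool) (permitted : ∀ v → T (ok (labels Xs v))) where

  vertexIneq : (c : Fin n → ℕ) (ls rs : List (Vec Lab r → ℕ)) →
               {True (allLabs? λ a → T? (ok a) →-dec (tot (λ q → q a) ls ≤? tot (λ q → q a) rs))} →
               tot (λ q → ∑ λ v → c v * q (labels Xs v)) ls ≤
               tot (λ q → ∑ λ v → c v * q (labels Xs v)) rs
  vertexIneq c ls rs {check} = subst₂ _≤_ (sym (∑-tot term ls)) (sym (∑-tot term rs)) (∑-mono λ v →
    subst₂ _≤_ (sym (tot-* (c v) (λ q → q (labels Xs v)) ls)) (sym (tot-* (c v) (λ q → q (labels Xs v)) rs))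
      (*-monoʳ-≤ (c v) (toWitness check (labels Xs v) (permitted v))))
    where
    term : (Vec Lab r → ℕ) → Fin n → ℕ
    term q v = c v * q (labels Xs v)

  edgeIneq : (G : Graph n) (ls rs : List (Vec Lab r → Lab)) →
             {True (allLabs? λ a → T? (ok a) →-dec allLabs? λ b → T? (ok b) →-dec
               (tot (λ q → enters (q a) (q b)) ls ≤? tot (λ q → enters (q a) (q b)) rs))} →
             tot (λ q → E G (λ v → q (labels Xs v))) ls ≤ tot (λ q → E G (λ v → q (labels Xs v))) rs
  edgeIneq [] ls rs = ≤-reflexive (trans (zeros ls) (sym (zeros rs)))
    where
    zeros : {A : Set} (xs : List A) → tot (λ _ → 0) xs ≡ 0
    zeros []           = refl
    zeros (x ∷ [])     = refl
    zeros (x ∷ y ∷ xs) = zeros (y ∷ xs)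
  edgeIneq ((x , y) ∷ G) ls rs {check} =
    subst₂ _≤_ (sym (tot-+ (cost x y) rest ls)) (sym (tot-+ (cost x y) rest rs))
      (+-mono-≤ (toWitness check (labels Xs x) (permitted x) (labels Xs y) (permitted y))
                (edgeIneq G ls rs {check}))
    where
    cost : Fin n → Fin n → (Vec Lab r → Lab) → ℕ
    cost x y q = enters (q (labels Xs x)) (q (labels Xs y))
    rest : (Vec Lab r → Lab) → ℕ
    rest q = E G (λ v → q (labels Xs v))

-- Extremal labellings and the inclusion order

argmax : {P : Labelling n → Set} → (∀ {X Y} → (∀ v → X v ≡ Y v) → P X → P Y) → (∀ X → Dec (P X)) →
         (μ : Labelling n → ℕ) → (∀ {X Y} → (∀ v → X v ≡ Y v) → μ X ≡ μ Y) →
         (bound : ℕ) → (∀ X → μ X ≤ bound) →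
         ∃ P → ∃ λ X → P X × (∀ Y → P Y → μ Y ≤ μ X)
argmax {n} {P} resp P? μ μ-cong bound μ≤ (X , pX) = climb bound X pX (m≤n+m bound (μ X))
  where
  -- Every improvement raises μ by at least one, so the distance to the bound serves as fuel.
  climb : ∀ fuel X → P X → bound ≤ μ X + fuel → ∃ λ X → P X × (∀ Y → P Y → μ Y ≤ μ X)
  climb fuel X pX enough
    with searchLabelling {P = λ Y → P Y × μ X < μ Y}
           (λ e (p , q) → resp e p , subst (μ X <_) (μ-cong e) q)
           (λ Y → P? Y ×-dec (μ X <? μ Y))
  ... | no none = X , pX , λ Y pY → ≮⇒≥ λ s → none (Y , pY , s)
  climb zero X pX enough | yes (Y , pY , s) =
    contradiction (≤-trans (μ≤ Y) (subst (bound ≤_) (+-identityʳ (μ X)) enough)) (<⇒≱ s)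
  climb (suc fuel) X pX enough | yes (Y , pY , s) =
    climb fuel Y pY (≤-trans enough (≤-trans (≤-reflexive (+-suc (μ X) fuel)) (+-monoˡ-≤ fuel s)))

-- Strictly increasing along `⊴`, so a labelling of largest size among those above a given one is
-- `⊴`-maximal.
size : Labelling n → ℕ
size X = ∑ λ v → rank (X v)

size-cong : {X Y : Labelling n} → (∀ v → X v ≡ Y v) → size X ≡ size Y
size-cong e = ∑-cong λ v → cong rank (e v)

rank≤2 : ∀ a → rank a ≤ 2
rank≤2 I = ≤-refl
rank≤2 W = s≤s z≤n
rank≤2 O = z≤n

size≤ : (X : Labelling n) → size X ≤ ∑ {n} (λ _ → 2)
size≤ X = ∑-mono λ v → rank≤2 (X v)

⊴-size : {X Y : Labelling n} → X ⊴ Y → size Y ≤ size X → Y ⊴ X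
⊴-size X⊴Y s v = ≮⇒≥ λ lt → <⇒≱ (∑-mono-< X⊴Y v lt) s

rank-I : ∀ {a b} → rank a ≤ rank b → a ≡ I → b ≡ I
rank-I {b = I} p refl = refl
rank-I {b = W} (s≤s ()) refl
rank-I {b = O} () refl

rank-O : ∀ {a b} → rank a ≤ rank b → b ≡ O → a ≡ O
rank-O {I} () refl
rank-O {W} () refl
rank-O {O} p refl = refl

rank-W : ∀ {a b} → rank a ≤ rank b → a ≡ W → b ≢ I → b ≡ W
rank-W {b = I} p e ¬I = contradiction refl ¬I
rank-W {b = W} p e ¬I = refl
rank-W {b = O} () refl ¬I

rank-⋎ˡ : ∀ a b → rank a ≤ rank (a ⋎ b)
rank-⋎ˡ I b = ≤-refl
rank-⋎ˡ W I = s≤s z≤n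
rank-⋎ˡ W W = ≤-refl
rank-⋎ˡ W O = ≤-refl
rank-⋎ˡ O b = z≤n

rank-⋎ʳ : ∀ a b → rank b ≤ rank (a ⋎ b)
rank-⋎ʳ I b = rank≤2 b
rank-⋎ʳ W I = ≤-refl
rank-⋎ʳ W W = ≤-refl
rank-⋎ʳ W O = z≤n
rank-⋎ʳ O b = ≤-refl

-- `single u ⊴ X` holds exactly when u is inner in X; this turns "u is inner" into a lower bound for
-- searches.
single : Fin n → Labelling n
single u v with v ≟ u
... | yes _ = I
... | no _  = O

single-⊴ : ∀ {u} {X : Labelling n} → X u ≡ I → single u ⊴ X
single-⊴ {u = u} p v with v ≟ u
... | yes refl = ≤-reflexive (cong rank (sym p))
... | no _     = z≤n

⊴-single : ∀ {u} {X : Labelling n} → single u ⊴ X → X u ≡ I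
⊴-single {u = u} p with u ≟ u | p u
... | yes _ | q  = rank-I q refl
... | no u≢u | _ = contradiction refl u≢u

-- Values of bi-sets under weights, and uncrossing

anything : ∀ {r} → Vec Lab r → Bool
anything _ = true

-- A vertex that is inner in one bi-set and on the wall of the other is inner in neither difference,
-- so uncrossing by differences gains its weight once.
crossing : Lab → Lab → ℕ
crossing I W = 1
crossing W I = 1
crossing _ _ = 0

module Weighted {n : ℕ} (k : ℕ) (G : Graph n) (m : Fin n → ℕ) where

  private
    variable
      X Y Z : Labelling n
      u v w x y : Fin n

  D K M Mo : Labelling n → ℕ
  D X  = E G X
  K X  = ∑ λ v → k * isW (X v)
  M X  = ∑ λ v → m v * isI (X v)
  Mo X = ∑ λ v → m v * isO (X v)

  Cross : Labelling n → Labelling n → ℕ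
  Cross X Y = ∑ λ v → m v * crossing (X v) (Y v)

  -- For the graph obtained by adding a vertex s with m v edges from s to each v,
  -- this is f of the bi-set X, with s outside.
  F : Labelling n → ℕ
  F X = D X + K X + M X

  Valid : Set
  Valid = ∀ X → NonTriv X → 2 * k ≤ F X

  F-cong : (∀ v → X v ≡ Y v) → F X ≡ F Y
  F-cong e = cong₂ _+_ (cong₂ _+_ (E-cong G e) (∑-cong λ v → cong (λ a → k * isW a) (e v)))
                       (∑-cong λ v → cong (λ a → m v * isI a) (e v))

  inner-weight : X v ≡ I → m v ≤ M X
  inner-weight {X} {v} e =
    subst (_≤ M X) (trans (cong (λ a → m v * isI a) e) (*-identityʳ (m v))) (term≤∑ (λ w → m w * isI (X w)) v)

  inner-weight₂ : u ≢ v → X u ≡ I → X v ≡ I → m u + m v ≤ M X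
  inner-weight₂ {u} {v} {X} u≢v p q =
    subst (_≤ M X) (cong₂ _+_ (trans (cong (λ a → m u * isI a) p) (*-identityʳ (m u)))
                              (trans (cong (λ a → m v * isI a) q) (*-identityʳ (m v))))
          (two-terms≤∑ (λ w → m w * isI (X w)) u≢v)

  cross-weight : ∀ X Y v → crossing (X v) (Y v) ≡ 1 → m v ≤ Cross X Y
  cross-weight X Y v e =
    subst (_≤ Cross X Y) (trans (cong (m v *_) e) (*-identityʳ (m v)))
          (term≤∑ (λ w → m w * crossing (X w) (Y w)) v)

  UniqueWall : Labelling n → Set
  UniqueWall X = ∀ {x y} → X x ≡ W → X y ≡ W → x ≡ y

  -- Two wall vertices alone would cost 2k.
  unique-wall : D X + K X < 2 * k → UniqueWall X
  unique-wall {X} small {x} {y} p q with x ≟ y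
  ... | yes x≡y = x≡y
  ... | no x≢y = ⊥-elim (refute (D X ∷ K X ∷ k ∷ [])
      (λ { (d ∷ κ ∷ k ∷ []) → d ⊕ κ ⊕ con 1 ⊑ 2 ⊗ k ∷ k ⊕ k ⊑ κ ∷ [] })
      (1 ∷ 1 ∷ [])
      (subst (_≤ 2 * k) (+-comm 1 (D X + K X)) small)
      (subst (_≤ K X) (cong₂ _+_ (wk p) (wk q)) (two-terms≤∑ (λ v → k * isW (X v)) x≢y)))
    where
    wk : ∀ {v} → X v ≡ W → k * isW (X v) ≡ k
    wk e = trans (cong (λ a → k * isW a) e) (*-identityʳ k)

  K-none : (∀ v → X v ≢ W) → K X ≡ 0
  K-none {X} h = ∑-zero λ v → go v (X v) refl
    where
    go : ∀ v a → X v ≡ a → k * isW (X v) ≡ 0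
    go v I e = trans (cong (λ a → k * isW a) e) (*-zeroʳ k)
    go v W e = contradiction e (h v)
    go v O e = trans (cong (λ a → k * isW a) e) (*-zeroʳ k)

  K-one : UniqueWall X → X x ≡ W → K X ≡ k
  K-one {X} {x} uniq p =
    trans (∑-unique (λ v → k * isW (X v)) x (λ v v≢x → go v v≢x (X v) refl))
          (trans (cong (λ a → k * isW a) p) (*-identityʳ k))
    where
    go : ∀ v → v ≢ x → ∀ a → X v ≡ a → k * isW (X v) ≡ 0
    go v v≢x I e = trans (cong (λ a → k * isW a) e) (*-zeroʳ k)
    go v v≢x W e = contradiction (uniq e p) v≢x
    go v v≢x O e = trans (cong (λ a → k * isW a) e) (*-zeroʳ k)

  K≤k : UniqueWall X → K X ≤ k
  K≤k {X} uniq with any? (λ v → X v ≟ᴸ W)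
  ... | yes (v , e) = ≤-reflexive (K-one uniq e)
  ... | no none     = ≤-trans (≤-reflexive (K-none λ v e → none (v , e))) z≤n

  K-inside : ∀ X → K (inside X) ≡ 0
  K-inside X = K-none λ v → go (X v)
    where
    go : ∀ a → core a ≢ W
    go I ()
    go W ()
    go O ()

  submodular : ∀ X Y → F (meet X Y) + F (join X Y) ≤ F X + F Y
  submodular X Y = ≮⇒≥ (refute
    (D X ∷ D Y ∷ D (meet X Y) ∷ D (join X Y) ∷ K X ∷ K Y ∷ K (meet X Y) ∷ K (join X Y) ∷
     M X ∷ M Y ∷ M (meet X Y) ∷ M (join X Y) ∷ [])
    (λ { (dx ∷ dy ∷ da ∷ db ∷ kx ∷ ky ∷ ka ∷ kb ∷ mx ∷ my ∷ ma ∷ mb ∷ []) →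
      da ⊕ db ⊑ dx ⊕ dy ∷ ka ⊕ kb ⊑ kx ⊕ ky ∷ ma ⊕ mb ⊑ mx ⊕ my ∷
      con 1 ⊕ (dx ⊕ kx ⊕ mx ⊕ (dy ⊕ ky ⊕ my)) ⊑ da ⊕ ka ⊕ ma ⊕ (db ⊕ kb ⊕ mb) ∷ [] })
    (1 ∷ 1 ∷ 1 ∷ 1 ∷ [])
    (edgeIneq Xs anything _ G
      ((λ { (a ∷ b ∷ []) → a ⋏ b }) ∷ (λ { (a ∷ b ∷ []) → a ⋎ b }) ∷ [])
      ((λ { (a ∷ b ∷ []) → a }) ∷ (λ { (a ∷ b ∷ []) → b }) ∷ []))
    (vertexIneq Xs anything _ (λ _ → k)
      ((λ { (a ∷ b ∷ []) → isW (a ⋏ b) }) ∷ (λ { (a ∷ b ∷ []) → isW (a ⋎ b) }) ∷ [])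
      ((λ { (a ∷ b ∷ []) → isW a }) ∷ (λ { (a ∷ b ∷ []) → isW b }) ∷ []))
    (vertexIneq Xs anything _ m
      ((λ { (a ∷ b ∷ []) → isI (a ⋏ b) }) ∷ (λ { (a ∷ b ∷ []) → isI (a ⋎ b) }) ∷ [])
      ((λ { (a ∷ b ∷ []) → isI a }) ∷ (λ { (a ∷ b ∷ []) → isI b }) ∷ [])))
    where
    Xs = X ∷ Y ∷ []

  difference-uncrossing : ∀ X Y →
    F (diff X Y) + F (diff Y X) + (2 * M (meet X Y) + Cross X Y) ≤ F X + F Y
  difference-uncrossing X Y = ≮⇒≥ (refute
    (D X ∷ D Y ∷ D (diff X Y) ∷ D (diff Y X) ∷ K X ∷ K Y ∷ K (diff X Y) ∷ K (diff Y X) ∷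
     M X ∷ M Y ∷ M (diff X Y) ∷ M (diff Y X) ∷ M (meet X Y) ∷ Cross X Y ∷ [])
    (λ { (dx ∷ dy ∷ da ∷ db ∷ kx ∷ ky ∷ ka ∷ kb ∷ mx ∷ my ∷ ma ∷ mb ∷ mm ∷ c ∷ []) →
      da ⊕ db ⊑ dx ⊕ dy ∷ ka ⊕ kb ⊑ kx ⊕ ky ∷ ma ⊕ (mb ⊕ (mm ⊕ (mm ⊕ c))) ⊑ mx ⊕ my ∷
      con 1 ⊕ (dx ⊕ kx ⊕ mx ⊕ (dy ⊕ ky ⊕ my)) ⊑ da ⊕ ka ⊕ ma ⊕ (db ⊕ kb ⊕ mb) ⊕ (2 ⊗ mm ⊕ c) ∷ [] })
    (1 ∷ 1 ∷ 1 ∷ 1 ∷ [])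
    (edgeIneq Xs anything _ G
      ((λ { (a ∷ b ∷ []) → a ⋏ ∁ b }) ∷ (λ { (a ∷ b ∷ []) → b ⋏ ∁ a }) ∷ [])
      ((λ { (a ∷ b ∷ []) → a }) ∷ (λ { (a ∷ b ∷ []) → b }) ∷ []))
    (vertexIneq Xs anything _ (λ _ → k)
      ((λ { (a ∷ b ∷ []) → isW (a ⋏ ∁ b) }) ∷ (λ { (a ∷ b ∷ []) → isW (b ⋏ ∁ a) }) ∷ [])
      ((λ { (a ∷ b ∷ []) → isW a }) ∷ (λ { (a ∷ b ∷ []) → isW b }) ∷ []))
    (vertexIneq Xs anything _ m
      ((λ { (a ∷ b ∷ []) → isI (a ⋏ ∁ b) }) ∷ (λ { (a ∷ b ∷ []) → isI (b ⋏ ∁ a) }) ∷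
       (λ { (a ∷ b ∷ []) → isI (a ⋏ b) }) ∷ (λ { (a ∷ b ∷ []) → isI (a ⋏ b) }) ∷
       (λ { (a ∷ b ∷ []) → crossing a b }) ∷ [])
      ((λ { (a ∷ b ∷ []) → isI a }) ∷ (λ { (a ∷ b ∷ []) → isI b }) ∷ [])))
    where
    Xs = X ∷ Y ∷ []

  TripleWall : Labelling n → Labelling n → Labelling n → ℕ
  TripleWall X Y Z = ∑ λ v → k * (isW (X v) * (isW (Y v) * isW (Z v)))

  -- Only a vertex in all three walls is counted more often on the left.
  triple-uncrossing : ∀ X Y Z →
    F (meet X (meet Y Z)) + F (diff X (join Y Z)) + F (diff Y (join X Z)) + F (diff Z (join X Y)) +
      2 * M (meet X (meet Y Z)) ≤ F X + F Y + F Z + TripleWall X Y Z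
  triple-uncrossing X Y Z = ≮⇒≥ (refute
    (D X ∷ D Y ∷ D Z ∷ D XYZ ∷ D A ∷ D B ∷ D C ∷ K X ∷ K Y ∷ K Z ∷ K XYZ ∷ K A ∷ K B ∷ K C ∷
     M X ∷ M Y ∷ M Z ∷ M XYZ ∷ M A ∷ M B ∷ M C ∷ TripleWall X Y Z ∷ [])
    (λ { (dx ∷ dy ∷ dz ∷ dm ∷ da ∷ db ∷ dc ∷ kx ∷ ky ∷ kz ∷ km ∷ ka ∷ kb ∷ kc ∷
          mx ∷ my ∷ mz ∷ mm ∷ ma ∷ mb ∷ mc ∷ t ∷ []) →
      dm ⊕ (da ⊕ (db ⊕ dc)) ⊑ dx ⊕ (dy ⊕ dz) ∷ km ⊕ (ka ⊕ (kb ⊕ kc)) ⊑ kx ⊕ (ky ⊕ (kz ⊕ t)) ∷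
      mm ⊕ (ma ⊕ (mb ⊕ (mc ⊕ (mm ⊕ mm)))) ⊑ mx ⊕ (my ⊕ mz) ∷
      con 1 ⊕ (dx ⊕ kx ⊕ mx ⊕ (dy ⊕ ky ⊕ my) ⊕ (dz ⊕ kz ⊕ mz) ⊕ t) ⊑
        dm ⊕ km ⊕ mm ⊕ (da ⊕ ka ⊕ ma) ⊕ (db ⊕ kb ⊕ mb) ⊕ (dc ⊕ kc ⊕ mc) ⊕ 2 ⊗ mm ∷ [] })
    (1 ∷ 1 ∷ 1 ∷ 1 ∷ [])
    (edgeIneq Xs anything _ G
      ((λ { (a ∷ b ∷ c ∷ []) → a ⋏ (b ⋏ c) }) ∷ (λ { (a ∷ b ∷ c ∷ []) → a ⋏ ∁ (b ⋎ c) }) ∷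
       (λ { (a ∷ b ∷ c ∷ []) → b ⋏ ∁ (a ⋎ c) }) ∷ (λ { (a ∷ b ∷ c ∷ []) → c ⋏ ∁ (a ⋎ b) }) ∷ [])
      ((λ { (a ∷ b ∷ c ∷ []) → a }) ∷ (λ { (a ∷ b ∷ c ∷ []) → b }) ∷ (λ { (a ∷ b ∷ c ∷ []) → c }) ∷ []))
    (vertexIneq Xs anything _ (λ _ → k)
      ((λ { (a ∷ b ∷ c ∷ []) → isW (a ⋏ (b ⋏ c)) }) ∷ (λ { (a ∷ b ∷ c ∷ []) → isW (a ⋏ ∁ (b ⋎ c)) }) ∷
       (λ { (a ∷ b ∷ c ∷ []) → isW (b ⋏ ∁ (a ⋎ c)) }) ∷ (λ { (a ∷ b ∷ c ∷ []) → isW (c ⋏ ∁ (a ⋎ b)) }) ∷ [])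
      ((λ { (a ∷ b ∷ c ∷ []) → isW a }) ∷ (λ { (a ∷ b ∷ c ∷ []) → isW b }) ∷ (λ { (a ∷ b ∷ c ∷ []) → isW c }) ∷
       (λ { (a ∷ b ∷ c ∷ []) → isW a * (isW b * isW c) }) ∷ []))
    (vertexIneq Xs anything _ m
      ((λ { (a ∷ b ∷ c ∷ []) → isI (a ⋏ (b ⋏ c)) }) ∷ (λ { (a ∷ b ∷ c ∷ []) → isI (a ⋏ ∁ (b ⋎ c)) }) ∷
       (λ { (a ∷ b ∷ c ∷ []) → isI (b ⋏ ∁ (a ⋎ c)) }) ∷ (λ { (a ∷ b ∷ c ∷ []) → isI (c ⋏ ∁ (a ⋎ b)) }) ∷
       (λ { (a ∷ b ∷ c ∷ []) → isI (a ⋏ (b ⋏ c)) }) ∷ (λ { (a ∷ b ∷ c ∷ []) → isI (a ⋏ (b ⋏ c)) }) ∷ [])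
      ((λ { (a ∷ b ∷ c ∷ []) → isI a }) ∷ (λ { (a ∷ b ∷ c ∷ []) → isI b }) ∷ (λ { (a ∷ b ∷ c ∷ []) → isI c }) ∷ [])))
    where
    Xs = X ∷ Y ∷ Z ∷ []
    XYZ = meet X (meet Y Z)
    A = diff X (join Y Z)
    B = diff Y (join X Z)
    C = diff Z (join X Y)

  comp-nonTriv : NonTriv X → NonTriv (comp X)
  comp-nonTriv ((v , p) , (w , q)) = (w , cong ∁ q) , (v , cong ∁ p)

  comp-weight : ∀ X → M (comp X) ≤ Mo X
  comp-weight X = vertexIneq (X ∷ []) anything _ m ((λ { (a ∷ []) → isI (∁ a) }) ∷ []) ((λ { (a ∷ []) → isO a }) ∷ [])

  comp-D : ∀ X → D (comp X) ≤ D X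
  comp-D X = edgeIneq (X ∷ []) anything _ G ((λ { (a ∷ []) → ∁ a }) ∷ []) ((λ { (a ∷ []) → a }) ∷ [])

  comp-K : ∀ X → K (comp X) ≤ K X
  comp-K X = vertexIneq (X ∷ []) anything _ (λ _ → k) ((λ { (a ∷ []) → isW (∁ a) }) ∷ []) ((λ { (a ∷ []) → isW a }) ∷ [])

  weight-split : ∀ X → M X + Mo X + (∑ λ v → m v * isW (X v)) ≤ ∑ m
  weight-split X = subst₂ _≤_ (sym (+-assoc (M X) (Mo X) _)) (∑-cong λ v → *-identityʳ (m v))
    (vertexIneq (X ∷ []) anything _ m
      ((λ { (a ∷ []) → isI a }) ∷ (λ { (a ∷ []) → isO a }) ∷ (λ { (a ∷ []) → isW a }) ∷ [])
      ((λ { (a ∷ []) → 1 }) ∷ []))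

  weight-bound : ∀ X → M X + Mo X ≤ ∑ m
  weight-bound X = m+n≤o⇒m≤o (M X + Mo X) (weight-split X)

  module _ (valid : Valid) where

    -- Reversing a bi-set keeps its entering edges and its wall and exchanges the weight inside with
    -- the weight outside.
    complement-bound : ∀ X → NonTriv X → 2 * k ≤ D X + K X + Mo X
    complement-bound X nt = ≤-trans (valid (comp X) (comp-nonTriv nt))
      (+-mono-≤ (+-mono-≤ (comp-D X) (comp-K X)) (comp-weight X))

    inside-bound : ∀ X → NonTriv X → 2 * k ≤ D (inside X) + M X
    inside-bound X ((v , p) , (w , q)) =
      ≤-trans (valid (inside X) ((v , cong core p) , (w , cong core q)))
        (+-mono-≤ (≤-reflexive (trans (cong (D (inside X) +_) (K-inside X)) (+-identityʳ _)))
          (vertexIneq (X ∷ []) anything _ m ((λ { (a ∷ []) → isI (core a) }) ∷ []) ((λ { (a ∷ []) → isI a }) ∷ [])))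

    outside-bound : ∀ X → NonTriv X → 2 * k ≤ D (outside X) + Mo X
    outside-bound X nt = ≤-trans (inside-bound (comp X) (comp-nonTriv nt)) (+-monoʳ-≤ (D (outside X)) (comp-weight X))

    -- Both bi-sets together cover all vertices, so neither their union nor
    -- X ∖ Y is available for uncrossing; the wall-free bi-sets on the inner set
    -- and on the outside of X take their place.
    covering-pair : ∀ X Y → NonTriv X → NonTriv Y → UniqueWall X → UniqueWall Y →
      (∀ v → X v ≡ I → Y v ≢ O) → (∀ v → X v ≡ O → Y v ≢ O) →
      ∀ a b → F X ≤ 2 * k + a → F Y ≤ 2 * k + b →
      (2 * M X ≤ 2 * a + b × (∀ v → X v ≡ I → Y v ≡ I)) ⊎
      (M X + M (meet X Y) ≤ a + b) ⊎
      (M Y ≤ a + b × (∀ v → X v ≡ I → Y v ≡ I))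
    covering-pair X Y ntX ntY@(_ , (x , Yx≡O)) uX uY IO OO a b FX FY = go
      where
      -- `IO` and `OO` force every vertex outside Y onto the wall of X, which is a single vertex. So
      -- x is the only vertex outside Y, and X pays exactly k for its wall.
      Xx≡W : X x ≡ W
      Xx≡W with X x in e
      ... | I = contradiction Yx≡O (IO x e)
      ... | W = refl
      ... | O = contradiction Yx≡O (OO x e)

      KX : K X ≡ k
      KX = K-one uX Xx≡W

      FX′ : D X + k + M X ≤ 2 * k + a
      FX′ = subst (λ κ → D X + κ + M X ≤ 2 * k + a) KX FX

      not-WI : ∀ {v} → X v ≡ W → Y v ≢ I
      not-WI p q with uX p Xx≡W
      ... | refl with () ← trans (sym q) Yx≡O

      not-WW : ∀ {v} → X v ≡ W → Y v ≢ W
      not-WW p q with uX p Xx≡W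
      ... | refl with () ← trans (sym q) Yx≡O

      Xs = X ∷ Y ∷ []
      go : (2 * M X ≤ 2 * a + b × (∀ v → X v ≡ I → Y v ≡ I)) ⊎
           (M X + M (meet X Y) ≤ a + b) ⊎ (M Y ≤ a + b × (∀ v → X v ≡ I → Y v ≡ I))
      go with any? (λ v → Y v ≟ᴸ W)
      -- Here Y is everything except x. An edge between the inner set and the outside of X lies in
      -- both wall-free cuts and is paid by two copies of `D X`; an edge from either side to x is
      -- paid by `D Y`.
      go | no none = inj₁ (≮⇒≥ (refute
          (D X ∷ D Y ∷ D (inside X) ∷ D (outside X) ∷ M X ∷ M Y ∷ Mo X ∷ k ∷ a ∷ b ∷ [])
          (λ { (dx ∷ dy ∷ di ∷ do′ ∷ mx ∷ my ∷ mo ∷ k ∷ a ∷ b ∷ []) →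
            2 ⊗ k ⊑ di ⊕ mx ∷ 2 ⊗ k ⊑ do′ ⊕ mo ∷ di ⊕ do′ ⊑ dx ⊕ (dx ⊕ dy) ∷ mx ⊕ mo ⊑ my ∷
            dx ⊕ k ⊕ mx ⊑ 2 ⊗ k ⊕ a ∷ dy ⊕ my ⊑ 2 ⊗ k ⊕ b ∷ con 1 ⊕ (2 ⊗ a ⊕ b) ⊑ 2 ⊗ mx ∷ [] })
          (1 ∷ 1 ∷ 1 ∷ 1 ∷ 2 ∷ 1 ∷ 1 ∷ [])
          (inside-bound X ntX) (outside-bound X ntX)
          (edgeIneq Xs ok perm G
            ((λ { (a ∷ b ∷ []) → core a }) ∷ (λ { (a ∷ b ∷ []) → core (∁ a) }) ∷ [])
            ((λ { (a ∷ b ∷ []) → a }) ∷ (λ { (a ∷ b ∷ []) → a }) ∷ (λ { (a ∷ b ∷ []) → b }) ∷ []))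
          (vertexIneq Xs ok perm m
            ((λ { (a ∷ b ∷ []) → isI a }) ∷ (λ { (a ∷ b ∷ []) → isO a }) ∷ [])
            ((λ { (a ∷ b ∷ []) → isI b }) ∷ []))
          FX′
          (subst (λ κ → κ + M Y ≤ 2 * k + b) (trans (cong (D Y +_) (K-none λ v p → none (v , p))) (+-identityʳ _)) FY)) ,
          λ v p → sub v (Y v) refl p)
        where
        sub : ∀ v c → Y v ≡ c → X v ≡ I → Y v ≡ I
        sub v I q p = q
        sub v W q p = contradiction (v , q) none
        sub v O q p = contradiction q (IO v p)
        ok : Vec Lab 2 → Bool
        ok (I ∷ I ∷ []) = true
        ok (W ∷ O ∷ []) = true
        ok (O ∷ I ∷ []) = true
        ok _            = false
        perm′ : ∀ v c d → X v ≡ c → Y v ≡ d → T (ok (c ∷ d ∷ []))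
        perm′ v I I p q = tt
        perm′ v I W p q = none (v , q)
        perm′ v I O p q = IO v p q
        perm′ v W I p q = not-WI p q
        perm′ v W W p q = none (v , q)
        perm′ v W O p q = tt
        perm′ v O I p q = tt
        perm′ v O W p q = none (v , q)
        perm′ v O O p q = OO v p q
        perm : ∀ v → T (ok (labels Xs v))
        perm v = perm′ v _ _ refl refl
      go | yes (y , Yy≡W) = wall-case (X y) refl
        where
        FY′ : D Y + k + M Y ≤ 2 * k + b
        FY′ = subst (λ κ → D Y + κ + M Y ≤ 2 * k + b) (K-one uY Yy≡W) FY
        wall-case : ∀ c → X y ≡ c → (2 * M X ≤ 2 * a + b × (∀ v → X v ≡ I → Y v ≡ I)) ⊎
           (M X + M (meet X Y) ≤ a + b) ⊎ (M Y ≤ a + b × (∀ v → X v ≡ I → Y v ≡ I))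
        wall-case W Xy = contradiction Yy≡W (not-WW Xy)
        -- The outside of X is inner in Y, so its edges to the inner set of X are paid by `D X` and
        -- those to x by `D Y`.
        wall-case I Xy = inj₂ (inj₁ (≮⇒≥ (refute
            (D X ∷ D Y ∷ D (outside X) ∷ M X ∷ M Y ∷ Mo X ∷ M (meet X Y) ∷ k ∷ a ∷ b ∷ [])
            (λ { (dx ∷ dy ∷ do′ ∷ mx ∷ my ∷ mo ∷ mm ∷ k ∷ a ∷ b ∷ []) →
              2 ⊗ k ⊑ do′ ⊕ mo ∷ do′ ⊑ dx ⊕ dy ∷ mo ⊕ mm ⊑ my ∷
              dx ⊕ k ⊕ mx ⊑ 2 ⊗ k ⊕ a ∷ dy ⊕ k ⊕ my ⊑ 2 ⊗ k ⊕ b ∷ con 1 ⊕ (a ⊕ b) ⊑ mx ⊕ mm ∷ [] })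
            (1 ∷ 1 ∷ 1 ∷ 1 ∷ 1 ∷ 1 ∷ [])
            (outside-bound X ntX)
            (edgeIneq Xs ok perm G
              ((λ { (a ∷ b ∷ []) → core (∁ a) }) ∷ [])
              ((λ { (a ∷ b ∷ []) → a }) ∷ (λ { (a ∷ b ∷ []) → b }) ∷ []))
            (vertexIneq Xs ok perm m
              ((λ { (a ∷ b ∷ []) → isO a }) ∷ (λ { (a ∷ b ∷ []) → isI (a ⋏ b) }) ∷ [])
              ((λ { (a ∷ b ∷ []) → isI b }) ∷ []))
            FX′ FY′)))
          where
          ok : Vec Lab 2 → Bool
          ok (I ∷ I ∷ []) = true
          ok (I ∷ W ∷ []) = true
          ok (W ∷ O ∷ []) = true
          ok (O ∷ I ∷ []) = true
          ok _            = false
          not-OW : ∀ {v} → X v ≡ O → Y v ≢ W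
          not-OW p q with uY q Yy≡W
          ... | refl with () ← trans (sym p) Xy
          perm′ : ∀ v c d → X v ≡ c → Y v ≡ d → T (ok (c ∷ d ∷ []))
          perm′ v I I p q = tt
          perm′ v I W p q = tt
          perm′ v I O p q = IO v p q
          perm′ v W I p q = not-WI p q
          perm′ v W W p q = not-WW p q
          perm′ v W O p q = tt
          perm′ v O I p q = tt
          perm′ v O W p q = not-OW p q
          perm′ v O O p q = OO v p q
          perm : ∀ v → T (ok (labels Xs v))
          perm v = perm′ v _ _ refl refl
        -- Mirror image: now the inner set of X is inner in Y, and the cut around it is paid by
        -- `D X` and `D Y` in the same way.
        wall-case O Xy = inj₂ (inj₂ (≮⇒≥ (refute
            (D X ∷ D Y ∷ D (inside X) ∷ M X ∷ M Y ∷ k ∷ a ∷ b ∷ [])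
            (λ { (dx ∷ dy ∷ di ∷ mx ∷ my ∷ k ∷ a ∷ b ∷ []) →
              2 ⊗ k ⊑ di ⊕ mx ∷ di ⊑ dx ⊕ dy ∷
              dx ⊕ k ⊕ mx ⊑ 2 ⊗ k ⊕ a ∷ dy ⊕ k ⊕ my ⊑ 2 ⊗ k ⊕ b ∷ con 1 ⊕ (a ⊕ b) ⊑ my ∷ [] })
            (1 ∷ 1 ∷ 1 ∷ 1 ∷ 1 ∷ [])
            (inside-bound X ntX)
            (edgeIneq Xs ok perm G
              ((λ { (a ∷ b ∷ []) → core a }) ∷ [])
              ((λ { (a ∷ b ∷ []) → a }) ∷ (λ { (a ∷ b ∷ []) → b }) ∷ []))
            FX′ FY′) ,
            λ v p → sub v (Y v) refl p))
          where
          not-IW : ∀ {v} → X v ≡ I → Y v ≢ W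
          not-IW p q with uY q Yy≡W
          ... | refl with () ← trans (sym p) Xy
          sub : ∀ v c → Y v ≡ c → X v ≡ I → Y v ≡ I
          sub v I q p = q
          sub v W q p = contradiction q (not-IW p)
          sub v O q p = contradiction q (IO v p)
          ok : Vec Lab 2 → Bool
          ok (I ∷ I ∷ []) = true
          ok (W ∷ O ∷ []) = true
          ok (O ∷ I ∷ []) = true
          ok (O ∷ W ∷ []) = true
          ok _            = false
          perm′ : ∀ v c d → X v ≡ c → Y v ≡ d → T (ok (c ∷ d ∷ []))
          perm′ v I I p q = tt
          perm′ v I W p q = not-IW p q
          perm′ v I O p q = IO v p q
          perm′ v W I p q = not-WI p q
          perm′ v W W p q = not-WW p q
          perm′ v W O p q = tt
          perm′ v O I p q = tt
          perm′ v O W p q = tt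
          perm′ v O O p q = OO v p q
          perm : ∀ v → T (ok (labels Xs v))
          perm v = perm′ v _ _ refl refl

-- Tight bi-sets, their hulls, and dangerous bi-sets

module Minimal {n : ℕ} (k : ℕ) (2≤k : 2 ≤ k) (G : Graph n) (m : Fin n → ℕ) where

  open Weighted k G m

  private
    variable
      X : Labelling n
      Y : Labelling n
      u v w z : Fin n

  -- Under `Valid`, the bound 2k describes the tight bi-sets and 2k + 1 the dangerous ones.
  Within : ℕ → Labelling n → Set
  Within c X = NonTriv X × F X ≤ c

  Above : Labelling n → ℕ → Labelling n → Set
  Above A c X = A ⊴ X × Within c X

  above? : ∀ A c X → Dec (Above A c X)
  above? A c X = (A ⊴? X) ×-dec (nonTriv? X ×-dec (F X ≤? c))

  above-cong : ∀ {A c X Y} → (∀ v → X v ≡ Y v) → Above A c X → Above A c Y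
  above-cong {c = c} e (p , ((v , q) , (w , r)) , s) =
    (λ v → subst (λ a → _ ≤ rank a) (e v) (p v)) ,
    ((v , trans (sym (e v)) q) , (w , trans (sym (e w)) r)) ,
    subst (_≤ c) (F-cong e) s

  MaximalWithin : ℕ → Labelling n → Set
  MaximalWithin c X = ∀ Y → X ⊴ Y → Within c Y → Y ⊴ X

  enlarge : ∀ c X → Within c X → ∃ λ Y → X ⊴ Y × Within c Y × MaximalWithin c Y
  enlarge c X wX with argmax {P = Above X c} above-cong (above? X c) size size-cong (∑ {n} λ _ → 2) size≤
                        (X , (λ _ → ≤-refl) , wX)
  ... | Y , (X⊴Y , wY) , best =
    Y , X⊴Y , wY , λ Z Y⊴Z wZ → ⊴-size Y⊴Z (best Z (⊴-trans {X = X} {Y} {Z} X⊴Y Y⊴Z , wZ))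

  inner-mono : (∀ v → X v ≡ I → Y v ≡ I) → M X ≤ M Y
  inner-mono {X} {Y} h = ∑-mono λ v → *-monoʳ-≤ (m v) (go v (X v) refl)
    where
    go : ∀ v a → X v ≡ a → isI a ≤ isI (Y v)
    go v I p rewrite h v p = ≤-refl
    go v W p = z≤n
    go v O p = z≤n

  module Tight (valid : Valid) where

    -- Inner weight above the slack leaves less than 2k for edges and wall.
    slack-wall : ∀ a X → F X ≤ 2 * k + a → a < M X → UniqueWall X
    slack-wall a X FX a<M = unique-wall (≰⇒> λ big → refute (D X + K X ∷ M X ∷ 2 * k ∷ a ∷ [])
      (λ { (d ∷ mx ∷ k ∷ a ∷ []) → k ⊑ d ∷ d ⊕ mx ⊑ k ⊕ a ∷ con 1 ⊕ a ⊑ mx ∷ [] }) (1 ∷ 1 ∷ 1 ∷ [])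
      big FX a<M)

    -- If some vertex is outside both outer sets, submodularity against the valid `meet` gives the
    -- bound. Otherwise there is a contradiction: when both differences are non-trivial, the weight
    -- at u makes `difference-uncrossing` demand a slack of 2, while only δ is available; when one
    -- is not, the weights contradict `covering-pair`.
    join-within : ∀ T X δ → δ ≤ 1 → Within (2 * k) T → Within (2 * k + δ) X → δ < M X →
                  0 < m u → T u ≡ I → X u ≡ I → Within (2 * k + δ) (join T X)
    join-within {u} T X δ δ≤1 (ntT , FT) (ntX , FX) δ<MX pos Tu Xu =
      go (any? λ v → (T v ≟ᴸ O) ×-dec (X v ≟ᴸ O))
      where
      FT′ : F T ≤ 2 * k + 0
      FT′ = ≤-trans FT (≤-reflexive (sym (+-identityʳ _)))
      MT : 1 ≤ M T
      MT = ≤-trans pos (inner-weight Tu)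
      M∩ : 1 ≤ M (meet T X)
      M∩ = ≤-trans pos (inner-weight {meet T X} (cong₂ _⋏_ Tu Xu))
      uT = slack-wall 0 T FT′ MT
      uX = slack-wall δ X FX δ<MX
      go : Dec (∃ λ v → T v ≡ O × X v ≡ O) → Within (2 * k + δ) (join T X)
      go (yes (v , Tv , Xv)) = ((u , cong₂ _⋎_ Tu Xu) , (v , cong₂ _⋎_ Tv Xv)) , ≮⇒≥ (refute
        (F T ∷ F X ∷ F (meet T X) ∷ F (join T X) ∷ 2 * k ∷ δ ∷ [])
        (λ { (t ∷ x ∷ a ∷ b ∷ k ∷ δ ∷ []) →
           a ⊕ b ⊑ t ⊕ x ∷ k ⊑ a ∷ t ⊑ k ∷ x ⊑ k ⊕ δ ∷ con 1 ⊕ (k ⊕ δ) ⊑ b ∷ [] })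
        (1 ∷ 1 ∷ 1 ∷ 1 ∷ 1 ∷ [])
        (submodular T X)
        (valid (meet T X) ((u , cong₂ _⋏_ Tu Xu) , (v , cong₂ _⋏_ Tv Xv)))
        FT FX)
      go (no cover) with any? (λ v → (T v ≟ᴸ I) ×-dec (X v ≟ᴸ O)) | any? (λ v → (X v ≟ᴸ I) ×-dec (T v ≟ᴸ O))
      ... | yes (v , Tv , Xv) | yes (w , Xw , Tw) = ⊥-elim (refute
        (F T ∷ F X ∷ F (diff T X) ∷ F (diff X T) ∷ M (meet T X) ∷ Cross T X ∷ 2 * k ∷ δ ∷ [])
        (λ { (t ∷ x ∷ a ∷ b ∷ mm ∷ c ∷ k ∷ δ ∷ []) →
           a ⊕ b ⊕ (2 ⊗ mm ⊕ c) ⊑ t ⊕ x ∷ k ⊑ a ∷ k ⊑ b ∷ t ⊑ k ∷ x ⊑ k ⊕ δ ∷ δ ⊑ con 1 ∷ con 1 ⊑ mm ∷ [] })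
        (1 ∷ 1 ∷ 1 ∷ 1 ∷ 1 ∷ 1 ∷ 2 ∷ [])
        (difference-uncrossing T X)
        (valid (diff T X) ((v , cong₂ (λ a b → a ⋏ ∁ b) Tv Xv) , (u , cong₂ (λ a b → a ⋏ ∁ b) Tu Xu)))
        (valid (diff X T) ((w , cong₂ (λ a b → a ⋏ ∁ b) Xw Tw) , (u , cong₂ (λ a b → a ⋏ ∁ b) Xu Tu)))
        FT FX δ≤1 M∩)
      ... | no ¬IO | _ = ⊥-elim (case (covering-pair valid T X ntT ntX uT uX
              (λ v p q → ¬IO (v , p , q)) (λ v p q → cover (v , p , q)) 0 δ FT′ FX))
        where
        case : _ → ⊥
        case (inj₁ (le , _)) = refute (M T ∷ δ ∷ [])
          (λ { (t ∷ δ ∷ []) → 2 ⊗ t ⊑ δ ∷ δ ⊑ con 1 ∷ con 1 ⊑ t ∷ [] }) (1 ∷ 1 ∷ 2 ∷ []) le δ≤1 MT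
        case (inj₂ (inj₁ le)) = refute (M T ∷ M (meet T X) ∷ δ ∷ [])
          (λ { (t ∷ i ∷ δ ∷ []) → t ⊕ i ⊑ δ ∷ δ ⊑ con 1 ∷ con 1 ⊑ t ∷ con 1 ⊑ i ∷ [] }) (1 ∷ 1 ∷ 1 ∷ 1 ∷ [])
          le δ≤1 MT M∩
        case (inj₂ (inj₂ (le , _))) = <⇒≱ δ<MX le
      ... | yes _ | no ¬OI = ⊥-elim (case (covering-pair valid X T ntX ntT uX uT
              (λ v p q → ¬OI (v , p , q)) (λ v p q → cover (v , q , p)) δ 0 FX FT′))
        where
        case : _ → ⊥
        case (inj₁ (le , _)) = refute (M X ∷ δ ∷ [])
          (λ { (x ∷ δ ∷ []) → 2 ⊗ x ⊑ 2 ⊗ δ ⊕ con 0 ∷ con 1 ⊕ δ ⊑ x ∷ [] }) (1 ∷ 2 ∷ []) le δ<MX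
        case (inj₂ (inj₁ le)) = refute (M X ∷ M (meet X T) ∷ δ ∷ [])
          (λ { (x ∷ i ∷ δ ∷ []) → x ⊕ i ⊑ δ ⊕ con 0 ∷ con 1 ⊕ δ ⊑ x ∷ [] }) (1 ∷ 1 ∷ []) le δ<MX
        case (inj₂ (inj₂ (le , sub))) = refute (M X ∷ M T ∷ δ ∷ [])
          (λ { (x ∷ t ∷ δ ∷ []) → t ⊑ δ ⊕ con 0 ∷ con 1 ⊕ δ ⊑ x ∷ x ⊑ t ∷ [] }) (1 ∷ 1 ∷ 1 ∷ [])
          le δ<MX (inner-mono sub)

    private
      ≤+0 : ∀ {a b} → a ≤ b → a ≤ b + 0
      ≤+0 {a} {b} = subst (a ≤_) (sym (+-identityʳ b))

    tight-wall : ∀ X → Within (2 * k) X → X u ≡ I → 0 < m u → UniqueWall X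
    tight-wall X (_ , FX) Xu pos = slack-wall 0 X (≤+0 FX) (≤-trans pos (inner-weight Xu))

    module Hulls (covered : ∀ v → 0 < m v → ∃ λ T → T v ≡ I × Within (2 * k) T) where

      IsHull : Fin n → Labelling n → Set
      IsHull u T = T u ≡ I × Within (2 * k) T × (∀ Y → Y u ≡ I → Within (2 * k) Y → Y ⊴ T)

      abstract
        -- By `join-within` with slack 0, tight bi-sets with u inside are closed under `join`, so a
        -- maximal one is the greatest.
        hull-exists : ∀ u → ∃ λ T → 0 < m u → IsHull u T
        hull-exists u with 0 <? m u
        -- A dummy for vertices of weight zero, about which nothing is claimed.
        ... | no ¬pos = (λ _ → O) , λ pos → contradiction pos ¬pos
        ... | yes pos with covered u pos
        ... | T₀ , T₀u , w₀ with enlarge (2 * k) T₀ w₀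
        ... | T , T₀⊴T , wT , maxT = T , λ _ → Tu , wT , λ Y Yu wY →
          let wJ = join-within T Y 0 z≤n wT (proj₁ wY , ≤+0 (proj₂ wY)) (≤-trans pos (inner-weight Yu)) pos Tu Yu
              J⊴T = maxT (join T Y) (λ v → rank-⋎ˡ (T v) (Y v)) (proj₁ wJ , subst (F (join T Y) ≤_) (+-identityʳ _) (proj₂ wJ))
          in λ v → ≤-trans (rank-⋎ʳ (T v) (Y v)) (J⊴T v)
          where
          Tu : T u ≡ I
          Tu = rank-I (T₀⊴T u) T₀u

      hull : Fin n → Labelling n
      hull u = proj₁ (hull-exists u)

      hull-∋ : 0 < m u → hull u u ≡ I
      hull-∋ {u} pos = proj₁ (proj₂ (hull-exists u) pos)

      hull-tight : 0 < m u → Within (2 * k) (hull u)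
      hull-tight {u} pos = proj₁ (proj₂ (proj₂ (hull-exists u) pos))

      hull-max : 0 < m u → ∀ Y → Y u ≡ I → Within (2 * k) Y → Y ⊴ hull u
      hull-max {u} pos = proj₂ (proj₂ (proj₂ (hull-exists u) pos))

      hull-wall : 0 < m u → UniqueWall (hull u)
      hull-wall {u} pos = tight-wall (hull u) (hull-tight pos) (hull-∋ pos) pos

      hull-same : 0 < m u → 0 < m v → hull u v ≡ I → (hull v ⊴ hull u) × (hull u ⊴ hull v)
      hull-same {u} {v} pu pv e =
        hull-max pu (hull v) (rank-I (u⊴v u) (hull-∋ pu)) (hull-tight pv) , u⊴v
        where
        u⊴v = hull-max pv (hull u) e (hull-tight pu)

      hull-sym : 0 < m u → 0 < m v → hull u v ≡ I → hull v u ≡ I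
      hull-sym {u} pu pv e = rank-I (proj₂ (hull-same pu pv e) u) (hull-∋ pu)

      Dangerous : Labelling n → Set
      Dangerous X = Within (2 * k + 1) X × MaximalWithin (2 * k + 1) X

      -- The join with the hull is again within 2k + 1, so maximality absorbs it. Weight 2 inside is
      -- what `join-within` asks for at slack 1.
      hull-⊴-dangerous : Dangerous X → 2 ≤ M X → 0 < m v → X v ≡ I → hull v ⊴ X
      hull-⊴-dangerous {X} {v} (wX , maxX) 2≤M pos Xv w =
        ≤-trans (rank-⋎ˡ (hull v w) (X w))
          (maxX (join (hull v) X) (λ w → rank-⋎ʳ (hull v w) (X w))
            (join-within (hull v) X 1 ≤-refl (hull-tight pos) wX 2≤M pos (hull-∋ pos) Xv) w)

      -- If every inner vertex of `hull v` is in the outer set of `hull u`, then v itself is on that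
      -- wall. If both differences are non-trivial, u counts in `Cross` and breaks tightness. So the
      -- inner set of `hull u` may be taken to lie in the outer set of `hull v`. If the inner sets
      -- are disjoint, it lies on the wall of `hull v`, which is u alone. If they meet, either the
      -- join is tight and `hull u` would contain v, or the outer sets cover V and `covering-pair`
      -- refuses.
      wall-of-hull : 0 < m u → 0 < m v → hull u v ≢ I → hull v u ≡ W →
                     hull u v ≡ W ⊎ (∀ w → hull u w ≡ I → w ≡ u)
      wall-of-hull {u} {v} pu pv ¬uv vu with any? (λ w → (hull u w ≟ᴸ O) ×-dec (hull v w ≟ᴸ I))
      ... | no ¬OI = inj₁ (go (hull u v) refl)
        where
        go : ∀ a → hull u v ≡ a → hull u v ≡ W
        go I e = contradiction e ¬uv
        go W e = e
        go O e = contradiction (v , e , hull-∋ pv) ¬OI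
      ... | yes (w , uw , vw) with any? (λ w → (hull u w ≟ᴸ I) ×-dec (hull v w ≟ᴸ O))
      ... | yes (x , ux , vx) = ⊥-elim (refute
        (F U ∷ F V ∷ F (diff U V) ∷ F (diff V U) ∷ M (meet U V) ∷ Cross U V ∷ 2 * k ∷ [])
        (λ { (t ∷ x ∷ a ∷ b ∷ mm ∷ c ∷ k ∷ []) →
           a ⊕ b ⊕ (2 ⊗ mm ⊕ c) ⊑ t ⊕ x ∷ k ⊑ a ∷ k ⊑ b ∷ t ⊑ k ∷ x ⊑ k ∷ con 1 ⊑ c ∷ [] })
        (1 ∷ 1 ∷ 1 ∷ 1 ∷ 1 ∷ 1 ∷ [])
        (difference-uncrossing U V)
        (valid (diff U V) ((x , cong₂ (λ a b → a ⋏ ∁ b) ux vx) , (v , trans (cong (λ b → U v ⋏ ∁ b) (hull-∋ pv)) (⋏-zeroʳ (U v)))))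
        (valid (diff V U) ((w , cong₂ (λ a b → a ⋏ ∁ b) vw uw) , (u , trans (cong (λ b → V u ⋏ ∁ b) (hull-∋ pu)) (⋏-zeroʳ (V u)))))
        (proj₂ (hull-tight pu)) (proj₂ (hull-tight pv))
        (≤-trans pu (cross-weight U V u (cong₂ crossing (hull-∋ pu) vu))))
        where
        U = hull u
        V = hull v
      ... | no ¬IO with any? (λ w → (hull u w ≟ᴸ I) ×-dec (hull v w ≟ᴸ I))
      ... | no ¬II = inj₂ λ w e → go w (hull v w) refl e
        where
        go : ∀ w a → hull v w ≡ a → hull u w ≡ I → w ≡ u
        go w I q p = contradiction (w , p , q) ¬II
        go w W q p = hull-wall pv q vu
        go w O q p = contradiction (w , p , q) ¬IO
      ... | yes (x , ux , vx) with any? (λ w → (hull u w ≟ᴸ O) ×-dec (hull v w ≟ᴸ O))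
      ... | yes (y , uy , vy) = contradiction
        (rank-I (J⊴U v) (trans (cong (U v ⋎_) (hull-∋ pv)) (⋎-zeroʳ (U v)))) ¬uv
        where
        U = hull u
        V = hull v
        J⊴U : join U V ⊴ U
        J⊴U = hull-max pu (join U V) (cong (_⋎ V u) (hull-∋ pu))
          (((x , cong₂ _⋎_ ux vx) , (y , cong₂ _⋎_ uy vy)) , ≮⇒≥ (refute
            (F U ∷ F V ∷ F (meet U V) ∷ F (join U V) ∷ 2 * k ∷ [])
            (λ { (t ∷ x ∷ a ∷ b ∷ k ∷ []) → a ⊕ b ⊑ t ⊕ x ∷ k ⊑ a ∷ t ⊑ k ∷ x ⊑ k ∷ con 1 ⊕ k ⊑ b ∷ [] })
            (1 ∷ 1 ∷ 1 ∷ 1 ∷ 1 ∷ [])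
            (submodular U V) (valid (meet U V) ((x , cong₂ _⋏_ ux vx) , (y , cong₂ _⋏_ uy vy)))
            (proj₂ (hull-tight pu)) (proj₂ (hull-tight pv))))
      ... | no ¬OO = ⊥-elim (case (covering-pair valid (hull u) (hull v) (proj₁ (hull-tight pu)) (proj₁ (hull-tight pv))
             (hull-wall pu) (hull-wall pv) (λ v p q → ¬IO (v , p , q)) (λ v p q → ¬OO (v , p , q)) 0 0
             (≤+0 (proj₂ (hull-tight pu))) (≤+0 (proj₂ (hull-tight pv)))))
        where
        Mu : 1 ≤ M (hull u)
        Mu = ≤-trans pu (inner-weight (hull-∋ pu))
        Mv : 1 ≤ M (hull v)
        Mv = ≤-trans pv (inner-weight (hull-∋ pv))
        case : _ → ⊥
        case (inj₁ (le , _)) = <⇒≱ Mu (≤-trans (m≤m+n _ _) le)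
        case (inj₂ (inj₁ le)) = <⇒≱ Mu (≤-trans (m≤m+n _ _) le)
        case (inj₂ (inj₂ (le , _))) = <⇒≱ Mv le

      -- An edge leaving the inner set of A either enters A or ends at v, and in the latter case it
      -- enters Y, since z is not inner in A. So the cut around the inner set of A is at most
      -- `D A + D Y`. Each of A and Y already spends k on its wall, and the weight of v makes the
      -- total fall below 2k.
      wall-excess : ∀ A Y → Within (2 * k) A → UniqueWall A → A v ≡ W →
        Within (2 * k) Y → UniqueWall Y → 0 < m v → Y v ≡ I → (∀ w → Y w ≡ I → w ≡ v) →
        Y z ≡ W → A z ≢ I → ⊥
      wall-excess {v} {z} A Y (ntA , FA) uA Av (ntY , FY) uY pos Yv only Yz Az = refute
        (D A ∷ D Y ∷ D (inside A) ∷ M A ∷ M Y ∷ k ∷ [])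
        (λ { (da ∷ dy ∷ di ∷ ma ∷ my ∷ k ∷ []) →
          2 ⊗ k ⊑ di ⊕ ma ∷ di ⊑ da ⊕ dy ∷ da ⊕ k ⊕ ma ⊑ 2 ⊗ k ∷ dy ⊕ k ⊕ my ⊑ 2 ⊗ k ∷ con 1 ⊑ my ∷ [] })
        (1 ∷ 1 ∷ 1 ∷ 1 ∷ 1 ∷ [])
        (inside-bound valid A ntA)
        (edgeIneq (A ∷ Y ∷ []) ok (λ w → perm w _ _ refl refl) G
          ((λ { (a ∷ b ∷ []) → core a }) ∷ [])
          ((λ { (a ∷ b ∷ []) → a }) ∷ (λ { (a ∷ b ∷ []) → b }) ∷ []))
        (subst (λ κ → D A + κ + M A ≤ 2 * k) (K-one uA Av) FA)
        (subst (λ κ → D Y + κ + M Y ≤ 2 * k) (K-one uY Yz) FY)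
        (≤-trans pos (inner-weight Yv))
        where
        ok : Vec Lab 2 → Bool
        ok (W ∷ I ∷ []) = true
        ok (I ∷ O ∷ []) = true
        ok (O ∷ O ∷ []) = true
        ok (O ∷ W ∷ []) = true
        ok _            = false
        not-I : ∀ {w a} → A w ≡ a → Y w ≡ I → a ≡ W
        not-I p q with only _ q
        ... | refl = trans (sym p) Av
        at-v : ∀ {w b} → A w ≡ W → Y w ≡ b → b ≡ I
        at-v p q with uA p Av
        ... | refl = trans (sym q) Yv
        perm : ∀ w a b → A w ≡ a → Y w ≡ b → T (ok (a ∷ b ∷ []))
        perm w I I p q with () ← not-I p q
        perm w I W p q with uY q Yz
        ... | refl = Az p
        perm w I O p q = tt
        perm w W I p q = tt
        perm w W W p q with () ← at-v p q
        perm w W O p q with () ← at-v p q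
        perm w O I p q with () ← not-I p q
        perm w O W p q = tt
        perm w O O p q = tt

-- Obstacles to splitting off a pair

module Splitting {n : ℕ} (k : ℕ) (2≤k : 2 ≤ k) (G : Graph n) (m : Fin n → ℕ)
  (valid : Weighted.Valid k G m)
  (covered : ∀ v → 0 < m v → ∃ λ T → T v ≡ I × Minimal.Within k 2≤k G m (2 * k) T) where

  open Weighted k G m
  open Minimal k 2≤k G m
  open Tight valid
  open Hulls covered

  private
    variable
      X : Labelling n
      Y : Labelling n
      u v w z : Fin n

  -- The hulls of q and r have t on their walls. The wall of `hull t` cannot contain both q and r,
  -- so `wall-of-hull` makes t the only inner vertex of `hull t`. If `hull t` has a wall vertex z,
  -- then z is not inner in A or not inner in C, and `wall-excess` applies. If it has none, edges
  -- from the inner sets of A and C to t enter `hull t`; the two wall-free cuts need 4k in total,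
  -- but A, C and `hull t` offer at most k, k and 2k before their inner weights are deducted, and t
  -- has weight.
  no-common-wall : ∀ {t q r} A C → Within (2 * k) A → Within (2 * k) C → 0 < m t → A t ≡ W → C t ≡ W →
    (∀ v → A v ≡ I → C v ≢ I) → 0 < m q → 0 < m r → A q ≡ I → C r ≡ I → hull q t ≢ I → hull r t ≢ I → ⊥
  no-common-wall {t} {q} {r} A C wA wC pt At Ct disjoint pq pr Aq Cr ¬qt ¬rt = go (any? λ z → hull t z ≟ᴸ W)
    where
    on-wall : ∀ {q} A → Within (2 * k) A → 0 < m q → A q ≡ I → A t ≡ W → hull q t ≢ I → hull q t ≡ W
    on-wall {q} A wA pq Aq At ¬qt = rank-W (hull-max pq A Aq wA t) At ¬qt
    uA = tight-wall A wA Aq pq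
    uC = tight-wall C wC Cr pr
    only : ∀ w → hull t w ≡ I → w ≡ t
    only with wall-of-hull pt pq (λ e → ¬qt (hull-sym pt pq e)) (on-wall A wA pq Aq At ¬qt)
            | wall-of-hull pt pr (λ e → ¬rt (hull-sym pt pr e)) (on-wall C wC pr Cr Ct ¬rt)
    ... | inj₂ o | _ = o
    ... | inj₁ _ | inj₂ o = o
    ... | inj₁ e | inj₁ e′ with hull-wall pt e e′
    ... | refl = contradiction Cr (disjoint q Aq)
    go : Dec (∃ λ z → hull t z ≡ W) → ⊥
    go (yes (z , tz)) with A z ≟ᴸ I
    ... | no Az = wall-excess A (hull t) wA uA At (hull-tight pt) (hull-wall pt) pt (hull-∋ pt) only tz Az
    ... | yes Az = wall-excess C (hull t) wC uC Ct (hull-tight pt) (hull-wall pt) pt (hull-∋ pt) only tz (disjoint z Az)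
    go (no none) = refute
      (D A ∷ D C ∷ D (hull t) ∷ D (inside A) ∷ D (inside C) ∷ M A ∷ M C ∷ M (hull t) ∷ k ∷ [])
      (λ { (da ∷ dc ∷ dt ∷ dia ∷ dic ∷ ma ∷ mc ∷ mt ∷ k ∷ []) →
        2 ⊗ k ⊑ dia ⊕ ma ∷ 2 ⊗ k ⊑ dic ⊕ mc ∷ dia ⊕ dic ⊑ da ⊕ (dc ⊕ dt) ∷
        da ⊕ k ⊕ ma ⊑ 2 ⊗ k ∷ dc ⊕ k ⊕ mc ⊑ 2 ⊗ k ∷ dt ⊕ mt ⊑ 2 ⊗ k ∷ con 1 ⊑ mt ∷ [] })
      (1 ∷ 1 ∷ 1 ∷ 1 ∷ 1 ∷ 1 ∷ 1 ∷ [])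
      (inside-bound valid A (proj₁ wA)) (inside-bound valid C (proj₁ wC))
      (edgeIneq (A ∷ C ∷ hull t ∷ []) ok (λ w → perm w _ _ _ refl refl refl) G
        ((λ { (a ∷ b ∷ c ∷ []) → core a }) ∷ (λ { (a ∷ b ∷ c ∷ []) → core b }) ∷ [])
        ((λ { (a ∷ b ∷ c ∷ []) → a }) ∷ (λ { (a ∷ b ∷ c ∷ []) → b }) ∷ (λ { (a ∷ b ∷ c ∷ []) → c }) ∷ []))
      (subst (λ κ → D A + κ + M A ≤ 2 * k) (K-one uA At) (proj₂ wA))
      (subst (λ κ → D C + κ + M C ≤ 2 * k) (K-one uC Ct) (proj₂ wC))
      (subst (λ κ → κ + M (hull t) ≤ 2 * k)
        (trans (cong (D (hull t) +_) (K-none λ z e → none (z , e))) (+-identityʳ _)) (proj₂ (hull-tight pt)))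
      (≤-trans pt (inner-weight (hull-∋ pt)))
      where
      ok : Vec Lab 3 → Bool
      ok (W ∷ W ∷ I ∷ []) = true
      ok (I ∷ O ∷ O ∷ []) = true
      ok (O ∷ I ∷ O ∷ []) = true
      ok (O ∷ O ∷ O ∷ []) = true
      ok _                = false
      perm : ∀ w a b c → A w ≡ a → C w ≡ b → hull t w ≡ c → T (ok (a ∷ b ∷ c ∷ []))
      perm w a b c p q e with w ≟ t
      perm w a b c p q e | yes refl with refl ← trans (sym p) At | refl ← trans (sym q) Ct
                                      | refl ← trans (sym e) (hull-∋ pt) = tt
      perm w W b c p q e | no w≢t = contradiction (uA p At) w≢t
      perm w a W c p q e | no w≢t = contradiction (uC q Ct) w≢t
      perm w a b I p q e | no w≢t = contradiction (only w e) w≢t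
      perm w a b W p q e | no w≢t = contradiction (w , e) none
      perm w I I O p q e | no w≢t = contradiction q (disjoint w p)
      perm w I O O p q e | no w≢t = tt
      perm w O I O p q e | no w≢t = tt
      perm w O O O p q e | no w≢t = tt

  -- For such a u, only dangerous bi-sets prevent splitting off u together with a
  -- vertex outside the outer set of its hull.
  WallsMutual : Fin n → Set
  WallsMutual u = ∀ v → 0 < m v → hull u v ≢ I → hull v u ≡ W → hull u v ≡ W

  -- If u fails because of v, then `wall-of-hull` makes u the only inner vertex of its hull, and u
  -- is on the wall of `hull v`. Now v works: a failure caused by w would make v the only inner
  -- vertex of `hull v`. Then either u is inner in `hull w`, which forces w = u and is no failure,
  -- or `wall-excess` applies to `hull w` and `hull v`.
  mutual-exists : 0 < m u → ∃ λ u → 0 < m u × WallsMutual u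
  mutual-exists {u} pu
    with any? (λ v → (0 <? m v) ×-dec (¬? (hull u v ≟ᴸ I) ×-dec ((hull v u ≟ᴸ W) ×-dec ¬? (hull u v ≟ᴸ W))))
  ... | no none = u , pu , λ v pv ¬I vu → decidable-stable (hull u v ≟ᴸ W) λ ¬W → none (v , pv , ¬I , vu , ¬W)
  ... | yes (v , pv , ¬I , vu , ¬W) with wall-of-hull pu pv ¬I vu
  ... | inj₁ e = contradiction e ¬W
  ... | inj₂ only-u = v , pv , good
    where
    good : WallsMutual v
    good w pw ¬vw wv with wall-of-hull pv pw ¬vw wv
    ... | inj₁ e = e
    ... | inj₂ only-v with hull w u ≟ᴸ I
    ... | yes wu with only-u w (hull-sym pw pu wu)
    ... | refl = vu
    good w pw ¬vw wv | inj₂ only-v | no ¬wu = ⊥-elim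
      (wall-excess (hull w) (hull v) (hull-tight pw) (hull-wall pw) wv (hull-tight pv) (hull-wall pv)
                   pv (hull-∋ pv) only-v vu ¬wu)

  -- Exactly the label patterns at u and v for which trading the two edges at s for the edge uv
  -- lowers the value: by 2 if both are inner, by 1 if one is inner and the other on the wall.
  Blocked : Fin n → Fin n → Set
  Blocked u v = (∃ λ X → Within (2 * k + 1) X × X u ≡ I × X v ≡ I) ⊎
                (∃ λ X → Within (2 * k) X × X u ≡ I × X v ≡ W) ⊎
                (∃ λ X → Within (2 * k) X × X v ≡ I × X u ≡ W)

  -- Compare the value of X with `complement-bound`. Up to the slack, no such bi-set holds more than
  -- half of the total weight.
  balance : ∀ a X → Within (2 * k + a) X → M X ≤ Mo X + a
  balance a X (nt , FX) = ≮⇒≥ (refute (D X + K X ∷ M X ∷ Mo X ∷ 2 * k ∷ a ∷ [])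
    (λ { (d ∷ mi ∷ mo ∷ k ∷ a ∷ []) → k ⊑ d ⊕ mo ∷ d ⊕ mi ⊑ k ⊕ a ∷ con 1 ⊕ (mo ⊕ a) ⊑ mi ∷ [] })
    (1 ∷ 1 ∷ 1 ∷ []) (complement-bound valid X nt) FX)

  blocked-cases : 0 < m u → 0 < m v → hull u v ≢ I → Blocked u v →
                  (∃ λ X → Within (2 * k + 1) X × X u ≡ I × X v ≡ I) ⊎ hull u v ≡ W ⊎ hull v u ≡ W
  blocked-cases pu pv ¬uv (inj₁ b) = inj₁ b
  blocked-cases {u} {v} pu pv ¬uv (inj₂ (inj₁ (X , wX , Xu , Xv))) =
    inj₂ (inj₁ (rank-W (hull-max pu X Xu wX v) Xv ¬uv))
  blocked-cases {u} {v} pu pv ¬uv (inj₂ (inj₂ (X , wX , Xv , Xu))) =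
    inj₂ (inj₂ (rank-W (hull-max pv X Xv wX u) Xu (λ e → ¬uv (hull-sym pv pu e))))

  dangerous-hull : ∀ X → Within (2 * k + 1) X → ∃ λ Y → X ⊴ Y × Dangerous Y
  dangerous-hull X wX with enlarge (2 * k + 1) X wX
  ... | Y , X⊴Y , wY , maxY = Y , X⊴Y , wY , maxY

  two-inner : u ≢ v → 0 < m u → 0 < m v → X u ≡ I → X v ≡ I → 2 ≤ M X
  two-inner u≢v pu pv Xu Xv = ≤-trans (+-mono-≤ pu pv) (inner-weight₂ u≢v Xu Xv)

  differences-weight : ∀ {X Y Z} → (∀ {x} → X x ≡ I → Y x ≡ O → Z x ≡ I) → (∀ {x} → Y x ≡ I → X x ≡ O → Z x ≡ I) →
                       M (diff X Y) + M (diff Y X) ≤ M Z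
  differences-weight {X} {Y} {Z} X∖Y⊴Z Y∖X⊴Z =
    vertexIneq (X ∷ Y ∷ Z ∷ []) ok (λ x → perm x _ _ _ refl refl refl) m
      ((λ { (a ∷ b ∷ c ∷ []) → isI (a ⋏ ∁ b) }) ∷ (λ { (a ∷ b ∷ c ∷ []) → isI (b ⋏ ∁ a) }) ∷ [])
      ((λ { (a ∷ b ∷ c ∷ []) → isI c }) ∷ [])
    where
    ok : Vec Lab 3 → Bool
    ok (I ∷ O ∷ I ∷ []) = true
    ok (I ∷ O ∷ _ ∷ []) = false
    ok (O ∷ I ∷ I ∷ []) = true
    ok (O ∷ I ∷ _ ∷ []) = false
    ok _                = true
    perm : ∀ x a b c → X x ≡ a → Y x ≡ b → Z x ≡ c → T (ok (a ∷ b ∷ c ∷ []))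
    perm x I O I p q r = tt
    perm x I O W p q r with () ← trans (sym r) (X∖Y⊴Z p q)
    perm x I O O p q r with () ← trans (sym r) (X∖Y⊴Z p q)
    perm x O I I p q r = tt
    perm x O I W p q r with () ← trans (sym r) (Y∖X⊴Z q p)
    perm x O I O p q r with () ← trans (sym r) (Y∖X⊴Z q p)
    perm x I I c p q r = tt
    perm x I W c p q r = tt
    perm x W b c p q r = tt
    perm x O W c p q r = tt
    perm x O O c p q r = tt

  outer-positive : ∀ X → 0 < Mo X → ∃ λ v → 0 < m v × X v ≡ O
  outer-positive X pos with ∑-positive (λ v → m v * isO (X v)) pos
  ... | v , p = v , go (X v) refl p
    where
    go : ∀ a → X v ≡ a → 0 < m v * isO (X v) → 0 < m v × X v ≡ O
    go I e p = contradiction (subst (λ a → 0 < m v * isO a) e p) (λ p → <-irrefl (sym (*-zeroʳ (m v))) p)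
    go W e p = contradiction (subst (λ a → 0 < m v * isO a) e p) (λ p → <-irrefl (sym (*-zeroʳ (m v))) p)
    go O e p = subst (0 <_) (*-identityʳ (m v)) (subst (λ a → 0 < m v * isO a) e p) , e

  -- Dangerous bi-sets around u when no pair can be split

  module AllBlocked (4≤m : 4 ≤ ∑ m) (blocked : ∀ u v → u ≢ v → 0 < m u → 0 < m v → Blocked u v)
                    (u : Fin n) (pu : 0 < m u) (mutual-walls : WallsMutual u) where

    Target : Fin n → Set
    Target v = 0 < m v × hull u v ≡ O

    target? : ∀ v → Dec (Target v)
    target? v = (0 <? m v) ×-dec (hull u v ≟ᴸ O)

    target≢u : Target v → u ≢ v
    target≢u (_ , uv) refl with () ← trans (sym uv) (hull-∋ pu)

    Around : Labelling n → Set
    Around X = Dangerous X × X u ≡ I × ∃ λ v → Target v × X v ≡ I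

    around-2≤ : Around X → 2 ≤ M X
    around-2≤ (_ , Xu , v , tv , Xv) = two-inner (target≢u tv) pu (proj₁ tv) Xu Xv

    around-wall : Around X → UniqueWall X
    around-wall {X} aX@(((_ , FX) , _) , _) = slack-wall 1 X FX (around-2≤ aX)

    around-hull : Around X → 0 < m v → X v ≡ I → hull v ⊴ X
    around-hull aX@(dX , _) = hull-⊴-dangerous dX (around-2≤ aX)

    -- A tight obstacle would put v on the wall of `hull u`, or u on the wall of `hull v` and hence,
    -- by the choice of u, again v on the wall of `hull u`. But v is outside that hull, so the
    -- obstacle is dangerous and can be enlarged.
    reach : Target v → ∃ λ X → Around X × X v ≡ I
    reach {v} tv@(pv , uv) with blocked-cases pu pv (λ e → O≢I (trans (sym uv) e)) (blocked u v (target≢u tv) pu pv)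
      where
      O≢I : O ≢ I
      O≢I ()
    ... | inj₂ (inj₁ e) with () ← trans (sym uv) e
    ... | inj₂ (inj₂ e) with () ← trans (sym uv) (mutual-walls v pv (λ i → case trans (sym uv) i of λ ()) e)
    ... | inj₁ (X , wX , Xu , Xv) with dangerous-hull X wX
    ... | Y , X⊴Y , dY = Y , (dY , rank-I (X⊴Y u) Xu , v , tv , rank-I (X⊴Y v) Xv) , rank-I (X⊴Y v) Xv

    -- By `balance` some weight is outside X, and since `hull u ⊴ X` it belongs to a target.
    misses : Around X → ∃ λ v → Target v × X v ≢ I
    misses {X} aX@((wX , _) , Xu , _)
      with outer-positive X (+-cancelʳ-< 1 0 (Mo X) (≤-trans (around-2≤ aX) (balance 1 X wX)))
    ... | v , pv , Xv = v , (pv , rank-O (around-hull aX pu Xu v) Xv) , λ e → case trans (sym Xv) e of λ ()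

    -- X ∖ Y is non-trivial: otherwise v is in the wall of Y, and uncrossing
    -- X, Y by union and intersection puts v into the hull of u.
    difference-inhabited : Around X → Around Y → Target v → X v ≡ I → Y v ≢ I →
                           Target w → Y w ≡ I → X w ≢ I → ∃ λ z → X z ≡ I × Y z ≡ O
    difference-inhabited {X} {Y} {v} {w} aX@((wX@(ntX , FX) , maxX) , Xu , _) aY@((wY@(ntY , FY) , _) , Yu , _)
                         tv Xv ¬Yv tw Yw ¬Xw
      with any? (λ z → (X z ≟ᴸ I) ×-dec (Y z ≟ᴸ O))
    ... | yes e = e
    ... | no ¬IO with any? (λ z → (X z ≟ᴸ O) ×-dec (Y z ≟ᴸ O))
    ... | no ¬OO = ⊥-elim (case covering-pair valid X Y ntX ntY (around-wall aX) (around-wall aY)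
                             (λ v p q → ¬IO (v , p , q)) (λ v p q → ¬OO (v , p , q)) 1 1 FX FY of λ
        { (inj₁ (_ , sub)) → ¬Yv (sub v Xv)
        ; (inj₂ (inj₂ (_ , sub))) → ¬Yv (sub v Xv)
        ; (inj₂ (inj₁ le)) → <⇒≱ (+-mono-≤ (around-2≤ aX)
            (≤-trans pu (inner-weight {meet X Y} (cong₂ _⋏_ Xu Yu)))) le })
    ... | yes (y , Xy , Yy) = ⊥-elim (go (F (join X Y) ≤? 2 * k + 1))
      where
      Yv : Y v ≡ W
      Yv with Y v in e
      ... | I = contradiction refl ¬Yv
      ... | W = refl
      ... | O = contradiction (v , Xv , e) ¬IO
      go : Dec (F (join X Y) ≤ 2 * k + 1) → ⊥
      go (yes le) = ¬Xw (rank-I (maxX (join X Y) (λ z → rank-⋎ˡ (X z) (Y z))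
        (((u , cong (_⋎ Y u) Xu) , (y , cong₂ _⋎_ Xy Yy)) , le) w)
        (rank-I (rank-⋎ʳ (X w) (Y w)) Yw))
      go (no big) = 1+n≰n (subst₂ (λ a b → rank a ≤ rank b) (cong₂ _⋏_ Xv Yv) (proj₂ tv) (meet⊴ v))
        where
        meet⊴ : meet X Y ⊴ hull u
        meet⊴ = hull-max pu (meet X Y) (cong₂ _⋏_ Xu Yu)
          (((u , cong₂ _⋏_ Xu Yu) , (y , cong₂ _⋏_ Xy Yy)) , ≮⇒≥ (refute
            (F X ∷ F Y ∷ F (meet X Y) ∷ F (join X Y) ∷ 2 * k ∷ [])
            (λ { (x ∷ y ∷ a ∷ b ∷ k ∷ []) →
              a ⊕ b ⊑ x ⊕ y ∷ x ⊑ k ⊕ con 1 ∷ y ⊑ k ⊕ con 1 ∷ con 1 ⊕ (k ⊕ con 1) ⊑ b ∷ con 1 ⊕ k ⊑ a ∷ [] })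
            (1 ∷ 1 ∷ 1 ∷ 1 ∷ 1 ∷ [])
            (submodular X Y) FX FY (≰⇒> big)))

    record Crossed (X Y : Labelling n) : Set where
      field
        diffˡ  : Within (2 * k) (diff X Y)
        diffʳ  : Within (2 * k) (diff Y X)
        sepˡ   : 0 < m v → X v ≡ I → Y v ≢ I → Y v ≡ O
        sepʳ   : 0 < m v → Y v ≡ I → X v ≢ I → X v ≡ O
        common : 0 < m v → X v ≡ I → Y v ≡ I → v ≡ u
        meet≤1 : M (meet X Y) ≤ 1

    -- The values of X and Y exceed 4k by at most 2 in total, and the weight of u in both inner sets
    -- uses up 2. So equality holds throughout: the differences are tight, the common inner weight
    -- is 1, and no vertex of positive weight is inner in one and on the wall of the other.
    crossed : Around X → Around Y → Target v → X v ≡ I → Y v ≢ I →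
              Target w → Y w ≡ I → X w ≢ I → Crossed X Y
    crossed {X} {Y} aX@((wX@(ntX , FX) , maxX) , Xu , _) aY@((wY@(ntY , FY) , _) , Yu , _)
            tv Xv ¬Yv tw Yw ¬Xw
      with difference-inhabited aX aY tv Xv ¬Yv tw Yw ¬Xw | difference-inhabited aY aX tw Yw ¬Xw tv Xv ¬Yv
    ... | a , Xa , Ya | b , Yb , Xb = record
      { diffˡ = nt₁ , ≮⇒≥ (refute vars
          (λ { (x ∷ y ∷ a ∷ b ∷ mm ∷ c ∷ k ∷ []) → a ⊕ b ⊕ (2 ⊗ mm ⊕ c) ⊑ x ⊕ y ∷ k ⊑ b ∷
            x ⊑ k ⊕ con 1 ∷ y ⊑ k ⊕ con 1 ∷ con 1 ⊑ mm ∷ con 1 ⊕ k ⊑ a ∷ [] })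
          (1 ∷ 1 ∷ 1 ∷ 1 ∷ 2 ∷ 1 ∷ []) unc (valid _ nt₂) FX FY M∩)
      ; diffʳ = nt₂ , ≮⇒≥ (refute vars
          (λ { (x ∷ y ∷ a ∷ b ∷ mm ∷ c ∷ k ∷ []) → a ⊕ b ⊕ (2 ⊗ mm ⊕ c) ⊑ x ⊕ y ∷ k ⊑ a ∷
            x ⊑ k ⊕ con 1 ∷ y ⊑ k ⊕ con 1 ∷ con 1 ⊑ mm ∷ con 1 ⊕ k ⊑ b ∷ [] })
          (1 ∷ 1 ∷ 1 ∷ 1 ∷ 2 ∷ 1 ∷ []) unc (valid _ nt₁) FX FY M∩)
      ; sepˡ = λ {v} pv Xv ¬Yv → sep (Y v) refl ¬Yv (λ Yv → no-cross v pv (cong₂ crossing Xv Yv))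
      ; sepʳ = λ {v} pv Yv ¬Xv → sep (X v) refl ¬Xv (λ Xv → no-cross v pv (cong₂ crossing Xv Yv))
      ; common = λ {v} pv Xv Yv → decidable-stable (v ≟ u) λ v≢u → refute vars
          (λ { (x ∷ y ∷ a ∷ b ∷ mm ∷ c ∷ k ∷ []) → a ⊕ b ⊕ (2 ⊗ mm ⊕ c) ⊑ x ⊕ y ∷ k ⊑ a ∷ k ⊑ b ∷
            x ⊑ k ⊕ con 1 ∷ y ⊑ k ⊕ con 1 ∷ con 2 ⊑ mm ∷ [] })
          (1 ∷ 1 ∷ 1 ∷ 1 ∷ 1 ∷ 2 ∷ []) unc (valid _ nt₁) (valid _ nt₂) FX FY
          (two-inner {X = meet X Y} v≢u pv pu (cong₂ _⋏_ Xv Yv) (cong₂ _⋏_ Xu Yu))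
      ; meet≤1 = ≮⇒≥ (refute vars
          (λ { (x ∷ y ∷ a ∷ b ∷ mm ∷ c ∷ k ∷ []) → a ⊕ b ⊕ (2 ⊗ mm ⊕ c) ⊑ x ⊕ y ∷ k ⊑ a ∷ k ⊑ b ∷
            x ⊑ k ⊕ con 1 ∷ y ⊑ k ⊕ con 1 ∷ con 2 ⊑ mm ∷ [] })
          (1 ∷ 1 ∷ 1 ∷ 1 ∷ 1 ∷ 2 ∷ []) unc (valid _ nt₁) (valid _ nt₂) FX FY)
      }
      where
      nt₁ : NonTriv (diff X Y)
      nt₁ = (a , cong₂ (λ a b → a ⋏ ∁ b) Xa Ya) , (u , cong₂ (λ a b → a ⋏ ∁ b) Xu Yu)
      nt₂ : NonTriv (diff Y X)
      nt₂ = (b , cong₂ (λ a b → a ⋏ ∁ b) Yb Xb) , (u , cong₂ (λ a b → a ⋏ ∁ b) Yu Xu)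
      vars = F X ∷ F Y ∷ F (diff X Y) ∷ F (diff Y X) ∷ M (meet X Y) ∷ Cross X Y ∷ 2 * k ∷ []
      unc = difference-uncrossing X Y
      M∩ : 1 ≤ M (meet X Y)
      M∩ = ≤-trans pu (inner-weight {meet X Y} (cong₂ _⋏_ Xu Yu))
      no-cross : ∀ v → 0 < m v → crossing (X v) (Y v) ≢ 1
      no-cross v pv e = refute vars
          (λ { (x ∷ y ∷ a ∷ b ∷ mm ∷ c ∷ k ∷ []) → a ⊕ b ⊕ (2 ⊗ mm ⊕ c) ⊑ x ⊕ y ∷ k ⊑ a ∷ k ⊑ b ∷
            x ⊑ k ⊕ con 1 ∷ y ⊑ k ⊕ con 1 ∷ con 1 ⊑ mm ∷ con 1 ⊑ c ∷ [] })
          (1 ∷ 1 ∷ 1 ∷ 1 ∷ 1 ∷ 2 ∷ 1 ∷ []) unc (valid _ nt₁) (valid _ nt₂) FX FY M∩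
          (≤-trans pv (cross-weight X Y v e))
      sep : ∀ a {b} → b ≡ a → b ≢ I → b ≢ W → b ≡ O
      sep I e ¬I ¬W = contradiction e ¬I
      sep W e ¬I ¬W = contradiction e ¬W
      sep O e ¬I ¬W = e

    μ : Labelling n → ℕ
    μ X = ∑ λ v → m v * (isI (X v) * isO (hull u v))

    Heavy : Labelling n → Set
    Heavy X = ∀ Z → Around Z → μ Z ≤ μ X

    -- `⊴`-maximality alone does not prevent all targets inside X from being inside Y as well.
    -- Comparing the target weight μ does, once Y contains a target that X lacks.
    heavy-misses : Heavy X → Around Y → Target w → Y w ≡ I → X w ≢ I → ∃ λ v → Target v × X v ≡ I × Y v ≢ I
    heavy-misses {X} {Y} {w} hX aY tw Yw ¬Xw
      with any? (λ v → target? v ×-dec ((X v ≟ᴸ I) ×-dec ¬? (Y v ≟ᴸ I)))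
    ... | yes (v , e) = v , e
    ... | no none = contradiction (hX Y aY) (<⇒≱ (∑-mono-< (λ v → go v (m v) refl (X v) (hull u v) refl refl) w strict))
      where
      go : ∀ v c → m v ≡ c → ∀ a b → X v ≡ a → hull u v ≡ b → c * (isI a * isO b) ≤ c * (isI (Y v) * isO b)
      go v zero p a b q r = z≤n
      go v (suc c) p I O q r with Y v ≟ᴸ I
      ... | yes e rewrite e = ≤-refl
      ... | no ¬e = contradiction (v , (subst (0 <_) (sym p) (s≤s z≤n) , r) , q , ¬e) none
      go v (suc c) p I I q r = *-monoʳ-≤ (suc c) z≤n
      go v (suc c) p I W q r = *-monoʳ-≤ (suc c) z≤n
      go v (suc c) p W b q r = *-monoʳ-≤ (suc c) z≤n
      go v (suc c) p O b q r = *-monoʳ-≤ (suc c) z≤n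
      not-inner : ∀ a → a ≢ I → m w * (isI a * isO (hull u w)) ≡ 0
      not-inner I ¬I = contradiction refl ¬I
      not-inner W ¬I = *-zeroʳ (m w)
      not-inner O ¬I = *-zeroʳ (m w)
      strict : m w * (isI (X w) * isO (hull u w)) < m w * (isI (Y w) * isO (hull u w))
      strict = subst₂ _<_ (sym (not-inner (X w) ¬Xw))
        (sym (trans (cong₂ (λ a b → m w * (isI a * isO b)) Yw (proj₂ tw)) (*-identityʳ (m w)))) (proj₁ tw)

    target-exists : ∃ Target
    target-exists = outer-positive (hull u) (≤-trans (≤-trans pu (inner-weight (hull-∋ pu)))
      (≤-trans (balance 0 (hull u) (proj₁ (hull-tight pu) , subst (F (hull u) ≤_) (sym (+-identityʳ _)) (proj₂ (hull-tight pu))))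
               (≤-reflexive (+-identityʳ _))))

    μ-cong : (∀ v → X v ≡ Y v) → μ X ≡ μ Y
    μ-cong e = ∑-cong λ v → cong (λ a → m v * (isI a * isO (hull u v))) (e v)

    μ-bound : ∀ X → μ X ≤ ∑ m
    μ-bound X = subst (μ X ≤_) (∑-cong λ v → *-identityʳ (m v)) (∑-mono λ v → *-monoʳ-≤ (m v) (go (X v) (hull u v)))
      where
      go : ∀ a b → isI a * isO b ≤ 1
      go I I = z≤n
      go I W = z≤n
      go I O = ≤-refl
      go W b = z≤n
      go O b = z≤n

    μ-mono : X ⊴ Y → μ X ≤ μ Y
    μ-mono {X} {Y} X⊴Y = ∑-mono λ v → *-monoʳ-≤ (m v) (*-monoˡ-≤ (isO (hull u v)) (go (X v) (Y v) (X⊴Y v)))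
      where
      go : ∀ a b → rank a ≤ rank b → isI a ≤ isI b
      go I b p rewrite rank-I p refl = ≤-refl
      go W b p = z≤n
      go O b p = z≤n

    -- The optimum is taken over all bi-sets within 2k + 1 with u inside, maximal or not. Enlarging
    -- it to a maximal one cannot lose target weight, and positive target weight exhibits a target
    -- inside.
    heavy-exists : ∃ λ X → Around X × Heavy X
    heavy-exists with target-exists
    ... | t , tt′ with reach tt′
    ... | X₀ , (((wX₀ , _) , X₀u , _)) , X₀t
      with argmax {P = Above (single u) (2 * k + 1)} above-cong (above? (single u) (2 * k + 1)) μ μ-cong (∑ m) μ-bound
             (X₀ , single-⊴ X₀u , wX₀)
    ... | X₁ , (u⊴X₁ , wX₁) , best with dangerous-hull X₁ wX₁
    ... | X , X₁⊴X , dX = X , (dX , Xu , target-in) , λ { Z ((wZ , _) , Zu , _) →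
                            ≤-trans (best Z (single-⊴ Zu , wZ)) (μ-mono X₁⊴X) }
      where
      Xu : X u ≡ I
      Xu = rank-I (X₁⊴X u) (⊴-single u⊴X₁)
      μX : 0 < μ X
      μX = ≤-trans (proj₁ tt′) (≤-trans (subst (_≤ μ X₀)
             (trans (cong₂ (λ a b → m t * (isI a * isO b)) X₀t (proj₂ tt′)) (*-identityʳ (m t)))
             (term≤∑ (λ v → m v * (isI (X₀ v) * isO (hull u v))) t))
             (≤-trans (best X₀ (single-⊴ X₀u , wX₀)) (μ-mono X₁⊴X)))
      target-in : ∃ λ v → Target v × X v ≡ I
      target-in with ∑-positive (λ v → m v * (isI (X v) * isO (hull u v))) μX
      ... | v , p = v , go (X v) (hull u v) refl refl p
        where
        bad : ∀ {A : Set} → 0 < m v * 0 → A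
        bad p = ⊥-elim (<-irrefl (sym (*-zeroʳ (m v))) p)
        go : ∀ a b → X v ≡ a → hull u v ≡ b → 0 < m v * (isI a * isO b) → Target v × X v ≡ I
        go I I q r p = bad p
        go I W q r p = bad p
        go I O q r p = (subst (0 <_) (*-identityʳ (m v)) p , r) , q
        go W b q r p = bad p
        go O b q r p = bad p

    ⋏-∁⋎ : ∀ {a b c} → a ≡ I → b ≡ O → c ≡ O → a ⋏ ∁ (b ⋎ c) ≡ I
    ⋏-∁⋎ refl refl refl = refl

    inner-⋎ : ∀ a {b c} → b ≡ I → a ⋏ ∁ (b ⋎ c) ≡ O
    inner-⋎ I refl = refl
    inner-⋎ W refl = refl
    inner-⋎ O refl = refl

    -- A third bi-set Z around z would turn `triple-uncrossing` into 4 * 2k + 2 ≤ 3 * (2k + 1) + k,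
    -- that is, k ≤ 1. The four bi-sets on the left are non-trivial because v, w and z each lie in
    -- one of X, Y, Z and outside the other two.
    no-third : Around X → Around Y → Heavy X → Target v → X v ≡ I → Y v ≢ I →
               Target w → Y w ≡ I → X w ≢ I → Target z → X z ≢ I → Y z ≢ I → ⊥
    no-third {X} {Y} {v} {w} {z} aX@((wX , _) , Xu , _) aY@((wY , _) , Yu , _) hX tv Xv ¬Yv tw Yw ¬Xw tz ¬Xz ¬Yz
      with reach tz
    ... | Z , aZ@((wZ , _) , Zu , _) , Zz with heavy-misses hX aZ tz Zz ¬Xz
    ... | v₀ , tv₀ , Xv₀ , ¬Zv₀ = refute
      (F X ∷ F Y ∷ F Z ∷ TripleWall X Y Z ∷ F (meet X (meet Y Z)) ∷ F (diff X (join Y Z)) ∷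
       F (diff Y (join X Z)) ∷ F (diff Z (join X Y)) ∷ M (meet X (meet Y Z)) ∷ k ∷ [])
      (λ { (x ∷ y ∷ z ∷ t ∷ i ∷ a ∷ b ∷ c ∷ mi ∷ k ∷ []) →
        i ⊕ a ⊕ b ⊕ c ⊕ 2 ⊗ mi ⊑ x ⊕ y ⊕ z ⊕ t ∷ x ⊑ 2 ⊗ k ⊕ con 1 ∷ y ⊑ 2 ⊗ k ⊕ con 1 ∷ z ⊑ 2 ⊗ k ⊕ con 1 ∷
        t ⊑ k ∷ 2 ⊗ k ⊑ i ∷ 2 ⊗ k ⊑ a ∷ 2 ⊗ k ⊑ b ∷ 2 ⊗ k ⊑ c ∷ con 1 ⊑ mi ∷ con 2 ⊑ k ∷ [] })
      (1 ∷ 1 ∷ 1 ∷ 1 ∷ 1 ∷ 1 ∷ 1 ∷ 1 ∷ 1 ∷ 2 ∷ 1 ∷ [])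
      (triple-uncrossing X Y Z) (proj₂ wX) (proj₂ wY) (proj₂ wZ)
      (≤-trans (vertexIneq (X ∷ Y ∷ Z ∷ []) anything _ (λ _ → k)
        ((λ { (a ∷ b ∷ c ∷ []) → isW a * (isW b * isW c) }) ∷ []) ((λ { (a ∷ b ∷ c ∷ []) → isW a }) ∷ []))
        (K≤k (around-wall aX)))
      (valid _ ((u , cong₂ _⋏_ Xu (cong₂ _⋏_ Yu Zu)) ,
                (v , trans (cong₂ (λ b c → X v ⋏ b ⋏ c) Yv Zv) (⋏-zeroʳ (X v)))))
      (valid _ ((v , ⋏-∁⋎ Xv Yv Zv) , (u , inner-⋎ (X u) Yu)))
      (valid _ ((w , ⋏-∁⋎ Yw Xw′ Zw′) , (u , inner-⋎ (Y u) Xu)))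
      (valid _ ((z , ⋏-∁⋎ Zz Xz Yz) , (u , inner-⋎ (Z u) Xu)))
      (≤-trans pu (inner-weight {meet X (meet Y Z)} (cong₂ _⋏_ Xu (cong₂ _⋏_ Yu Zu))))
      2≤k
      where
      cXY : Crossed X Y
      cXY = crossed aX aY tv Xv ¬Yv tw Yw ¬Xw
      cXZ : Crossed X Z
      cXZ = crossed aX aZ tv₀ Xv₀ ¬Zv₀ tz Zz ¬Xz
      module XY = Crossed cXY
      module XZ = Crossed cXZ
      Xw′ : X w ≡ O
      Xw′ = XY.sepʳ (proj₁ tw) Yw ¬Xw
      Xz : X z ≡ O
      Xz = XZ.sepʳ (proj₁ tz) Zz ¬Xz
      -- Only X is heavy, so the crossing of Y and Z needs its own reason: with w inside Z, the
      -- tight `diff Z X` would contain w and z, hence lie below `hull w` and so below Y, which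
      -- misses z.
      ¬Zw : Z w ≢ I
      ¬Zw Zw = ¬Yz (rank-I (around-hull aY (proj₁ tw) Yw z)
        (rank-I (hull-max (proj₁ tw) (diff Z X) (cong₂ (λ a b → a ⋏ ∁ b) Zw Xw′) XZ.diffʳ z)
                (cong₂ (λ a b → a ⋏ ∁ b) Zz Xz)))
      cYZ : Crossed Y Z
      cYZ = crossed aY aZ tw Yw ¬Zw tz Zz ¬Yz
      module YZ = Crossed cYZ
      Yv : Y v ≡ O
      Yv = XY.sepˡ (proj₁ tv) Xv ¬Yv
      Zv : Z v ≡ O
      Zv = XZ.sepˡ (proj₁ tv) Xv (λ Zv → target≢u tv (sym (XZ.common (proj₁ tv) Xv Zv)))
      Zw′ : Z w ≡ O
      Zw′ = YZ.sepˡ (proj₁ tw) Yw ¬Zw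
      Yz : Y z ≡ O
      Yz = YZ.sepʳ (proj₁ tz) Zz ¬Yz

    module Pair {X Y v w} (aX : Around X) (aY : Around Y) (hX : Heavy X) (tv : Target v) (Xv : X v ≡ I)
                (¬Yv : Y v ≢ I) (tw : Target w) (Yw : Y w ≡ I) (¬Xw : X w ≢ I) where

      open Crossed (crossed aX aY tv Xv ¬Yv tw Yw ¬Xw)

      Xu : X u ≡ I
      Xu = proj₁ (proj₂ aX)
      Yu : Y u ≡ I
      Yu = proj₁ (proj₂ aY)
      Yv : Y v ≡ O
      Yv = sepˡ (proj₁ tv) Xv ¬Yv
      Xw : X w ≡ O
      Xw = sepʳ (proj₁ tw) Yw ¬Xw
      v≢w : v ≢ w
      v≢w refl = ¬Xw Xv
      hull-v-w : hull v w ≡ O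
      hull-v-w = rank-O (around-hull aX (proj₁ tv) Xv w) Xw
      hull-w-v : hull w v ≡ O
      hull-w-v = rank-O (around-hull aY (proj₁ tw) Yw v) Yv

      disjoint-diffs : ∀ x → diff X Y x ≡ I → diff Y X x ≢ I
      disjoint-diffs x p q = go (X x) (Y x) p q
        where
        go : ∀ a b → a ⋏ ∁ b ≡ I → b ⋏ ∁ a ≢ I
        go I I () q
        go I W () q
        go I O p ()
        go W I () q
        go W W () q
        go W O () q
        go O b () q

      Position : Fin n → Set
      Position x = (X x ≡ I × Y x ≡ I) ⊎ (X x ≡ I × Y x ≡ O) ⊎ (X x ≡ O × Y x ≡ I)

      -- A vertex of positive weight inside neither X nor Y is not inner in `hull u`. If it is
      -- outside `hull u`, it is a third target. If it is on the wall of `hull u`, it is on the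
      -- walls of X and Y, hence a common wall vertex of the two tight differences.
      position : ∀ x → 0 < m x → Position x
      position x px with X x ≟ᴸ I | Y x ≟ᴸ I
      ... | yes Xx | yes Yx = inj₁ (Xx , Yx)
      ... | yes Xx | no ¬Yx = inj₂ (inj₁ (Xx , sepˡ px Xx ¬Yx))
      ... | no ¬Xx | yes Yx = inj₂ (inj₂ (sepʳ px Yx ¬Xx , Yx))
      ... | no ¬Xx | no ¬Yx = ⊥-elim (go (hull u x) refl)
        where
        hull⊴X = around-hull aX pu Xu x
        hull⊴Y = around-hull aY pu Yu x
        go : ∀ a → hull u x ≡ a → ⊥
        go I e = ¬Xx (rank-I hull⊴X e)
        go O e = no-third aX aY hX tv Xv ¬Yv tw Yw ¬Xw (px , e) ¬Xx ¬Yx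
        go W e = no-common-wall (diff X Y) (diff Y X) diffˡ diffʳ px
          (cong₂ (λ a b → a ⋏ ∁ b) Xx Yx) (cong₂ (λ a b → a ⋏ ∁ b) Yx Xx) disjoint-diffs (proj₁ tv) (proj₁ tw)
          (cong₂ (λ a b → a ⋏ ∁ b) Xv Yv) (cong₂ (λ a b → a ⋏ ∁ b) Yw Xw)
          (λ i → ¬Xx (rank-I (around-hull aX (proj₁ tv) Xv x) i))
          (λ i → ¬Yx (rank-I (around-hull aY (proj₁ tw) Yw x) i))
          where
          Xx = rank-W hull⊴X e ¬Xx
          Yx = rank-W hull⊴Y e ¬Yx

      total : ∑ m ≤ M (meet X Y) + (M (diff X Y) + M (diff Y X))
      total = subst (∑ m ≤_) (trans (∑-+ (part meet) (λ x → part diff x + part (λ X Y → diff Y X) x))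
                                   (cong (M (meet X Y) +_) (∑-+ (part diff) (part λ X Y → diff Y X))))
                             (∑-mono λ x → go x (m x) refl)
        where
        part : (Labelling n → Labelling n → Labelling n) → Fin n → ℕ
        part op x = m x * isI (op X Y x)
        go : ∀ x c → m x ≡ c → c ≤ c * isI (meet X Y x) + (c * isI (diff X Y x) + c * isI (diff Y X x))
        go x zero p = z≤n
        go x (suc c) p with position x (subst (0 <_) (sym p) (s≤s z≤n))
        ... | inj₁ (Xx , Yx) rewrite Xx | Yx = ≤-trans (≤-reflexive (sym (*-identityʳ (suc c)))) (m≤m+n _ (suc c * 0 + suc c * 0))
        ... | inj₂ (inj₁ (Xx , Yx)) rewrite Xx | Yx =
          ≤-trans (≤-reflexive (sym (*-identityʳ (suc c)))) (≤-trans (m≤m+n _ (suc c * 0)) (m≤n+m _ (suc c * 0)))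
        ... | inj₂ (inj₂ (Xx , Yx)) rewrite Xx | Yx =
          ≤-trans (≤-reflexive (sym (*-identityʳ (suc c)))) (≤-trans (m≤n+m _ (suc c * 0)) (m≤n+m _ (suc c * 0)))

      -- Z contains the hulls of v and w, hence both differences, hence all weight except the at
      -- most one unit common to X and Y. By `balance` it holds at most (`∑ m` + 1) / 2, so `∑ m`
      -- would be at most 3.
      not-dangerous : ∀ Z → Dangerous Z → Z v ≡ I → Z w ≡ I → ⊥
      not-dangerous Z dZ Zv Zw = refute
        (∑ m ∷ M (meet X Y) ∷ M (diff X Y) ∷ M (diff Y X) ∷ M Z ∷ Mo Z ∷ [])
        (λ { (s ∷ i ∷ a ∷ c ∷ z ∷ zo ∷ []) →
          s ⊑ i ⊕ (a ⊕ c) ∷ i ⊑ con 1 ∷ a ⊕ c ⊑ z ∷ z ⊑ zo ⊕ con 1 ∷ z ⊕ zo ⊑ s ∷ con 4 ⊑ s ∷ [] })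
        (2 ∷ 2 ∷ 2 ∷ 1 ∷ 1 ∷ 1 ∷ [])
        total meet≤1
        (differences-weight X∖Y⊴Z Y∖X⊴Z)
        (balance 1 Z (proj₁ dZ)) (weight-bound Z) 4≤m
        where
        2≤Z : 2 ≤ M Z
        2≤Z = two-inner v≢w (proj₁ tv) (proj₁ tw) Zv Zw
        X∖Y⊴Z : ∀ {x} → X x ≡ I → Y x ≡ O → Z x ≡ I
        X∖Y⊴Z {x} p q = rank-I (hull-⊴-dangerous dZ 2≤Z (proj₁ tv) Zv x)
          (rank-I (hull-max (proj₁ tv) (diff X Y) (cong₂ (λ a b → a ⋏ ∁ b) Xv Yv) diffˡ x)
                  (cong₂ (λ a b → a ⋏ ∁ b) p q))
        Y∖X⊴Z : ∀ {x} → Y x ≡ I → X x ≡ O → Z x ≡ I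
        Y∖X⊴Z {x} p q = rank-I (hull-⊴-dangerous dZ 2≤Z (proj₁ tw) Zw x)
          (rank-I (hull-max (proj₁ tw) (diff Y X) (cong₂ (λ a b → a ⋏ ∁ b) Yw Xw) diffʳ x)
                  (cong₂ (λ a b → a ⋏ ∁ b) p q))

      contradictory : Blocked v w → ⊥
      contradictory b = go (blocked-cases (proj₁ tv) (proj₁ tw) (λ e → case trans (sym hull-v-w) e of λ ()) b)
        where
        go : (∃ λ X → Within (2 * k + 1) X × X v ≡ I × X w ≡ I) ⊎ hull v w ≡ W ⊎ hull w v ≡ W → ⊥
        go (inj₂ (inj₁ e)) = case trans (sym hull-v-w) e of λ ()
        go (inj₂ (inj₂ e)) = case trans (sym hull-w-v) e of λ ()
        go (inj₁ (Z₀ , wZ₀ , Z₀v , Z₀w)) =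
          let Z , Z₀⊴Z , dZ = dangerous-hull Z₀ wZ₀
          in not-dangerous Z dZ (rank-I (Z₀⊴Z v) Z₀v) (rank-I (Z₀⊴Z w) Z₀w)

    impossible : ⊥
    impossible = from-heavy heavy-exists
      where
      from-pair : ∀ {X Y w} → Around X → Around Y → Heavy X → Target w → Y w ≡ I → X w ≢ I →
                  (∃ λ v → Target v × X v ≡ I × Y v ≢ I) → ⊥
      from-pair {w = w} aX aY hX tw Yw ¬Xw (v , tv , Xv , ¬Yv) =
        Pair.contradictory aX aY hX tv Xv ¬Yv tw Yw ¬Xw
          (blocked v w (λ { refl → ¬Xw Xv }) (proj₁ tv) (proj₁ tw))
      from-target : ∀ {X w} → Around X → Heavy X → Target w → X w ≢ I → (∃ λ Y → Around Y × Y w ≡ I) → ⊥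
      from-target aX hX tw ¬Xw (Y , aY , Yw) = from-pair aX aY hX tw Yw ¬Xw (heavy-misses hX aY tw Yw ¬Xw)
      from-heavy : (∃ λ X → Around X × Heavy X) → ⊥
      from-heavy (X , aX , hX) = let w , tw , ¬Xw = misses aX in from-target aX hX tw ¬Xw (reach tw)

-- Removing one unit of weight

δ : Fin n → Fin n → ℕ
δ u w with w ≟ u
... | yes _ = 1
... | no _  = 0

δ-same : (u : Fin n) → δ u u ≡ 1
δ-same u with u ≟ u
... | yes _  = refl
... | no u≢u = contradiction refl u≢u

δ-other : {u w : Fin n} → w ≢ u → δ u w ≡ 0
δ-other {u = u} {w} w≢u with w ≟ u
... | yes w≡u = contradiction w≡u w≢u
... | no _    = refl

∑-δ : (u : Fin n) (f : Fin n → ℕ) → ∑ (λ w → δ u w * f w) ≡ f u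
∑-δ u f = trans (∑-unique _ u λ w w≢u → cong (_* f w) (δ-other w≢u))
                (trans (cong (_* f u) (δ-same u)) (*-identityˡ (f u)))

_⊖_ : (Fin n → ℕ) → Fin n → Fin n → ℕ
(m ⊖ u) w = m w ∸ δ u w

⊖-split : (m : Fin n → ℕ) {u : Fin n} → 0 < m u → ∀ w → m w ≡ (m ⊖ u) w + δ u w
⊖-split m {u} pos w with w ≟ u
... | yes refl = sym (m∸n+n≡m pos)
... | no _     = sym (+-identityʳ (m w))

⊖-positive : (m : Fin n → ℕ) {u w : Fin n} → 0 < (m ⊖ u) w → 0 < m w
⊖-positive m {u} {w} p = ≤-trans p (m∸n≤m (m w) (δ u w))

⊖-other : (m : Fin n → ℕ) {u w : Fin n} → w ≢ u → 0 < m w → 0 < (m ⊖ u) w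
⊖-other m {w = w} w≢u pos = subst (λ d → 0 < m w ∸ d) (sym (δ-other w≢u)) pos

∑-⊖ : (m : Fin n → ℕ) {u : Fin n} → 0 < m u → (f : Fin n → ℕ) →
      ∑ (λ w → m w * f w) ≡ ∑ (λ w → (m ⊖ u) w * f w) + f u
∑-⊖ m {u} pos f = trans
  (∑-cong λ w → trans (cong (_* f w) (⊖-split m pos w)) (*-distribʳ-+ (f w) ((m ⊖ u) w) (δ u w)))
  (trans (∑-+ (λ w → (m ⊖ u) w * f w) (λ w → δ u w * f w)) (cong (∑ (λ w → (m ⊖ u) w * f w) +_) (∑-δ u f)))

total-⊖ : (m : Fin n → ℕ) {u : Fin n} → 0 < m u → ∑ m ≡ ∑ (m ⊖ u) + 1
total-⊖ m {u} pos = trans (∑-cong λ w → sym (*-identityʳ (m w)))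
  (trans (∑-⊖ m pos (λ _ → 1)) (cong (_+ 1) (∑-cong λ w → *-identityʳ ((m ⊖ u) w))))

no-weights : Fin n → ℕ
no-weights _ = 0

-- Minimal weights and the construction of the new edges

module _ (k : ℕ) (2≤k : 2 ≤ k) {n : ℕ} where

  open Weighted {n} k using (Valid; F)

  Covered : Graph n → (Fin n → ℕ) → Set
  Covered G m = ∀ v → 0 < m v → ∃ λ T → T v ≡ I × Minimal.Within k 2≤k G m (2 * k) T

  F-⊖ : ∀ G (m : Fin n → ℕ) {u} → 0 < m u → ∀ X → F G m X ≡ F G (m ⊖ u) X + isI (X u)
  F-⊖ G m pos X = trans (cong (Weighted.D k G m X + Weighted.K k G m X +_) (∑-⊖ m pos (λ w → isI (X w))))
                        (sym (+-assoc (Weighted.D k G m X + Weighted.K k G m X) _ _))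

  counterexample : ∀ G (m : Fin n → ℕ) → Valid G m ⊎ ∃ λ X → NonTriv X × F G m X < 2 * k
  counterexample G m with searchLabelling {P = λ X → NonTriv X × F G m X < 2 * k}
      (λ { e (((v , q) , (w , r)) , s) → ((v , trans (sym (e v)) q) , (w , trans (sym (e w)) r)) ,
                                         subst (_< 2 * k) (Weighted.F-cong k G m e) s })
      (λ X → nonTriv? X ×-dec (F G m X <? 2 * k))
  ... | yes c   = inj₂ c
  ... | no none = inj₁ λ X nt → ≮⇒≥ λ s → none (X , nt , s)

  valid? : ∀ G (m : Fin n → ℕ) → Dec (Valid G m)
  valid? G m with counterexample G m
  ... | inj₁ v            = yes v
  ... | inj₂ (X , nt , s) = no λ v → <⇒≱ s (v X nt)

  -- Greedy descent. When weight can no longer be removed at v, a bi-set violated by the removal has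
  -- value below 2k after it and at least 2k before it, so v is inner in it and it was tight.
  minimal-weights : ∀ G s (m : Fin n → ℕ) → ∑ m ≡ s → Valid G m → ∃ λ m → Valid G m × Covered G m
  minimal-weights G s m ∑m valid with any? (λ v → (0 <? m v) ×-dec valid? G (m ⊖ v))
  minimal-weights G zero m ∑m valid | yes (v , pos , _) =
    contradiction (≤-trans pos (≤-trans (term≤∑ m v) (≤-reflexive ∑m))) λ ()
  minimal-weights G (suc s) m ∑m valid | yes (v , pos , valid′) =
    minimal-weights G s (m ⊖ v) (suc-injective (trans (+-comm 1 _) (trans (sym (total-⊖ m pos)) ∑m))) valid′
  ... | no none = m , valid , cover
    where
    cover : Covered G m
    cover v pos with counterexample G (m ⊖ v)
    ... | inj₁ valid′ = contradiction (v , pos , valid′) none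
    ... | inj₂ (X , nt , s) = X , at-v (X v) refl , nt ,
      ≤-trans (≤-reflexive (F-⊖ G m pos X)) (≤-trans (+-monoʳ-≤ (F G (m ⊖ v) X) (isI≤1 (X v)))
        (≤-trans (≤-reflexive (+-comm _ 1)) s))
      where
      isI≤1 : ∀ a → isI a ≤ 1
      isI≤1 I = ≤-refl
      isI≤1 W = z≤n
      isI≤1 O = z≤n
      not-inner : isI (X v) ≡ 0 → ⊥
      not-inner e = <⇒≱ s (subst (2 * k ≤_) (trans (F-⊖ G m pos X) (trans (cong (F G (m ⊖ v) X +_) e) (+-identityʳ _))) (valid X nt))
      at-v : ∀ a → X v ≡ a → X v ≡ I
      at-v I e = e
      at-v W e = ⊥-elim (not-inner (cong isI e))
      at-v O e = ⊥-elim (not-inner (cong isI e))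

  module Split (G : Graph n) (m : Fin n → ℕ) (valid : Valid G m) (covered : Covered G m)
               {u v : Fin n} (u≢v : u ≢ v) (pu : 0 < m u) (pv : 0 < m v) where

    m′ : Fin n → ℕ
    m′ = (m ⊖ u) ⊖ v

    G′ : Graph n
    G′ = (u , v) ∷ G

    pv′ : 0 < (m ⊖ u) v
    pv′ = ⊖-other m (u≢v ∘ sym) pv

    total-split : ∑ m ≡ 2 + ∑ m′
    total-split = trans (total-⊖ m pu) (trans (cong (_+ 1) (total-⊖ (m ⊖ u) pv′))
      (trans (+-assoc (∑ m′) 1 1) (+-comm (∑ m′) 2)))

    -- Stated by addition on both sides because the change of value can have either sign term by
    -- term and ℕ has no true subtraction.
    F-split : ∀ X → F G m X + enters (X u) (X v) ≡ F G′ m′ X + isI (X v) + isI (X u)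
    F-split X = trans (cong (_+ e) (trans (F-⊖ G m pu X) (cong (_+ isI (X u)) (F-⊖ G (m ⊖ u) pv′ X)))) rearrange
      where
      e = enters (X u) (X v)
      d = E G X
      κ = Weighted.K k G m X
      μ = Weighted.M k G m′ X
      rearrange : d + κ + μ + isI (X v) + isI (X u) + e ≡ e + d + κ + μ + isI (X v) + isI (X u)
      rearrange = trans (+-comm _ e) (trans (sym (+-assoc e _ _)) (cong (_+ isI (X u))
        (trans (sym (+-assoc e _ _)) (cong (_+ isI (X v)) (trans (sym (+-assoc e _ _)) (cong (_+ μ) (sym (+-assoc e d κ))))))))

    covered-split : Covered G′ m′
    covered-split w pos with covered w (⊖-positive m {u} {w} (⊖-positive (m ⊖ u) {v} {w} pos))
    ... | T , Tw , nt , FT = T , Tw , nt , ≮⇒≥ (refute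
      (F G m T ∷ F G′ m′ T ∷ enters (T u) (T v) ∷ isI (T u) ∷ isI (T v) ∷ 2 * k ∷ [])
      (λ { (f ∷ f′ ∷ e ∷ iu ∷ iv ∷ k ∷ []) →
        f′ ⊕ iv ⊕ iu ⊑ f ⊕ e ∷ e ⊑ iu ⊕ iv ∷ f ⊑ k ∷ con 1 ⊕ k ⊑ f′ ∷ [] }) (1 ∷ 1 ∷ 1 ∷ 1 ∷ [])
      (≤-reflexive (sym (F-split T))) (enters≤inner-ends (T u) (T v)) FT)

    split : Valid G′ m′ ⊎ Splitting.Blocked k 2≤k G m valid covered u v
    split with counterexample G′ m′
    ... | inj₁ valid′ = inj₁ valid′
    ... | inj₂ (X , nt , s) = inj₂ (go (X u) (X v) refl refl (F-split X))
      where
      φ = F G m X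
      φ′ = F G′ m′ X
      go : ∀ a b → X u ≡ a → X v ≡ b → φ + enters (X u) (X v) ≡ φ′ + isI (X v) + isI (X u) →
           Splitting.Blocked k 2≤k G m valid covered u v
      go a b p q eq = go′ a b p q (subst₂ (λ a b → φ + enters a b ≡ φ′ + isI b + isI a) p q eq)
        where
        close : ∀ {e i j c} → φ + e ≡ φ′ + i + j → i + j ≤ suc c → φ ≤ 2 * k + c
        close {e} {i} {j} {c} eq le = ≮⇒≥ (refute (φ ∷ φ′ ∷ e ∷ i ∷ j ∷ c ∷ 2 * k ∷ [])
          (λ { (φ ∷ φ′ ∷ e ∷ i ∷ j ∷ c ∷ k ∷ []) →
            φ ⊕ e ⊑ φ′ ⊕ i ⊕ j ∷ i ⊕ j ⊑ con 1 ⊕ c ∷ con 1 ⊕ φ′ ⊑ k ∷ con 1 ⊕ (k ⊕ c) ⊑ φ ∷ [] })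
          (1 ∷ 1 ∷ 1 ∷ 1 ∷ []) (≤-reflexive eq) le s)
        close₀ : ∀ {e i j} → φ + e ≡ φ′ + i + j → i + j ≤ 1 → φ ≤ 2 * k
        close₀ {e} eq le = subst (φ ≤_) (+-identityʳ _) (close {e} eq le)
        unchanged : ∀ {e i j} → φ + e ≡ φ′ + i + j → i + j ≤ e → ⊥
        unchanged {e} {i} {j} eq le = refute (φ ∷ φ′ ∷ e ∷ i ∷ j ∷ 2 * k ∷ [])
          (λ { (φ ∷ φ′ ∷ e ∷ i ∷ j ∷ k ∷ []) →
            φ ⊕ e ⊑ φ′ ⊕ i ⊕ j ∷ i ⊕ j ⊑ e ∷ con 1 ⊕ φ′ ⊑ k ∷ k ⊑ φ ∷ [] })
          (1 ∷ 1 ∷ 1 ∷ 1 ∷ []) (≤-reflexive eq) le s (valid X nt)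
        go′ : ∀ a b → X u ≡ a → X v ≡ b → φ + enters a b ≡ φ′ + isI b + isI a →
              Splitting.Blocked k 2≤k G m valid covered u v
        go′ I I p q eq = inj₁ (X , (nt , close {0} {1} {1} eq ≤-refl) , p , q)
        go′ I W p q eq = inj₂ (inj₁ (X , (nt , close₀ {0} {0} {1} eq ≤-refl) , p , q))
        go′ W I p q eq = inj₂ (inj₂ (X , (nt , close₀ {0} {1} {0} eq ≤-refl) , q , p))
        go′ I O p q eq = ⊥-elim (unchanged {1} {0} {1} eq ≤-refl)
        go′ O I p q eq = ⊥-elim (unchanged {1} {1} {0} eq ≤-refl)
        go′ W W p q eq = ⊥-elim (unchanged {0} {0} {0} eq ≤-refl)
        go′ W O p q eq = ⊥-elim (unchanged {0} {0} {0} eq ≤-refl)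
        go′ O W p q eq = ⊥-elim (unchanged {0} {0} {0} eq ≤-refl)
        go′ O O p q eq = ⊥-elim (unchanged {0} {0} {0} eq ≤-refl)

  -- Small totals: one, two and three edges at s

  module Endgame (G : Graph n) (m : Fin n → ℕ) (valid : Valid G m) (covered : Covered G m) where

    open Weighted k G m hiding (Valid; F)
    open Minimal k 2≤k G m
    open Tight valid
    open Hulls covered
    open Splitting k 2≤k G m valid covered

    private
      variable
        u v w : Fin n

    tight-balance : ∀ X → Within (2 * k) X → M X ≤ Mo X
    tight-balance X (nt , FX) =
      subst (M X ≤_) (+-identityʳ _) (balance 0 X (nt , ≤-trans FX (≤-reflexive (sym (+-identityʳ _)))))

    hull-weight : 0 < m u → 1 ≤ M (hull u)
    hull-weight pu = ≤-trans pu (inner-weight (hull-∋ pu))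

    outside-hull : 0 < m u → ∃ λ v → 0 < m v × hull u v ≡ O
    outside-hull {u} pu =
      outer-positive (hull u) (≤-trans (hull-weight pu) (tight-balance (hull u) (hull-tight pu)))

    hull-O≢ : 0 < m u → hull u v ≡ O → u ≢ v
    hull-O≢ pu e refl = case trans (sym e) (hull-∋ pu) of λ ()

    not-one : ∑ m ≢ 1
    not-one ∑m with ∑-positive m (subst (0 <_) (sym ∑m) (s≤s z≤n))
    ... | u , pu = refute (M (hull u) ∷ Mo (hull u) ∷ ∑ m ∷ [])
      (λ { (i ∷ o ∷ s ∷ []) → con 1 ⊑ i ∷ i ⊑ o ∷ i ⊕ o ⊑ s ∷ s ⊑ con 1 ∷ [] }) (2 ∷ 1 ∷ 1 ∷ 1 ∷ [])
      (hull-weight pu) (tight-balance (hull u) (hull-tight pu)) (weight-bound (hull u)) (≤-reflexive ∑m)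

    wall-weight : ∀ {X : Labelling n} → X v ≡ W → m v ≤ ∑ λ w → m w * isW (X w)
    wall-weight {v} {X} e =
      subst (_≤ ∑ λ w → m w * isW (X w)) (trans (cong (λ a → m v * isW a) e) (*-identityʳ (m v)))
            (term≤∑ (λ w → m w * isW (X w)) v)

    -- Counting suffices: a dangerous obstacle has weight 2 inside and so, by `balance`, at least 1
    -- outside; a tight one has at least 1 inside, 1 on the wall and 1 outside.
    all-blocked-two : ∑ m ≡ 2 → (∀ u v → u ≢ v → 0 < m u → 0 < m v → Blocked u v) → ⊥
    all-blocked-two ∑m blocked with ∑-positive m (subst (0 <_) (sym ∑m) (s≤s z≤n))
    ... | u , pu with outside-hull pu
    ... | v , pv , uv = go (blocked u v (hull-O≢ pu uv) pu pv)
      where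
      wall-case : ∀ X {x y} → 0 < m x → 0 < m y → Within (2 * k) X → X x ≡ I → X y ≡ W → ⊥
      wall-case X px py wX Xx Xy = refute (M X ∷ Mo X ∷ (∑ λ w → m w * isW (X w)) ∷ ∑ m ∷ [])
        (λ { (i ∷ o ∷ w ∷ s ∷ []) → con 1 ⊑ i ∷ i ⊑ o ∷ con 1 ⊑ w ∷ i ⊕ o ⊕ w ⊑ s ∷ s ⊑ con 2 ∷ [] })
        (2 ∷ 1 ∷ 1 ∷ 1 ∷ 1 ∷ [])
        (≤-trans px (inner-weight Xx)) (tight-balance X wX) (≤-trans py (wall-weight {X = X} Xy))
        (weight-split X) (≤-reflexive ∑m)
      go : Blocked u v → ⊥
      go (inj₁ (X , wX , Xu , Xv)) = refute (M X ∷ Mo X ∷ ∑ m ∷ [])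
        (λ { (i ∷ o ∷ s ∷ []) → con 2 ⊑ i ∷ i ⊑ o ⊕ con 1 ∷ i ⊕ o ⊑ s ∷ s ⊑ con 2 ∷ [] })
        (2 ∷ 1 ∷ 1 ∷ 1 ∷ []) (two-inner {X = X} (hull-O≢ pu uv) pu pv Xu Xv) (balance 1 X wX) (weight-bound X) (≤-reflexive ∑m)
      go (inj₂ (inj₁ (X , wX , Xu , Xv))) = wall-case X pu pv wX Xu Xv
      go (inj₂ (inj₂ (X , wX , Xv , Xu))) = wall-case X pv pu wX Xv Xu

    all-blocked : ∀ s → ∑ m ≡ 2 + s → s ≢ 1 → (∀ u v → u ≢ v → 0 < m u → 0 < m v → Blocked u v) → ⊥
    all-blocked zero ∑m s≢1 blocked = all-blocked-two ∑m blocked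
    all-blocked (suc zero) ∑m s≢1 blocked = s≢1 refl
    all-blocked (suc (suc s)) ∑m s≢1 blocked with ∑-positive m (subst (0 <_) (sym ∑m) (s≤s z≤n))
    ... | u , pu with mutual-exists pu
    ... | v , pv , walls = AllBlocked.impossible (subst (4 ≤_) (sym ∑m) (s≤s (s≤s (s≤s (s≤s z≤n))))) blocked v pv walls

    splittable : ∀ s → ∑ m ≡ 2 + s → s ≢ 1 →
                 ∃ λ u → ∃ λ v → u ≢ v × 0 < m u × 0 < m v × Valid ((u , v) ∷ G) ((m ⊖ u) ⊖ v)
    splittable s ∑m s≢1
      with any? (λ u → any? λ v → ¬? (u ≟ v) ×-dec ((0 <? m u) ×-dec ((0 <? m v) ×-dec valid? ((u , v) ∷ G) ((m ⊖ u) ⊖ v))))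
    ... | yes e = e
    ... | no none = ⊥-elim (all-blocked s ∑m s≢1 λ u v u≢v pu pv →
      [ (λ valid′ → contradiction (u , v , u≢v , pu , pv , valid′) none) , id ]′ (Split.split G m valid covered u≢v pu pv))

    -- Three edges at s remain: two of their ends, u and r, are joined to the third one, v.
    module Three (∑m : ∑ m ≡ 3) where

      -- At most half of 3. Hence the three edges at s have distinct ends, and no hull has two of
      -- these ends in its inner set.
      light : ∀ X → Within (2 * k) X → M X ≤ 1
      light X wX = ≮⇒≥ (refute (M X ∷ Mo X ∷ ∑ m ∷ [])
        (λ { (i ∷ o ∷ s ∷ []) → i ⊑ o ∷ i ⊕ o ⊑ s ∷ s ⊑ con 3 ∷ con 2 ⊑ i ∷ [] }) (1 ∷ 1 ∷ 1 ∷ 2 ∷ [])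
        (tight-balance X wX) (weight-bound X) (≤-reflexive ∑m))

      m≤1 : ∀ w → m w ≤ 1
      m≤1 w with 0 <? m w
      ... | yes pos = ≤-trans (inner-weight (hull-∋ pos)) (light (hull w) (hull-tight pos))
      ... | no ¬pos = ≤-trans (≮⇒≥ ¬pos) z≤n

      third : u ≢ v → ∃ λ r → 0 < m r × r ≢ u × r ≢ v
      third {u} {v} u≢v with any? (λ r → (0 <? m r) ×-dec (¬? (r ≟ u) ×-dec ¬? (r ≟ v)))
      ... | yes e = e
      ... | no none = contradiction (subst₂ _≤_ ∑m total (∑-mono bound)) λ { (s≤s (s≤s ())) }
        where
        total : ∑ (λ w → δ u w * 1 + δ v w * 1) ≡ 2
        total = trans (∑-+ (λ w → δ u w * 1) (λ w → δ v w * 1)) (cong₂ _+_ (∑-δ u (λ _ → 1)) (∑-δ v (λ _ → 1)))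
        bound : ∀ w → m w ≤ δ u w * 1 + δ v w * 1
        bound w with w ≟ u | w ≟ v
        ... | yes refl | _ = ≤-trans (m≤1 w) (m≤m+n 1 _)
        ... | no _ | yes refl = m≤1 w
        ... | no w≢u | no w≢v = ≮⇒≥ λ pos → none (w , pos , w≢u , w≢v)

      Separated : Lab → Lab → Lab → Set
      Separated a b c = b ≡ W × ((a ≡ I × c ≡ O) ⊎ (a ≡ O × c ≡ I))

      separated : ∀ a b c → enters a b + enters b c < isI a + (isI b + isI c) →
                  enters a b + enters b c < isO a + (isO b + isO c) → Separated a b c
      separated = toWitness {a? = allLab? λ a → allLab? λ b → allLab? λ c →
        (enters a b + enters b c <? isI a + (isI b + isI c)) →-dec
        ((enters a b + enters b c <? isO a + (isO b + isO c)) →-dec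
        ((b ≟ᴸ W) ×-dec (((a ≟ᴸ I) ×-dec (c ≟ᴸ O)) ⊎-dec ((a ≟ᴸ O) ×-dec (c ≟ᴸ I)))))} tt

      module Path {u v r : Fin n} (u≢v : u ≢ v) (r≢u : r ≢ u) (r≢v : r ≢ v)
                  (pu : 0 < m u) (pv : 0 < m v) (pr : 0 < m r) where

        support : ∀ w → m w ≤ δ u w + (δ v w + δ r w)
        support w with w ≟ u | w ≟ v | w ≟ r
        ... | yes _ | _ | _ = ≤-trans (m≤1 w) (m≤m+n 1 _)
        ... | no _ | yes _ | _ = ≤-trans (m≤1 w) (m≤m+n 1 _)
        ... | no _ | no _ | yes _ = m≤1 w
        ... | no w≢u | no w≢v | no w≢r = ≮⇒≥ λ pw → refute (m w ∷ m u ∷ m v ∷ m r ∷ ∑ m ∷ [])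
          (λ { (w ∷ u ∷ v ∷ r ∷ s ∷ []) →
            w ⊕ (u ⊕ (v ⊕ r)) ⊑ s ∷ s ⊑ con 3 ∷ con 1 ⊑ w ∷ con 1 ⊑ u ∷ con 1 ⊑ v ∷ con 1 ⊑ r ∷ [] })
          (1 ∷ 1 ∷ 1 ∷ 1 ∷ 1 ∷ 1 ∷ [])
          (subst₂ _≤_ four (∑-cong λ x → *-identityʳ (m x)) (∑-mono λ x → *-monoʳ-≤ (m x) (at-most-one x)))
          (≤-reflexive ∑m) pw pu pv pr
          where
          at-most-one : ∀ x → δ w x + (δ u x + (δ v x + δ r x)) ≤ 1
          at-most-one x with x ≟ w | x ≟ u | x ≟ v | x ≟ r
          ... | yes refl | yes e | _ | _ = contradiction e w≢u
          ... | yes refl | no _ | yes e | _ = contradiction e w≢v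
          ... | yes refl | no _ | no _ | yes e = contradiction e w≢r
          ... | yes refl | no _ | no _ | no _ = ≤-refl
          ... | no _ | yes refl | yes e | _ = contradiction e u≢v
          ... | no _ | yes refl | no _ | yes e = contradiction (sym e) r≢u
          ... | no _ | yes refl | no _ | no _ = ≤-refl
          ... | no _ | no _ | yes refl | yes e = contradiction (sym e) r≢v
          ... | no _ | no _ | yes refl | no _ = ≤-refl
          ... | no _ | no _ | no _ | yes _ = ≤-refl
          ... | no _ | no _ | no _ | no _ = z≤n
          at : ∀ x → ∑ (λ y → m y * δ x y) ≡ m x
          at x = trans (∑-cong λ y → *-comm (m y) (δ x y)) (∑-δ x m)
          four : ∑ (λ x → m x * (δ w x + (δ u x + (δ v x + δ r x)))) ≡ m w + (m u + (m v + m r))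
          four = trans (∑-cong λ x → trans (*-distribˡ-+ (m x) (δ w x) _) (cong (m x * δ w x +_)
                   (trans (*-distribˡ-+ (m x) (δ u x) _) (cong (m x * δ u x +_) (*-distribˡ-+ (m x) (δ v x) _)))))
            (trans (∑-+ (λ x → m x * δ w x) (λ x → m x * δ u x + (m x * δ v x + m x * δ r x)))
              (cong₂ _+_ (at w) (trans (∑-+ (λ x → m x * δ u x) (λ x → m x * δ v x + m x * δ r x))
                (cong₂ _+_ (at u) (trans (∑-+ (λ x → m x * δ v x) (λ x → m x * δ r x)) (cong₂ _+_ (at v) (at r)))))))

        spread : ∀ (p : Lab → ℕ) X → ∑ (λ w → m w * p (X w)) ≤ p (X u) + (p (X v) + p (X r))
        spread p X = ≤-trans (∑-mono λ w → *-monoˡ-≤ (p (X w)) (support w))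
          (≤-reflexive (trans (∑-cong λ w → trans (*-distribʳ-+ (p (X w)) (δ u w) _)
                                (cong (δ u w * p (X w) +_) (*-distribʳ-+ (p (X w)) (δ v w) _)))
            (trans (∑-+ (λ w → δ u w * p (X w)) (λ w → δ v w * p (X w) + δ r w * p (X w)))
              (cong₂ _+_ (∑-δ u (p ∘ X)) (trans (∑-+ (λ w → δ v w * p (X w)) (λ w → δ r w * p (X w)))
                (cong₂ _+_ (∑-δ v (p ∘ X)) (∑-δ r (p ∘ X))))))))

        apart : ∀ {q} → 0 < m q → q ≢ v → hull q v ≢ I
        apart {q} pq q≢v e = <⇒≱ (two-inner {X = hull q} q≢v pq pv (hull-∋ pq) e) (light (hull q) (hull-tight pq))

        -- If X is violated, the path edges entering it are fewer than its inner ends among u, v, r,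
        -- by `Valid`, and fewer than the ends outside it, by `complement-bound`. Inspecting labels
        -- leaves only the case of v on the wall with u and r on opposite sides. Then X and its
        -- complement both become tight, and `no-common-wall` excludes them at the vertex v.
        covers : ∀ X → NonTriv X → 2 * k ≤ enters (X u) (X v) + enters (X v) (X r) + (D X + K X)
        covers X nt = ≮⇒≥ λ small → separates small
          (separated (X u) (X v) (X r)
            (≤-trans (few small (M X) (valid X nt)) (spread isI X))
            (≤-trans (few small (Mo X) (complement-bound valid X nt)) (spread isO X)))
          where
          e = enters (X u) (X v) + enters (X v) (X r)
          few : e + (D X + K X) < 2 * k → ∀ x → 2 * k ≤ D X + K X + x → e < x
          few small x le = ≮⇒≥ (refute (e ∷ D X + K X ∷ x ∷ 2 * k ∷ [])
            (λ { (e ∷ d ∷ x ∷ k ∷ []) → con 1 ⊕ (e ⊕ d) ⊑ k ∷ k ⊑ d ⊕ x ∷ con 1 ⊕ x ⊑ con 1 ⊕ e ∷ [] })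
            (1 ∷ 1 ∷ 1 ∷ []) small le)
          tight : e + (D X + K X) < 2 * k → ∀ Y → NonTriv Y → D Y ≤ D X → K Y ≤ K X → M Y ≤ 1 → Within (2 * k) Y
          tight small Y ntY d κ μ = ntY , ≮⇒≥ (refute (e ∷ D X ∷ K X ∷ D Y ∷ K Y ∷ M Y ∷ 2 * k ∷ [])
            (λ { (e ∷ dx ∷ kx ∷ dy ∷ ky ∷ my ∷ k ∷ []) →
              con 1 ⊕ (e ⊕ (dx ⊕ kx)) ⊑ k ∷ dy ⊑ dx ∷ ky ⊑ kx ∷ my ⊑ con 1 ∷ con 1 ⊕ k ⊑ dy ⊕ ky ⊕ my ∷ [] })
            (1 ∷ 1 ∷ 1 ∷ 1 ∷ 1 ∷ []) small d κ μ)
          disjoint : ∀ w → X w ≡ I → comp X w ≢ I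
          disjoint w p q with () ← trans (sym (cong ∁ p)) q
          weight : ∀ {p : Lab → ℕ} {a b c} → X u ≡ a → X v ≡ b → X r ≡ c → ∑ (λ w → m w * p (X w)) ≤ p a + (p b + p c)
          weight {p} refl refl refl = spread p X
          clash : e + (D X + K X) < 2 * k → X v ≡ W → ∀ {q t} → 0 < m q → 0 < m t → q ≢ v → t ≢ v →
                  X q ≡ I → X t ≡ O → M X ≤ 1 → Mo X ≤ 1 → ⊥
          clash small Xv pq pt q≢v t≢v Xq Xt μ₁ μ₂ = no-common-wall X (comp X)
            (tight small X nt ≤-refl ≤-refl μ₁)
            (tight small (comp X) (comp-nonTriv nt) (comp-D X) (comp-K X) (≤-trans (comp-weight X) μ₂))
            pv Xv (cong ∁ Xv) disjoint pq pt Xq (cong ∁ Xt) (apart pq q≢v) (apart pt t≢v)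
          separates : e + (D X + K X) < 2 * k → Separated (X u) (X v) (X r) → ⊥
          separates small (Xv , inj₁ (Xu , Xr)) =
            clash small Xv pu pr u≢v r≢v Xu Xr (weight {isI} Xu Xv Xr) (weight {isO} Xu Xv Xr)
          separates small (Xv , inj₂ (Xu , Xr)) =
            clash small Xv pr pu r≢v u≢v Xr Xu (weight {isI} Xu Xv Xr) (weight {isO} Xu Xv Xr)

  E-move : ∀ (G H : Graph n) x y X → E (((x , y) ∷ G) ++ H) X ≡ E (G ++ (x , y) ∷ H) X
  E-move G H x y X = trans (cong (e +_) (E-++ G H X)) (trans (sym (+-assoc e (E G X) (E H X)))
    (trans (cong (_+ E H X) (+-comm e (E G X))) (trans (+-assoc (E G X) e (E H X)) (sym (E-++ G ((x , y) ∷ H) X)))))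
    where
    e = enters (X x) (X y)

  -- Each split lowers the total by 2 and adds one edge. Splitting stops at 0 or at 3, since
  -- `not-one` rules out 1; the two edges of the path match the rounded-up half of 3.
  augment : ∀ s (G : Graph n) (m : Fin n → ℕ) → ∑ m ≡ s → Valid G m → Covered G m →
            ∃ λ H → Valid (G ++ H) no-weights × length H ≡ ⌈ s /2⌉
  augment zero G m ∑m valid covered = [] , (λ X nt → ≤-trans (valid X nt) (≤-reflexive
    (cong₂ _+_ (cong (_+ Weighted.K k G m X) (sym (trans (E-++ G [] X) (+-identityʳ _))))
               (∑-cong λ w → cong (_* isI (X w)) (n≤0⇒n≡0 (≤-trans (term≤∑ m w) (≤-reflexive ∑m))))))) , refl
  augment (suc zero) G m ∑m valid covered = contradiction ∑m (Endgame.not-one G m valid covered)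
  augment (suc (suc s)) G m ∑m valid covered with s ℕ.≟ 1
  ... | yes refl with ∑-positive m (subst (0 <_) (sym ∑m) (s≤s z≤n))
  ... | u , pu with Endgame.outside-hull G m valid covered pu
  ... | v , pv , uv with Endgame.Three.third G m valid covered ∑m (Endgame.hull-O≢ G m valid covered pu uv)
  ... | r , pr , r≢u , r≢v = (u , v) ∷ (v , r) ∷ [] , (λ X nt →
      ≤-trans (Endgame.Three.Path.covers G m valid covered ∑m (Endgame.hull-O≢ G m valid covered pu uv) r≢u r≢v pu pv pr X nt)
        (≤-trans (≤-reflexive (rearrange X)) (m≤m+n _ _))) , refl
    where
    rearrange : ∀ X → enters (X u) (X v) + enters (X v) (X r) + (E G X + Weighted.K k G m X) ≡
                E (G ++ (u , v) ∷ (v , r) ∷ []) X + Weighted.K k G m X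
    rearrange X = trans (sym (+-assoc (enters (X u) (X v) + enters (X v) (X r)) (E G X) _)) (cong (_+ Weighted.K k G m X)
      (trans (+-comm (enters (X u) (X v) + enters (X v) (X r)) (E G X)) (trans (cong (λ e → E G X + (enters (X u) (X v) + e)) (sym (+-identityʳ (enters (X v) (X r)))))
        (sym (E-++ G ((u , v) ∷ (v , r) ∷ []) X)))))
  augment (suc (suc s)) G m ∑m valid covered | no s≢1
    with Endgame.splittable G m valid covered s ∑m s≢1
  ... | u , v , u≢v , pu , pv , valid′
    with augment s ((u , v) ∷ G) ((m ⊖ u) ⊖ v)
           (suc-injective (suc-injective (trans (sym (Split.total-split G m valid covered u≢v pu pv)) ∑m)))
           valid′ (Split.covered-split G m valid covered u≢v pu pv)
  ... | H , validH , len = (u , v) ∷ H , (λ X nt → ≤-trans (validH X nt) (≤-reflexive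
    (cong (λ e → e + Weighted.K k G m X + Weighted.M k G no-weights X) (E-move G H u v X)))) , cong suc len

-- Families of labellings

Meets Disjoint : Labelling n → Labelling n → Set
Meets X Y    = ∃ λ v → X v ≡ I × Y v ≡ I
Disjoint X Y = ∀ v → X v ≡ I → Y v ≢ I

meets? : (X Y : Labelling n) → Dec (Meets X Y)
meets? X Y = any? λ v → (X v ≟ᴸ I) ×-dec (Y v ≟ᴸ I)

meeting : (X : Labelling n) (𝒳 : List (Labelling n)) →
          All (Disjoint X) 𝒳 ⊎ ∃ λ Y → ∃ λ 𝒴 → 𝒳 ↭ Y ∷ 𝒴 × Meets X Y
meeting X [] = inj₁ []
meeting X (Y ∷ 𝒳) with meets? X Y
... | yes meet = inj₂ (Y , 𝒳 , ↭-refl , meet)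
... | no ¬meet with meeting X 𝒳
... | inj₁ disjoint = inj₁ ((λ v p q → ¬meet (v , p , q)) ∷ disjoint)
... | inj₂ (Z , 𝒵 , perm , meet) = inj₂ (Z , Y ∷ 𝒵 , ↭-trans (prep Y perm) (↭-swap Y Z ↭-refl) , meet)

conflict : (𝒳 : List (Labelling n)) →
           AllPairs Disjoint 𝒳 ⊎ ∃ λ X → ∃ λ Y → ∃ λ 𝒴 → 𝒳 ↭ X ∷ Y ∷ 𝒴 × Meets X Y
conflict [] = inj₁ []
conflict (X ∷ 𝒳) with meeting X 𝒳
... | inj₂ (Y , 𝒴 , perm , meet) = inj₂ (X , Y , 𝒴 , prep X perm , meet)
... | inj₁ disjoint with conflict 𝒳
... | inj₁ pairs = inj₁ (disjoint ∷ pairs)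
... | inj₂ (Y , Z , 𝒵 , perm , meet) =
  inj₂ (Y , Z , X ∷ 𝒵 , ↭-trans (prep X perm) (↭-trans (↭-swap X Y ↭-refl) (prep Y (↭-swap X Z ↭-refl))) , meet)

sumˡ-∑ : (g : Labelling n → Fin n → ℕ) (𝒳 : List (Labelling n)) →
         sumˡ (map (λ X → ∑ (g X)) 𝒳) ≡ ∑ λ v → sumˡ (map (λ X → g X v) 𝒳)
sumˡ-∑ {n} g []  = sym (∑-zero {n} {λ _ → 0} λ _ → refl)
sumˡ-∑ g (X ∷ 𝒳) = trans (cong (∑ (g X) +_) (sumˡ-∑ g 𝒳)) (sym (∑-+ (g X) _))

sumˡ-* : (c : ℕ) (f : Labelling n → ℕ) (𝒳 : List (Labelling n)) → sumˡ (map (λ X → c * f X) 𝒳) ≡ c * sumˡ (map f 𝒳)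
sumˡ-* c f []      = sym (*-zeroʳ c)
sumˡ-* c f (X ∷ 𝒳) = trans (cong (c * f X +_) (sumˡ-* c f 𝒳)) (sym (*-distribˡ-+ c (f X) _))

multiplicity : Fin n → List (Labelling n) → ℕ
multiplicity v 𝒳 = sumˡ (map (λ X → isI (X v)) 𝒳)

disjoint-multiplicity : (v : Fin n) {𝒳 : List (Labelling n)} → AllPairs Disjoint 𝒳 → multiplicity v 𝒳 ≤ 1
disjoint-multiplicity v [] = z≤n
disjoint-multiplicity v {X ∷ 𝒳} (disjoint ∷ pairs) = go (X v) refl
  where
  none : X v ≡ I → ∀ {𝒴} → All (Disjoint X) 𝒴 → multiplicity v 𝒴 ≡ 0
  none e [] = refl
  none e {Y ∷ 𝒴} (d ∷ ds) with Y v in f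
  ... | I = contradiction f (d v e)
  ... | W = none e ds
  ... | O = none e ds
  go : ∀ a → X v ≡ a → isI (X v) + multiplicity v 𝒳 ≤ 1
  go I e = ≤-reflexive (cong₂ _+_ (cong isI e) (none e disjoint))
  go W e = subst (λ a → isI a + multiplicity v 𝒳 ≤ 1) (sym e) (disjoint-multiplicity v pairs)
  go O e = subst (λ a → isI a + multiplicity v 𝒳 ≤ 1) (sym e) (disjoint-multiplicity v pairs)

covered-multiplicity : (v : Fin n) {𝒳 : List (Labelling n)} → Any (λ X → X v ≡ I) 𝒳 → 1 ≤ multiplicity v 𝒳
covered-multiplicity v {X ∷ 𝒳} (here e)  = subst (λ a → 1 ≤ isI a + multiplicity v 𝒳) (sym e) (s≤s z≤n)
covered-multiplicity v {X ∷ 𝒳} (there a) = ≤-trans (covered-multiplicity v a) (m≤n+m _ (isI (X v)))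

-- Double counting. Multiplicities are at most one in a disjoint family and at least one, on
-- positive weight, in a covering family; together these make the total exactly `∑ m`.
sumˡ-M : (m : Fin n → ℕ) (𝒳 : List (Labelling n)) →
         sumˡ (map (λ X → ∑ λ v → m v * isI (X v)) 𝒳) ≡ ∑ λ v → m v * multiplicity v 𝒳
sumˡ-M m 𝒳 = trans (sumˡ-∑ _ 𝒳) (∑-cong λ v → sumˡ-* (m v) (λ X → isI (X v)) 𝒳)

disjoint-weight : (m : Fin n → ℕ) {𝒳 : List (Labelling n)} → AllPairs Disjoint 𝒳 →
                  sumˡ (map (λ X → ∑ λ v → m v * isI (X v)) 𝒳) ≤ ∑ m
disjoint-weight m {𝒳} pairs = ≤-trans (≤-reflexive (sumˡ-M m 𝒳))
  (∑-mono λ v → ≤-trans (*-monoʳ-≤ (m v) (disjoint-multiplicity v pairs)) (≤-reflexive (*-identityʳ (m v))))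

covering-weight : (m : Fin n → ℕ) {𝒳 : List (Labelling n)} → (∀ v → 0 < m v → Any (λ X → X v ≡ I) 𝒳) →
                  ∑ m ≤ sumˡ (map (λ X → ∑ λ v → m v * isI (X v)) 𝒳)
covering-weight m {𝒳} cover = ≤-trans (∑-mono λ v → go v (m v) refl) (≤-reflexive (sym (sumˡ-M m 𝒳)))
  where
  go : ∀ v c → m v ≡ c → c ≤ c * multiplicity v 𝒳
  go v zero e    = z≤n
  go v (suc c) e = ≤-trans (≤-reflexive (sym (*-identityʳ (suc c))))
    (*-monoʳ-≤ (suc c) (covered-multiplicity v (cover v (subst (0 <_) (sym e) (s≤s z≤n)))))

module Family {n : ℕ} (k : ℕ) (2≤k : 2 ≤ k) (G : Graph n) (m : Fin n → ℕ) (valid : Weighted.Valid k G m) where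

  open Weighted k G m
  open Minimal k 2≤k G m
  open Tight valid

  -- Positive inner weight belongs to the invariant because it limits the wall to one vertex, as
  -- `covering-pair` requires.
  Active : Labelling n → Set
  Active X = Within (2 * k) X × 1 ≤ M X

  Covers : List (Labelling n) → Set
  Covers 𝒳 = ∀ v → 0 < m v → Any (λ X → X v ≡ I) 𝒳

  inner-positive : ∀ X → 0 < M X → ∃ λ v → 0 < m v × X v ≡ I
  inner-positive X pos with ∑-positive (λ v → m v * isI (X v)) pos
  ... | v , p = v , go (X v) refl p
    where
    go : ∀ a → X v ≡ a → 0 < m v * isI (X v) → 0 < m v × X v ≡ I
    go I e p = subst (0 <_) (*-identityʳ (m v)) (subst (λ a → 0 < m v * isI a) e p) , e
    go W e p = contradiction (subst (λ a → 0 < m v * isI a) e p) (λ p → <-irrefl (sym (*-zeroʳ (m v))) p)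
    go O e p = contradiction (subst (λ a → 0 < m v * isI a) e p) (λ p → <-irrefl (sym (*-zeroʳ (m v))) p)

  Resolved : Labelling n → Labelling n → Set
  Resolved X Y = Active (join X Y) ⊎
    (Active (diff X Y) × Active (diff Y X) ×
     (∀ v → 0 < m v → X v ≡ I → diff X Y v ≡ I) × (∀ v → 0 < m v → Y v ≡ I → diff Y X v ≡ I))

  -- The common inner vertex may have weight zero here, so covering outer sets need not be
  -- contradictory. In that case the differences are tight, and equality forces `M (meet X Y)` and
  -- `Cross X Y` to vanish; thus no vertex of positive weight is lost from the cover.
  uncross : ∀ X Y → Active X → Active Y → Meets X Y → Resolved X Y
  uncross X Y (wX@(ntX , FX) , MX) (wY@(ntY , FY) , MY) (x , Xx , Yx) =
    go (any? λ v → (X v ≟ᴸ O) ×-dec (Y v ≟ᴸ O))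
    where
    FX′ : F X ≤ 2 * k + 0
    FX′ = subst (F X ≤_) (sym (+-identityʳ _)) FX
    FY′ : F Y ≤ 2 * k + 0
    FY′ = subst (F Y ≤_) (sym (+-identityʳ _)) FY
    uX = slack-wall 0 X FX′ MX
    uY = slack-wall 0 Y FY′ MY
    no-cover : ∀ P Q → NonTriv P → NonTriv Q → UniqueWall P → UniqueWall Q → 1 ≤ M P → 1 ≤ M Q →
               F P ≤ 2 * k + 0 → F Q ≤ 2 * k + 0 → (∀ v → P v ≡ I → Q v ≢ O) → (∀ v → P v ≡ O → Q v ≢ O) → ⊥
    no-cover P Q ntP ntQ uP uQ MP MQ FP FQ IO OO with covering-pair valid P Q ntP ntQ uP uQ IO OO 0 0 FP FQ
    ... | inj₁ (le , _)        = <⇒≱ MP (≤-trans (m≤m+n _ _) le)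
    ... | inj₂ (inj₁ le)       = <⇒≱ MP (≤-trans (m≤m+n _ _) le)
    ... | inj₂ (inj₂ (le , _)) = <⇒≱ MQ le
    go : Dec (∃ λ v → X v ≡ O × Y v ≡ O) → Resolved X Y
    go (yes (y , Xy , Yy)) = inj₁ ((((x , cong₂ _⋎_ Xx Yx) , (y , cong₂ _⋎_ Xy Yy)) , ≮⇒≥ (refute
        (F X ∷ F Y ∷ F (meet X Y) ∷ F (join X Y) ∷ 2 * k ∷ [])
        (λ { (x ∷ y ∷ a ∷ b ∷ k ∷ []) → a ⊕ b ⊑ x ⊕ y ∷ k ⊑ a ∷ x ⊑ k ∷ y ⊑ k ∷ con 1 ⊕ k ⊑ b ∷ [] })
        (1 ∷ 1 ∷ 1 ∷ 1 ∷ 1 ∷ []) (submodular X Y)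
        (valid (meet X Y) ((x , cong₂ _⋏_ Xx Yx) , (y , cong₂ _⋏_ Xy Yy))) FX FY)) ,
      ≤-trans MX (inner-mono {X} {join X Y} λ v e → cong (_⋎ Y v) e))
    go (no ¬OO) with any? (λ v → (X v ≟ᴸ I) ×-dec (Y v ≟ᴸ O)) | any? (λ v → (Y v ≟ᴸ I) ×-dec (X v ≟ᴸ O))
    ... | no ¬IO | _ = ⊥-elim (no-cover X Y ntX ntY uX uY MX MY FX′ FY′ (λ v p q → ¬IO (v , p , q)) λ v p q → ¬OO (v , p , q))
    ... | yes _ | no ¬IO = ⊥-elim (no-cover Y X ntY ntX uY uX MY MX FY′ FX′ (λ v p q → ¬IO (v , p , q)) λ v p q → ¬OO (v , q , p))
    ... | yes (y , Xy , Yy) | yes (z , Yz , Xz) =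
      inj₂ (((nt₁ , F₁) , M₁) , ((nt₂ , F₂) , M₂) , keep₁ , keep₂)
      where
      nt₁ : NonTriv (diff X Y)
      nt₁ = (y , cong₂ (λ a b → a ⋏ ∁ b) Xy Yy) , (x , cong₂ (λ a b → a ⋏ ∁ b) Xx Yx)
      nt₂ : NonTriv (diff Y X)
      nt₂ = (z , cong₂ (λ a b → a ⋏ ∁ b) Yz Xz) , (x , cong₂ (λ a b → a ⋏ ∁ b) Yx Xx)
      vars = F X ∷ F Y ∷ F (diff X Y) ∷ F (diff Y X) ∷ M (meet X Y) ∷ Cross X Y ∷ 2 * k ∷ []
      unc = difference-uncrossing X Y
      F₁ : F (diff X Y) ≤ 2 * k
      F₁ = ≮⇒≥ (refute vars (λ { (x ∷ y ∷ a ∷ b ∷ mm ∷ c ∷ k ∷ []) →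
        a ⊕ b ⊕ (2 ⊗ mm ⊕ c) ⊑ x ⊕ y ∷ k ⊑ b ∷ x ⊑ k ∷ y ⊑ k ∷ con 1 ⊕ k ⊑ a ∷ [] })
        (1 ∷ 1 ∷ 1 ∷ 1 ∷ 1 ∷ []) unc (valid _ nt₂) FX FY)
      F₂ : F (diff Y X) ≤ 2 * k
      F₂ = ≮⇒≥ (refute vars (λ { (x ∷ y ∷ a ∷ b ∷ mm ∷ c ∷ k ∷ []) →
        a ⊕ b ⊕ (2 ⊗ mm ⊕ c) ⊑ x ⊕ y ∷ k ⊑ a ∷ x ⊑ k ∷ y ⊑ k ∷ con 1 ⊕ k ⊑ b ∷ [] })
        (1 ∷ 1 ∷ 1 ∷ 1 ∷ 1 ∷ []) unc (valid _ nt₁) FX FY)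
      slack : 2 * M (meet X Y) + Cross X Y ≤ 0
      slack = ≮⇒≥ (refute vars (λ { (x ∷ y ∷ a ∷ b ∷ mm ∷ c ∷ k ∷ []) →
        a ⊕ b ⊕ (2 ⊗ mm ⊕ c) ⊑ x ⊕ y ∷ k ⊑ a ∷ k ⊑ b ∷ x ⊑ k ∷ y ⊑ k ∷ con 1 ⊑ 2 ⊗ mm ⊕ c ∷ [] })
        (1 ∷ 1 ∷ 1 ∷ 1 ∷ 1 ∷ 1 ∷ []) unc (valid _ nt₁) (valid _ nt₂) FX FY)
      not-II : ∀ {v} → 0 < m v → X v ≡ I → Y v ≢ I
      not-II pv p q = <⇒≱ (≤-trans pv (inner-weight {meet X Y} (cong₂ _⋏_ p q)))
        (≤-trans (m≤m+n _ _) (≤-trans (m≤m+n _ _) slack))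
      not-cross : ∀ {v} → 0 < m v → crossing (X v) (Y v) ≢ 1
      not-cross pv e = <⇒≱ (≤-trans pv (cross-weight X Y _ e)) (≤-trans (m≤n+m _ _) slack)
      keep₁ : ∀ v → 0 < m v → X v ≡ I → diff X Y v ≡ I
      keep₁ v pv p = subst (λ a → a ⋏ ∁ (Y v) ≡ I) (sym p) (out (Y v) refl)
        where
        out : ∀ b → Y v ≡ b → ∁ (Y v) ≡ I
        out I q = contradiction q (not-II pv p)
        out W q = contradiction (cong₂ crossing p q) (not-cross pv)
        out O q = cong ∁ q
      keep₂ : ∀ v → 0 < m v → Y v ≡ I → diff Y X v ≡ I
      keep₂ v pv q = subst (λ b → b ⋏ ∁ (X v) ≡ I) (sym q) (out (X v) refl)
        where
        out : ∀ a → X v ≡ a → ∁ (X v) ≡ I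
        out I p = contradiction q (not-II pv p)
        out W p = contradiction (cong₂ crossing p q) (not-cross pv)
        out O p = cong ∁ p
      M₁ : 1 ≤ M (diff X Y)
      M₁ = let v , pv , p = inner-positive X MX in ≤-trans pv (inner-weight {diff X Y} (keep₁ v pv p))
      M₂ : 1 ≤ M (diff Y X)
      M₂ = let v , pv , p = inner-positive Y MY in ≤-trans pv (inner-weight {diff Y X} (keep₂ v pv p))

  -- The factor 1 gives the sum the shape produced by `vertexIneq`.
  inner-count : Labelling n → ℕ
  inner-count X = ∑ λ v → 1 * isI (X v)

  meet-count : ∀ {X Y : Labelling n} → Meets X Y → 1 ≤ inner-count (meet X Y)
  meet-count {X} {Y} (v , p , q) = subst (_≤ inner-count (meet X Y)) (cong (λ a → 1 * isI a) (cong₂ _⋏_ p q))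
    (term≤∑ (λ v → 1 * isI (X v ⋏ Y v)) v)

  join-count : ∀ X Y → inner-count (join X Y) + inner-count (meet X Y) ≤ inner-count X + inner-count Y
  join-count X Y = vertexIneq (X ∷ Y ∷ []) anything _ (λ _ → 1)
    ((λ { (a ∷ b ∷ []) → isI (a ⋎ b) }) ∷ (λ { (a ∷ b ∷ []) → isI (a ⋏ b) }) ∷ [])
    ((λ { (a ∷ b ∷ []) → isI a }) ∷ (λ { (a ∷ b ∷ []) → isI b }) ∷ [])

  diff-count : ∀ X Y → inner-count (diff X Y) + (inner-count (diff Y X) + inner-count (meet X Y)) ≤ inner-count X + inner-count Y
  diff-count X Y = vertexIneq (X ∷ Y ∷ []) anything _ (λ _ → 1)
    ((λ { (a ∷ b ∷ []) → isI (a ⋏ ∁ b) }) ∷ (λ { (a ∷ b ∷ []) → isI (b ⋏ ∁ a) }) ∷ (λ { (a ∷ b ∷ []) → isI (a ⋏ b) }) ∷ [])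
    ((λ { (a ∷ b ∷ []) → isI a }) ∷ (λ { (a ∷ b ∷ []) → isI b }) ∷ [])

  -- Either way of resolving a conflict counts the common inner vertices at least once less, so the
  -- total number of inner vertices decreases.
  make-disjoint : ∀ s 𝒳 → sumˡ (map inner-count 𝒳) ≤ s → All Active 𝒳 → Covers 𝒳 →
                  ∃ λ 𝒴 → All Active 𝒴 × Covers 𝒴 × AllPairs Disjoint 𝒴
  make-disjoint s 𝒳 le active cover with conflict 𝒳
  ... | inj₁ pairs = 𝒳 , active , cover , pairs
  ... | inj₂ (X , Y , 𝒴 , perm , meets) with All-resp-↭ perm active
  ... | aX ∷ aY ∷ a𝒴 = resolve s le (uncross X Y aX aY meets)
    where
    rest = sumˡ (map inner-count 𝒴)
    size-𝒳 : sumˡ (map inner-count 𝒳) ≡ inner-count X + (inner-count Y + rest)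
    size-𝒳 = sum-↭ (map⁺ inner-count perm)
    cover′ : ∀ v → 0 < m v → Any (λ Z → Z v ≡ I) (X ∷ Y ∷ 𝒴)
    cover′ v pv = Any-resp-↭ perm (cover v pv)
    resolve : ∀ s → sumˡ (map inner-count 𝒳) ≤ s → Resolved X Y →
              ∃ λ 𝒴 → All Active 𝒴 × Covers 𝒴 × AllPairs Disjoint 𝒴
    resolve zero le _ = ⊥-elim (refute (inner-count X ∷ inner-count Y ∷ rest ∷ inner-count (join X Y) ∷ inner-count (meet X Y) ∷ [])
      (λ { (x ∷ y ∷ r ∷ j ∷ i ∷ []) → x ⊕ (y ⊕ r) ⊑ con 0 ∷ j ⊕ i ⊑ x ⊕ y ∷ con 1 ⊑ i ∷ [] }) (1 ∷ 1 ∷ 1 ∷ [])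
      (≤-trans (≤-reflexive (sym size-𝒳)) le) (join-count X Y) (meet-count meets))
    resolve (suc s) le (inj₁ aJ) = make-disjoint s (join X Y ∷ 𝒴)
      (≮⇒≥ (refute (inner-count X ∷ inner-count Y ∷ rest ∷ inner-count (join X Y) ∷ inner-count (meet X Y) ∷ s ∷ [])
        (λ { (x ∷ y ∷ r ∷ j ∷ i ∷ s ∷ []) →
          x ⊕ (y ⊕ r) ⊑ con 1 ⊕ s ∷ j ⊕ i ⊑ x ⊕ y ∷ con 1 ⊑ i ∷ con 1 ⊕ s ⊑ j ⊕ r ∷ [] }) (1 ∷ 1 ∷ 1 ∷ 1 ∷ [])
        (≤-trans (≤-reflexive (sym size-𝒳)) le) (join-count X Y) (meet-count meets)))
      (aJ ∷ a𝒴) λ v pv → shift v (cover′ v pv)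
      where
      shift : ∀ v → Any (λ Z → Z v ≡ I) (X ∷ Y ∷ 𝒴) → Any (λ Z → Z v ≡ I) (join X Y ∷ 𝒴)
      shift v (here p)           = here (cong (_⋎ Y v) p)
      shift v (there (here q))   = here (rank-I (rank-⋎ʳ (X v) (Y v)) q)
      shift v (there (there a))  = there a
    resolve (suc s) le (inj₂ (aP , aQ , keep₁ , keep₂)) = make-disjoint s (diff X Y ∷ diff Y X ∷ 𝒴)
      (≮⇒≥ (refute (inner-count X ∷ inner-count Y ∷ rest ∷ inner-count (diff X Y) ∷ inner-count (diff Y X) ∷ inner-count (meet X Y) ∷ s ∷ [])
        (λ { (x ∷ y ∷ r ∷ p ∷ q ∷ i ∷ s ∷ []) →
          x ⊕ (y ⊕ r) ⊑ con 1 ⊕ s ∷ p ⊕ (q ⊕ i) ⊑ x ⊕ y ∷ con 1 ⊑ i ∷ con 1 ⊕ s ⊑ p ⊕ (q ⊕ r) ∷ [] }) (1 ∷ 1 ∷ 1 ∷ 1 ∷ [])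
        (≤-trans (≤-reflexive (sym size-𝒳)) le) (diff-count X Y) (meet-count meets)))
      (aP ∷ aQ ∷ a𝒴) λ v pv → shift v pv (cover′ v pv)
      where
      shift : ∀ v → 0 < m v → Any (λ Z → Z v ≡ I) (X ∷ Y ∷ 𝒴) → Any (λ Z → Z v ≡ I) (diff X Y ∷ diff Y X ∷ 𝒴)
      shift v pv (here p)          = here (keep₁ v pv p)
      shift v pv (there (here q))  = there (here (keep₂ v pv q))
      shift v pv (there (there a)) = there (there a)

  disjoint-family : (∀ v → 0 < m v → ∃ λ T → T v ≡ I × Within (2 * k) T) →
                    ∃ λ 𝒳 → All Active 𝒳 × Covers 𝒳 × AllPairs Disjoint 𝒳
  disjoint-family covered =
    let 𝒳 , active , cover = collect (allFin n)
    in make-disjoint _ 𝒳 ≤-refl active λ v → cover v (∈-allFin v)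
    where
    collect : ∀ vs → ∃ λ 𝒳 → All Active 𝒳 × (∀ v → v ∈ˡ vs → 0 < m v → Any (λ X → X v ≡ I) 𝒳)
    collect [] = [] , [] , λ _ ()
    collect (v ∷ vs) with collect vs | 0 <? m v
    ... | 𝒳 , active , cover | no ¬pos =
      𝒳 , active , λ { w (here refl) pos → contradiction pos ¬pos ; w (there w∈) pos → cover w w∈ pos }
    ... | 𝒳 , active , cover | yes pos with covered v pos
    ... | T , Tv , wT = T ∷ 𝒳 , (wT , ≤-trans pos (inner-weight Tv)) ∷ active ,
      λ { w (here refl) pos → here Tv ; w (there w∈) pos → there (cover w w∈ pos) }

private
  variable
    u v w : Fin n

-- Bi-sets and labellings

label : {A B : Set} → Dec A → Dec B → Lab
label (yes _) _       = I
label (no _)  (yes _) = W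
label (no _)  (no _)  = O

lab : BiSet n → Labelling n
lab X v = label (v ∈? inner X) (v ∈? outer X)

module _ (X : BiSet n) where

  lab-inner : v ∈ inner X → lab X v ≡ I
  lab-inner {v} v∈ with v ∈? inner X
  ... | yes _ = refl
  ... | no v∉ = contradiction v∈ v∉

  lab-outside : v ∉ outer X → lab X v ≡ O
  lab-outside {v} v∉ with v ∈? inner X | v ∈? outer X
  ... | yes v∈ | _     = contradiction (inner⊆outer X v∈) v∉
  ... | no _   | yes v∈ = contradiction v∈ v∉
  ... | no _   | no _  = refl

  inner-lab : lab X v ≡ I → v ∈ inner X
  inner-lab {v} e with v ∈? inner X | v ∈? outer X
  inner-lab e  | yes v∈ | _     = v∈
  inner-lab () | no _   | yes _
  inner-lab () | no _   | no _

  outside-lab : lab X v ≡ O → v ∉ outer X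
  outside-lab {v} e with v ∈? inner X | v ∈? outer X
  outside-lab () | yes _ | _
  outside-lab () | no _  | yes _
  outside-lab e  | no _  | no v∉ = v∉

  enters-lab : ∀ x y → Enters X (x , y) → enters (lab X x) (lab X y) ≡ 1
  enters-lab x y (inj₁ (x∈ , y∉)) = cong₂ enters (lab-inner x∈) (lab-outside y∉)
  enters-lab x y (inj₂ (y∈ , x∉)) = cong₂ enters (lab-outside x∉) (lab-inner y∈)

  ¬enters-lab : ∀ x y → ¬ Enters X (x , y) → enters (lab X x) (lab X y) ≡ 0
  ¬enters-lab x y ¬e = go (lab X x) (lab X y) refl refl
    where
    go : ∀ a b → lab X x ≡ a → lab X y ≡ b → enters a b ≡ 0
    go I I p q = refl
    go I W p q = refl
    go I O p q = contradiction (inj₁ (inner-lab p , outside-lab q)) ¬e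
    go W b p q = refl
    go O I p q = contradiction (inj₂ (inner-lab q , outside-lab p)) ¬e
    go O W p q = refl
    go O O p q = refl

  d̂≡E : ∀ G → d̂ G X ≡ E G (lab X)
  d̂≡E [] = refl
  d̂≡E ((x , y) ∷ G) = go (enters? X (x , y))
    where
    go : Dec (Enters X (x , y)) → d̂ ((x , y) ∷ G) X ≡ E ((x , y) ∷ G) (lab X)
    go (yes e) = trans (cong length (filter-accept (enters? X) e)) (cong₂ _+_ (sym (enters-lab x y e)) (d̂≡E G))
    go (no ¬e) = trans (cong length (filter-reject (enters? X) ¬e)) (cong₂ _+_ (sym (¬enters-lab x y ¬e)) (d̂≡E G))

cardinality : (p : Subset n) (g : Fin n → ℕ) → (∀ v → v ∈ p → g v ≡ 1) → (∀ v → v ∉ p → g v ≡ 0) → ∣ p ∣ ≡ ∑ g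
cardinality [] g in-p out-p = refl
cardinality (true ∷ p) g in-p out-p = cong₂ _+_ (sym (in-p zero here))
  (cardinality p (g ∘ suc) (λ v v∈ → in-p (suc v) (there v∈)) (λ v v∉ → out-p (suc v) λ { (there v∈) → v∉ v∈ }))
cardinality (false ∷ p) g in-p out-p = cong₂ _+_ (sym (out-p zero λ ()))
  (cardinality p (g ∘ suc) (λ v v∈ → in-p (suc v) (there v∈)) (λ v v∉ → out-p (suc v) λ { (there v∈) → v∉ v∈ }))

x∈p─q⇒x∉q : (p q : Subset n) → v ∈ p ─ q → v ∉ q
x∈p─q⇒x∉q (s ∷ p) (true ∷ q) () here
x∈p─q⇒x∉q (s ∷ p) (t ∷ q) (there v∈) (there v∈q) = x∈p─q⇒x∉q p q v∈ v∈q

∑-* : (c : ℕ) (f : Fin n → ℕ) → ∑ (λ v → c * f v) ≡ c * ∑ f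
∑-* {zero} c f  = sym (*-zeroʳ c)
∑-* {suc n} c f = trans (cong (c * f zero +_) (∑-* c (f ∘ suc))) (sym (*-distribˡ-+ c (f zero) _))

wall-cost : ∀ k (X : BiSet n) → k * ∣ wall X ∣ ≡ ∑ λ v → k * isW (lab X v)
wall-cost k X = trans (cong (k *_) (cardinality (wall X) (isW ∘ lab X) on-wall off-wall)) (sym (∑-* k (isW ∘ lab X)))
  where
  on-wall : ∀ v → v ∈ wall X → isW (lab X v) ≡ 1
  on-wall v v∈ with v ∈? inner X | v ∈? outer X
  ... | yes v∈I | _     = contradiction v∈I (x∈p─q⇒x∉q (outer X) (inner X) v∈)
  ... | no _    | yes _ = refl
  ... | no _    | no v∉ = contradiction (p─q⊆p (outer X) (inner X) v∈) v∉
  off-wall : ∀ v → v ∉ wall X → isW (lab X v) ≡ 0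
  off-wall v v∉ with v ∈? inner X | v ∈? outer X
  ... | yes _  | _      = refl
  ... | no v∉I | yes v∈ = contradiction (x∈p∧x∉q⇒x∈p─q v∈ v∉I) v∉
  ... | no _   | no _   = refl

nonTriv-lab : (X : BiSet n) → NonTrivial X → NonTriv (lab X)
nonTriv-lab X nt with nonempty? (inner X) | any? (λ v → ¬? (v ∈? outer X))
... | no ¬ne      | _             = contradiction (inj₁ (Empty-unique ¬ne)) nt
... | yes (v , v∈) | no none      = contradiction (inj₂ (⊆-antisym (λ _ → ∈⊤)
                                      λ {w} _ → decidable-stable (w ∈? outer X) λ w∉ → none (w , w∉))) nt
... | yes (v , v∈) | yes (w , w∉) = (v , lab-inner X v∈) , (w , lab-outside X w∉)

lab-nonTrivial : (X : BiSet n) → NonTriv (lab X) → NonTrivial X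
lab-nonTrivial X ((v , p) , (w , q)) (inj₁ e) = ∉⊥ (subst (v ∈_) e (inner-lab X p))
lab-nonTrivial X ((v , p) , (w , q)) (inj₂ e) = outside-lab X q (subst (w ∈_) (sym e) ∈⊤)

innerSide outerSide : Lab → Side
innerSide I = true
innerSide _ = false
outerSide O = false
outerSide _ = true

∈-tabulate⁺ : (g : Fin n → Side) → g v ≡ true → v ∈ tabulate g
∈-tabulate⁺ {v = v} g e = lookup⇒[]= v (tabulate g) (trans (lookup∘tabulate g v) e)

∈-tabulate⁻ : (g : Fin n → Side) → v ∈ tabulate g → g v ≡ true
∈-tabulate⁻ {v = v} g v∈ = trans (sym (lookup∘tabulate g v)) ([]=⇒lookup v∈)

toBiSet : Labelling n → BiSet n
toBiSet L = record
  { outer       = tabulate (outerSide ∘ L)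
  ; inner       = tabulate (innerSide ∘ L)
  ; inner⊆outer = λ {v} v∈ → ∈-tabulate⁺ (outerSide ∘ L) (mono (L v) (∈-tabulate⁻ (innerSide ∘ L) v∈))
  }
  where
  mono : ∀ a → innerSide a ≡ true → outerSide a ≡ true
  mono I e  = refl
  mono W ()
  mono O ()

lab-toBiSet : (L : Labelling n) → ∀ v → lab (toBiSet L) v ≡ L v
lab-toBiSet L v = go (L v) refl
  where
  go : ∀ a → L v ≡ a → lab (toBiSet L) v ≡ a
  go I e = lab-inner (toBiSet L) (∈-tabulate⁺ (innerSide ∘ L) (cong innerSide e))
  go O e = lab-outside (toBiSet L) λ v∈ → case trans (sym (∈-tabulate⁻ (outerSide ∘ L) v∈)) (cong outerSide e) of λ ()
  go W e with v ∈? inner (toBiSet L) | v ∈? outer (toBiSet L)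
  ... | yes v∈ | _     = case trans (sym (∈-tabulate⁻ (innerSide ∘ L) v∈)) (cong innerSide e) of λ ()
  ... | no _   | yes _ = refl
  ... | no _   | no v∉ = contradiction (∈-tabulate⁺ (outerSide ∘ L) (cong outerSide e)) v∉

-- Cuts and connectivity

E≤length : (G : Graph n) (L : Labelling n) → E G L ≤ length G
E≤length [] L            = z≤n
E≤length ((x , y) ∷ G) L = +-mono-≤ (enters≤1 (L x) (L y)) (E≤length G L)

E-interleaving : ∀ {D R G : Graph n} (L : Labelling n) → Interleaving D R G → E G L ≡ E D L + E R L
E-interleaving L [] = refl
E-interleaving {D = (x , y) ∷ D} L (consˡ s) =
  trans (cong (enters (L x) (L y) +_) (E-interleaving L s)) (sym (+-assoc (enters (L x) (L y)) _ _))
E-interleaving {D = D} {(x , y) ∷ R} L (consʳ s) =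
  trans (cong (e +_) (E-interleaving L s)) (trans (sym (+-assoc e (E D L) (E R L)))
    (trans (cong (_+ E R L) (+-comm e (E D L))) (+-assoc (E D L) e (E R L))))
  where
  e = enters (L x) (L y)

cut-edges : (G : Graph n) (L : Labelling n) → ∃₂ λ D R → Interleaving D R G × length D ≡ E G L × E R L ≡ 0
cut-edges [] L = [] , [] , [] , refl , refl
cut-edges ((x , y) ∷ G) L with cut-edges G L | enters (L x) (L y) in e | enters≤1 (L x) (L y)
... | D , R , s , len , none | zero | _ = D , (x , y) ∷ R , consʳ s , len , trans (cong (_+ E R L) e) none
... | D , R , s , len , none | suc zero | _ = (x , y) ∷ D , R , consˡ s , cong suc len , none
... | D , R , s , len , none | suc (suc _) | s≤s ()

∈-E : ∀ {x y} (R : Graph n) (L : Labelling n) → E R L ≡ 0 → (x , y) ∈ˡ R → enters (L x) (L y) ≡ 0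
∈-E ((x , y) ∷ R) L e (here refl) = m+n≡0⇒m≡0 _ e
∈-E ((x , y) ∷ R) L e (there i)   = ∈-E R L (m+n≡0⇒n≡0 (enters (L x) (L y)) e) i

interleaving-⊆ : ∀ {D R G : Graph n} {e} → Interleaving D R G → e ∈ˡ R → e ∈ˡ G
interleaving-⊆ (consˡ s) i           = there (interleaving-⊆ s i)
interleaving-⊆ (consʳ s) (here refl) = here refl
interleaving-⊆ (consʳ s) (there i)   = there (interleaving-⊆ s i)

inner-closed : (R : Graph n) (L : Labelling n) → E R L ≡ 0 →
               (∀ {x y} → (x , y) ∈ˡ R → L x ≢ W × L y ≢ W) → Joined R u v → L u ≡ I → L v ≡ I
inner-closed R L none walls ε e = e
inner-closed R L none walls (fwd i ◅ s) e =
  inner-closed R L none walls s (move e (∈-E R L none i) (proj₂ (walls i)))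
  where
  move : ∀ {a b} → a ≡ I → enters a b ≡ 0 → b ≢ W → b ≡ I
  move {b = I} refl p ¬W = refl
  move {b = W} refl p ¬W = contradiction refl ¬W
inner-closed R L none walls (bwd i ◅ s) e =
  inner-closed R L none walls s (move e (∈-E R L none i) (proj₁ (walls i)))
  where
  move : ∀ {a b} → a ≡ I → enters b a ≡ 0 → b ≢ W → b ≡ I
  move {b = I} refl p ¬W = refl
  move {b = W} refl p ¬W = contradiction refl ¬W

E-deleteVertex : ∀ {x} (G : Graph n) (L : Labelling n) → L x ≡ W → E (deleteVertex x G) L ≡ E G L
E-deleteVertex [] L e = refl
E-deleteVertex {x = x} ((a , b) ∷ G) L e = go (incident? x (a , b))
  where
  keep? = λ e → ¬? (incident? x e)
  outside-wall : Incident x (a , b) → enters (L a) (L b) ≡ 0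
  outside-wall (inj₁ refl) = cong (λ c → enters c (L b)) e
  outside-wall (inj₂ refl) = trans (cong (enters (L a)) e) (wall-right (L a))
    where
    wall-right : ∀ c → enters c W ≡ 0
    wall-right I = refl
    wall-right W = refl
    wall-right O = refl
  go : Dec (Incident x (a , b)) → E (deleteVertex x ((a , b) ∷ G)) L ≡ E ((a , b) ∷ G) L
  go (yes i) = trans (cong (λ H → E H L) (filter-reject keep? (λ ¬i → ¬i i)))
    (trans (E-deleteVertex G L e) (cong (_+ E G L) (sym (outside-wall i))))
  go (no ¬i) = trans (cong (λ H → E H L) (filter-accept keep? ¬i))
    (cong (enters (L a) (L b) +_) (E-deleteVertex G L e))

∈-minus⁻ : {x : Fin n} → v ∈ full - x → v ≢ x
∈-minus⁻ {v = v} v∈ refl = x∈p─q⇒x∉q full ⁅ v ⁆ v∈ (x∈⁅x⁆ v)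

boundary-edge : (R : Graph n) (L : Labelling n) →
                E R L ≡ 0 ⊎ ∃₂ λ x y → L x ≡ I × L y ≡ O × SymClosure (λ u v → (u , v) ∈ˡ R) x y
boundary-edge [] L = inj₁ refl
boundary-edge ((x , y) ∷ R) L with boundary-edge R L
... | inj₂ (a , b , p , q , fwd i) = inj₂ (a , b , p , q , fwd (there i))
... | inj₂ (a , b , p , q , bwd i) = inj₂ (a , b , p , q , bwd (there i))
... | inj₁ none = go (L x) (L y) refl refl
  where
  Found = ∃₂ λ a b → L a ≡ I × L b ≡ O × SymClosure (λ u v → (u , v) ∈ˡ ((x , y) ∷ R)) a b
  go : ∀ a b → L x ≡ a → L y ≡ b → E ((x , y) ∷ R) L ≡ 0 ⊎ Found
  go I O p q = inj₂ (x , y , p , q , fwd (here refl))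
  go O I p q = inj₂ (y , x , q , p , bwd (here refl))
  go I I p q = inj₁ (cong₂ _+_ (cong₂ enters p q) none)
  go I W p q = inj₁ (cong₂ _+_ (cong₂ enters p q) none)
  go W b p q = inj₁ (cong₂ _+_ (cong₂ enters p q) none)
  go O W p q = inj₁ (cong₂ _+_ (cong₂ enters p q) none)
  go O O p q = inj₁ (cong₂ _+_ (cong₂ enters p q) none)

mark : Labelling n → Fin n → Labelling n
mark L y w with w ≟ y
... | yes _ = I
... | no _  = L w

mark-same : (L : Labelling n) (y : Fin n) → mark L y y ≡ I
mark-same L y with y ≟ y
... | yes _  = refl
... | no y≢y = contradiction refl y≢y

mark-other : (L : Labelling n) {y w : Fin n} → w ≢ y → mark L y w ≡ L w
mark-other L {y} {w} w≢y with w ≟ y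
... | yes e = contradiction e w≢y
... | no _  = refl

-- `base` carries the wall: empty when whole graphs are considered, the deleted vertex otherwise.
-- While the component grows, only labels O turn into I, so the number of O's bounds the growth.
record Component (R : Graph n) (u : Fin n) (base : Labelling n) (L : Labelling n) : Set where
  field
    start  : L u ≡ I
    joined : ∀ w → L w ≡ I → Joined R u w
    wall⁺  : ∀ w → base w ≡ W → L w ≡ W
    wall⁻  : ∀ w → L w ≡ W → base w ≡ W

grow : ∀ s (R : Graph n) (u : Fin n) (base L : Labelling n) → (∑ λ w → isO (L w)) ≤ s →
       Component R u base L → ∃ λ L → Component R u base L × E R L ≡ 0
grow s R u base L le c with boundary-edge R L
... | inj₁ none = L , c , none
grow zero R u base L le c | inj₂ (x , y , p , q , e) =
  contradiction (≤-trans (≤-reflexive (cong isO (sym q))) (≤-trans (term≤∑ (isO ∘ L) y) le)) λ ()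
grow (suc s) R u base L le c | inj₂ (x , y , p , q , e) = grow s R u base (mark L y)
  (≤-pred (≤-trans (∑-mono-< less y strict) le)) (record
    { start  = keep-I start
    ; joined = λ w i → join-w w i (w ≟ y)
    ; wall⁺  = λ w b → trans (mark-other L λ { refl → case trans (sym q) (wall⁺ w b) of λ () }) (wall⁺ w b)
    ; wall⁻  = λ w i → wall⁻ w (trans (sym (mark-other L λ { refl → case trans (sym i) (mark-same L y) of λ () })) i)
    })
  where
  open Component c
  keep-I : ∀ {w} → L w ≡ I → mark L y w ≡ I
  keep-I {w} i with w ≟ y
  ... | yes _ = refl
  ... | no _  = i
  join-w : ∀ w → mark L y w ≡ I → Dec (w ≡ y) → Joined R u w
  join-w w i (yes refl) = joined x p ◅◅ (e ◅ ε)
  join-w w i (no w≢y)   = joined w (trans (sym (mark-other L w≢y)) i)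
  less : ∀ w → isO (mark L y w) ≤ isO (L w)
  less w with w ≟ y
  ... | yes _ = z≤n
  ... | no _  = ≤-refl
  strict : isO (mark L y y) < isO (L y)
  strict = subst₂ (λ a b → isO a < isO b) (sym (mark-same L y)) (sym q) (s≤s z≤n)

component : (R : Graph n) (u : Fin n) (base : Labelling n) → (∀ w → base w ≢ I) → base u ≢ W →
            ∃ λ L → Component R u base L × E R L ≡ 0
component R u base no-I u-out = grow _ R u base (mark base u) ≤-refl (record
  { start  = mark-same base u
  ; joined = λ w i → only w i (w ≟ u)
  ; wall⁺  = λ w b → trans (mark-other base λ { refl → u-out b }) b
  ; wall⁻  = λ w i → trans (sym (mark-other base λ { refl → case trans (sym i) (mark-same base u) of λ () })) i
  })
  where
  only : ∀ w → mark base u w ≡ I → Dec (w ≡ u) → Joined R u w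
  only w i (yes refl) = ε
  only w i (no w≢u)   = contradiction (trans (sym (mark-other base w≢u)) i) (no-I w)

module _ (k : ℕ) (G : Graph n) where

  Cuts : Set
  Cuts = ∀ L → NonTriv L → 2 * k ≤ E G L + ∑ λ v → k * isW (L v)

  open Weighted k G no-weights using (K; K-one; K-none; UniqueWall)

  two-walls : ∀ {x y} (L : Labelling n) → x ≢ y → L x ≡ W → L y ≡ W → 2 * k ≤ K L
  two-walls L x≢y p q = ≤-trans (≤-reflexive (cong₂ _+_ (at p) (+-identityʳ k ⟨ trans ⟩ at q)))
    (two-terms≤∑ (λ v → k * isW (L v)) x≢y)
    where
    open import Function using (_⟨_⟩_)
    at : ∀ {v} → L v ≡ W → k ≡ k * isW (L v)
    at e = trans (sym (*-identityʳ k)) (cong (λ a → k * isW a) (sym e))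

  -- The wall decides which condition is used: none, and the entering edges form a cut of G; one
  -- vertex x, and they form a cut of G - x while the wall pays the other k; two or more, and the
  -- wall pays 2k by itself.
  connected⇒cuts : [2k,k]-Connected k G → Cuts
  connected⇒cuts conn L ((u , Lu) , (v , Lv)) with any? (λ x → L x ≟ᴸ W)
  ... | no none = ≤-trans (≮⇒≥ cut) (m≤m+n _ _)
    where
    cut : E G L < 2 * k → ⊥
    cut small with cut-edges G L
    ... | D , R , s , len , empty-cut = case trans (sym Lv) (inner-closed R L empty-cut (λ _ → (λ e → none (_ , e)) , λ e → none (_ , e))
      ([2k,k]-Connected.edgeConnected conn s (subst (_< 2 * k) (sym len) small) ∈⊤ ∈⊤) Lu) of λ ()
  ... | yes (x , Lx) with any? (λ y → ¬? (x ≟ y) ×-dec (L y ≟ᴸ W))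
  ... | yes (y , x≢y , Ly) = ≤-trans (two-walls L x≢y Lx Ly) (m≤n+m _ _)
  ... | no none = ≤-trans (≤-reflexive (cong (k +_) (+-identityʳ k)))
                    (+-mono-≤ (≮⇒≥ cut) (≤-reflexive (sym (K-one unique Lx))))
    where
    only : ∀ {y} → L y ≡ W → x ≡ y
    only {y} e = decidable-stable (x ≟ y) λ x≢y → none (y , x≢y , e)
    unique : UniqueWall L
    unique p q = trans (sym (only p)) (only q)
    away : ∀ {w} → L w ≢ W → w ∈ full - x
    away ¬W = x∈p∧x≢y⇒x∈p-y ∈⊤ λ { refl → ¬W Lx }
    cut : E G L < k → ⊥
    cut small with cut-edges (deleteVertex x G) L
    ... | D , R , s , len , empty-cut = case trans (sym Lv) (inner-closed R L empty-cut walls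
      ([2k,k]-Connected.edgeConnected-del conn x s
        (subst (_< k) (sym (trans len (E-deleteVertex G L Lx))) small)
        (away λ e → case trans (sym Lu) e of λ ()) (away λ e → case trans (sym Lv) e of λ ())) Lu) of λ ()
      where
      walls : ∀ {a b} → (a , b) ∈ˡ R → L a ≢ W × L b ≢ W
      walls i = let ¬inc = proj₂ (∈-filter⁻ (λ e → ¬? (incident? x e)) {xs = G} (interleaving-⊆ s i))
                in (λ e → ¬inc (inj₁ (sym (only e)))) , λ e → ¬inc (inj₂ (sym (only e)))

  -- The vertices reachable from u after the deletion, with the deleted vertex as wall if there is
  -- one, form a bi-set that no remaining edge enters. All edges entering it were deleted, which is
  -- too few for `Cuts` unless v was reached.
  cuts⇒connected : 3 ≤ n → Cuts → [2k,k]-Connected k G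
  cuts⇒connected 3≤n cuts = record
    { 3≤∣V∣ = 3≤n
    ; edgeConnected = λ s small _ _ → whole s small
    ; edgeConnected-del = λ x s small u∈ v∈ → deleted x s small (∈-minus⁻ u∈) (∈-minus⁻ v∈)
    }
    where
    whole : ∀ {D R u v} → Interleaving D R G → length D < 2 * k → Joined R u v
    whole {D} {R} {u} {v} s small with component R u (λ _ → O) (λ _ ()) (λ ())
    ... | L , c , none = go (L v) refl
      where
      open Component c
      go : ∀ a → L v ≡ a → Joined R u v
      go I e = joined v e
      go W e = case wall⁻ v e of λ ()
      go O e = contradiction (≤-trans (cuts L ((u , start) , (v , e))) (≤-reflexive
        (trans (cong₂ _+_ (E-interleaving L s) (K-none λ w p → case wall⁻ w p of λ ()))
          (trans (+-identityʳ _) (trans (cong (E D L +_) none) (+-identityʳ _))))))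
        (<⇒≱ (≤-trans (s≤s (E≤length D L)) small))
    deleted : ∀ x {D R u v} → Interleaving D R (deleteVertex x G) → length D < k → u ≢ x → v ≢ x → Joined R u v
    deleted x {D} {R} {u} {v} s small u≢x v≢x with component R u base no-I (λ e → u≢x (at-wall e))
      where
      base : Labelling n
      base w with w ≟ x
      ... | yes _ = W
      ... | no _  = O
      no-I : ∀ w → base w ≢ I
      no-I w e with w ≟ x
      no-I w () | yes _
      no-I w () | no _
      at-wall : ∀ {w} → base w ≡ W → w ≡ x
      at-wall {w} e with w ≟ x
      at-wall e  | yes p = p
      at-wall () | no _
    ... | L , c , none = go (L v) refl
      where
      open Component c
      base-x : ∀ {w} → L w ≡ W → w ≡ x
      base-x {w} e with w ≟ x | wall⁻ w e
      ... | yes p | _ = p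
      Lx : L x ≡ W
      Lx with x ≟ x | wall⁺ x
      ... | yes _ | f = f refl
      ... | no ¬p | _ = contradiction refl ¬p
      go : ∀ a → L v ≡ a → Joined R u v
      go I e = joined v e
      go W e = contradiction (base-x e) v≢x
      go O e = contradiction (≤-trans (cuts L ((u , start) , (v , e))) (≤-reflexive
        (cong₂ _+_ (trans (sym (E-deleteVertex G L Lx)) (trans (E-interleaving L s) (trans (cong (E D L +_) none) (+-identityʳ _))))
                   (K-one (λ p q → trans (base-x p) (sym (base-x q))) Lx))))
        (<⇒≱ (≤-trans (+-monoˡ-< k (≤-trans (s≤s (E≤length D L)) small)) (≤-reflexive (cong (k +_) (sym (+-identityʳ k))))))

-- Degrees of an augmenting edge set as weights

degree : Graph n → Fin n → ℕ
degree []            w = 0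
degree ((x , y) ∷ H) w = δ x w + (δ y w + degree H w)

∑-degree : (p : Fin n → ℕ) (x y : Fin n) (H : Graph n) →
           ∑ (λ w → degree ((x , y) ∷ H) w * p w) ≡ p x + (p y + ∑ (λ w → degree H w * p w))
∑-degree p x y H = trans (∑-cong λ w → trans (*-distribʳ-+ (p w) (δ x w) _)
    (cong (δ x w * p w +_) (*-distribʳ-+ (p w) (δ y w) _)))
  (trans (∑-+ (λ w → δ x w * p w) _) (cong₂ _+_ (∑-δ x p)
    (trans (∑-+ (λ w → δ y w * p w) _) (cong (_+ ∑ (λ w → degree H w * p w)) (∑-δ y p)))))

total-degree : (H : Graph n) → ∑ (λ w → degree H w * 1) ≡ length H * 2
total-degree {n} []        = ∑-zero {n} {λ _ → 0} λ _ → refl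
total-degree ((x , y) ∷ H) = trans (∑-degree (λ _ → 1) x y H) (cong (2 +_) (total-degree H))

-- Every entering edge has an inner end. So replacing each edge of H by two edges from its ends to s
-- loses nothing, and degrees inherit validity from an augmentation.
E≤degree : (H : Graph n) (L : Labelling n) → E H L ≤ ∑ λ w → degree H w * isI (L w)
E≤degree [] L = z≤n
E≤degree ((x , y) ∷ H) L = ≤-trans (+-mono-≤ (enters≤inner-ends (L x) (L y)) (E≤degree H L))
  (≤-reflexive (trans (+-assoc (isI (L x)) (isI (L y)) _) (sym (∑-degree (isI ∘ L) x y H))))

-- Rounding up halves

open import Data.Integer using (+_)

ceiling-integer : ∀ q (c : Coprime q 1) → ceiling (mkℚ (+ q) 0 c) ≡ + q
ceiling-integer zero    c = refl
ceiling-integer (suc q) c rewrite ℕ.n%1≡0 (suc q) | ℕ.n/1≡n (suc q) = cong (λ q → + suc q) (+-identityʳ q)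

odd/2 : ∀ q → (1 + q * 2) ℕ./ 2 ≡ q
odd/2 q = trans (ℕ.+-distrib-/-∣ʳ 1 {q * 2} {2} (n∣m*n q)) (ℕ.m*n/n≡m q 2)

odd%2 : ∀ q → (1 + q * 2) ℕ.% 2 ≡ 1
odd%2 q = ℕ.[m+kn]%n≡m%n 1 q 2

-- `mkℚ` stores the denominator minus one, so this is an odd number over 2. An even number over 2
-- normalises to denominator 1 and goes through `ceiling-integer`.
ceiling-half-odd : ∀ q (c : Coprime (1 + q * 2) 2) → ceiling (mkℚ (+ (1 + q * 2)) 1 c) ≡ + (1 + q)
ceiling-half-odd q c rewrite odd%2 q | odd/2 q = cong (λ q → + suc q) (+-identityʳ q)

odd-coprime : ∀ q → Coprime (1 + q * 2) 2
odd-coprime zero    = 1-coprimeTo 2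
odd-coprime (suc q) = coprime-+ (odd-coprime q)

data Halved : ℕ → Set where
  even : ∀ q → Halved (q * 2)
  odd  : ∀ q → Halved (1 + q * 2)

halve : ∀ t → Halved t
halve zero = even 0
halve (suc t) with halve t
... | even q = odd q
... | odd q  = even (suc q)

⌈even/2⌉ : ∀ q → ⌈ q * 2 /2⌉ ≡ q
⌈even/2⌉ zero    = refl
⌈even/2⌉ (suc q) = cong suc (⌈even/2⌉ q)

⌈odd/2⌉ : ∀ q → ⌈ 1 + q * 2 /2⌉ ≡ 1 + q
⌈odd/2⌉ zero    = refl
⌈odd/2⌉ (suc q) = cong suc (⌈odd/2⌉ q)

ceiling-half : ∀ t → + ⌈ t /2⌉ ≡ ceiling (+ t / 2)
ceiling-half t with halve t
... | even q = trans (cong +_ (⌈even/2⌉ q)) (sym (trans (cong ceiling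
  (trans (ℚ.fromℚᵘ-cong {mkℚᵘ (+ (q * 2)) 1} {mkℚᵘ (+ q) 0} (*≡* (trans (ℤ.*-identityʳ (+ (q * 2))) (ℤ.pos-* q 2))))
         (ℚ.normalize-coprime (coprime-sym (1-coprimeTo q)))))
  (ceiling-integer q (coprime-sym (1-coprimeTo q)))))
... | odd q = trans (cong +_ (⌈odd/2⌉ q)) (sym (trans (cong ceiling (ℚ.normalize-coprime (odd-coprime q)))
  (ceiling-half-odd q (odd-coprime q))))

-- Duality between families and weights

deficiency-≡ : ∀ {a f w} → f + w ≡ a → + a ℤ.- + f ≡ + w
deficiency-≡ {a} {f} {w} e =
  trans (cong (λ a → + a ℤ.- + f) (trans (sym e) (+-comm f w)))
    (trans (ℤ.+-assoc (+ w) (+ f) (ℤ.- + f)) (trans (cong (λ z → + w ℤ.+ z) (ℤ.+-inverseʳ (+ f))) (ℤ.+-identityʳ (+ w))))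

deficiency-≤ : ∀ {a f w} → a ≤ f + w → + a ℤ.- + f ℤ.≤ + w
deficiency-≤ {a} {f} {w} le =
  ℤ.≤-trans (ℤ.+-monoˡ-≤ (ℤ.- + f) (ℤ.+≤+ le)) (ℤ.≤-reflexive (deficiency-≡ {f + w} {f} {w} refl))

totalDeficiency-≡ : ∀ k (G : Graph n) (w : BiSet n → ℕ) {𝒳} → All (λ X → f k G X + w X ≡ 2 * k) 𝒳 →
                    totalDeficiency k G 𝒳 ≡ + sumˡ (map w 𝒳)
totalDeficiency-≡ k G w [] = refl
totalDeficiency-≡ k G w {X ∷ 𝒳} (e ∷ es) =
  cong₂ ℤ._+_ (deficiency-≡ {2 * k} {f k G X} {w X} e) (totalDeficiency-≡ k G w es)

totalDeficiency-≤ : ∀ k (G : Graph n) (w : BiSet n → ℕ) {𝒳} → All (λ X → 2 * k ≤ f k G X + w X) 𝒳 →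
                    totalDeficiency k G 𝒳 ℤ.≤ + sumˡ (map w 𝒳)
totalDeficiency-≤ k G w [] = ℤ.≤-refl
totalDeficiency-≤ k G w {X ∷ 𝒳} (e ∷ es) =
  ℤ.+-mono-≤ (deficiency-≤ {2 * k} {f k G X} {w X} e) (totalDeficiency-≤ k G w es)

module _ (k : ℕ) (G : Graph n) where

  f-lab : ∀ X → f k G X ≡ E G (lab X) + ∑ λ v → k * isW (lab X v)
  f-lab X = cong₂ _+_ (d̂≡E X G) (wall-cost k X)

  -- Validity bounds each deficiency by the inner weight, and disjoint inner sets share the total.
  -- It serves twice: minimal weights bound the maximum, and the degrees of an augmenting set bound
  -- its cardinality from below.
  family-≤ : ∀ (m : Fin n → ℕ) {𝒳} → Weighted.Valid k G m → Admissible 𝒳 → totalDeficiency k G 𝒳 ℤ.≤ + ∑ m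
  family-≤ m {𝒳} valid adm = ℤ.≤-trans
    (totalDeficiency-≤ k G (Weighted.M k G m ∘ lab) (All.map (λ {X} nt →
      subst (λ x → 2 * k ≤ x + Weighted.M k G m (lab X)) (sym (f-lab X)) (valid (lab X) (nonTriv-lab X nt)))
      (Admissible.nonTrivial adm)))
    (ℤ.+≤+ (≤-trans (≤-reflexive (cong sumˡ (map-∘ 𝒳))) (disjoint-weight m (AllPairs.map⁺
      (AllPairs.map (λ {X} {Y} disjoint v p q → disjoint (v , x∈p∩q⁺ (inner-lab X p , inner-lab Y q)))
        (Admissible.innerlyDisjoint adm))))))

  -- Both estimates of `family-≤` become equalities: the bi-sets are tight, and they cover all
  -- positive weight.
  family-attained : ∀ (2≤k : 2 ≤ k) (m : Fin n → ℕ) → Weighted.Valid k G m → Covered k 2≤k G m →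
                    ∃ λ 𝒳 → Admissible 𝒳 × totalDeficiency k G 𝒳 ≡ + ∑ m
  family-attained 2≤k m valid covered with Family.disjoint-family k 2≤k G m valid covered
  ... | 𝒳 , active , covers , disjoint = map toBiSet 𝒳 , record
      { nonTrivial = All.map⁺ (All.map (λ {L} a → lab-nonTrivial (toBiSet L) (nonTriv L (proj₁ (proj₁ a)))) active)
      ; innerlyDisjoint = AllPairs.map⁺ (AllPairs.map (λ {L} {L′} d → λ { (v , v∈) →
          let v∈L , v∈L′ = x∈p∩q⁻ (inner (toBiSet L)) (inner (toBiSet L′)) v∈
          in d v (trans (sym (lab-toBiSet L v)) (lab-inner (toBiSet L) v∈L))
                 (trans (sym (lab-toBiSet L′ v)) (lab-inner (toBiSet L′) v∈L′)) }) disjoint)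
      } , trans (totalDeficiency-≡ k G (W.M ∘ lab) (All.map⁺ (All.map (λ {L} a → exact L (proj₁ a)) active)))
            (cong +_ (trans (cong sumˡ (sym (map-∘ 𝒳))) (trans (weights 𝒳)
              (≤-antisym (disjoint-weight m disjoint) (covering-weight m covers)))))
    where
    module W = Weighted k G m
    nonTriv : ∀ L → NonTriv L → NonTriv (lab (toBiSet L))
    nonTriv L ((v , p) , (w , q)) = (v , trans (lab-toBiSet L v) p) , (w , trans (lab-toBiSet L w) q)
    exact : ∀ L → Minimal.Within k 2≤k G m (2 * k) L → f k G (toBiSet L) + W.M (lab (toBiSet L)) ≡ 2 * k
    exact L (nt , FL) = trans (cong (_+ W.M (lab (toBiSet L))) (f-lab (toBiSet L)))
      (trans (W.F-cong (lab-toBiSet L)) (≤-antisym FL (valid L nt)))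
    weights : ∀ 𝒳 → sumˡ (map (λ L → W.M (lab (toBiSet L))) 𝒳) ≡ sumˡ (map W.M 𝒳)
    weights []      = refl
    weights (L ∷ 𝒳) = cong₂ _+_ (∑-cong λ v → cong (λ a → m v * isI a) (lab-toBiSet L v)) (weights 𝒳)

augmentation-size : ∀ k (G H : Graph n) (m : Fin n → ℕ) {𝒳} → [2k,k]-Connected k (G ++ H) →
                    Admissible 𝒳 → totalDeficiency k G 𝒳 ≡ + ∑ m → ⌈ ∑ m /2⌉ ≤ length H
augmentation-size k G H m conn adm value = subst (⌈ ∑ m /2⌉ ≤_) (⌈even/2⌉ (length H)) (⌈n/2⌉-mono
  (≤-trans (ℤ.drop‿+≤+ (subst (ℤ._≤ _) value (family-≤ k G (degree H) valid adm)))
    (≤-reflexive (trans (∑-cong λ w → sym (*-identityʳ (degree H w))) (total-degree H)))))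
  where
  valid : Weighted.Valid k G (degree H)
  valid L nt = ≤-trans (connected⇒cuts k (G ++ H) conn L nt) (≮⇒≥ (refute
    (E (G ++ H) L ∷ E G L ∷ E H L ∷ Weighted.K k G (degree H) L ∷ Weighted.M k G (degree H) L ∷ [])
    (λ { (gh ∷ g ∷ h ∷ κ ∷ μ ∷ []) → gh ⊑ g ⊕ h ∷ h ⊑ μ ∷ con 1 ⊕ (g ⊕ κ ⊕ μ) ⊑ gh ⊕ κ ∷ [] })
    (1 ∷ 1 ∷ 1 ∷ []) (≤-reflexive (E-++ G H L)) (E≤degree H L)))

theorem8p3 : ∀ {n : ℕ} (G : Graph n) (k : ℕ) → 3 ≤ n → 2 ≤ k →
    ∃₂ λ (γ : ℕ) (μ : ℤ) →
    IsMinimum (AugmentationSize k G) γ ×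
    IsMaximum (FamilyValue k G) μ ×
    + γ ≡ ceiling (μ / 2)
theorem8p3 {n} G k 3≤n 2≤k =
  let m , valid , covered = minimal-weights k 2≤k G _ (λ _ → 2 * k) refl start
      H , valid′ , size = augment k 2≤k (∑ m) G m refl valid covered
      𝒳 , adm , value = family-attained k G 2≤k m valid covered
  in ⌈ ∑ m /2⌉ , + ∑ m ,
     ((H , cuts⇒connected k (G ++ H) 3≤n (λ L nt → ≤-trans (valid′ L nt) (≤-reflexive (no-weight {G ++ H} L))) , size) ,
      λ { (H′ , conn , refl) → augmentation-size k G H′ m conn adm value }) ,
     ((𝒳 , adm , value) , λ { (𝒴 , adm′ , refl) → family-≤ k G m valid adm′ }) ,
     ceiling-half (∑ m)
  where
  -- Weight 2k everywhere is enough to begin with, since one inner vertex already contributes 2k.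
  start : Weighted.Valid k G (λ _ → 2 * k)
  start L ((v , p) , _) = ≤-trans (Weighted.inner-weight k G (λ _ → 2 * k) {L} p) (m≤n+m _ _)
  no-weight : ∀ {H : Graph n} L → E H L + Weighted.K k H no-weights L + Weighted.M k H no-weights L ≡
                                  E H L + ∑ λ v → k * isW (L v)
  no-weight {H} L = trans (cong (λ x → E H L + Weighted.K k H no-weights L + x) (∑-zero {f = λ v → 0 * isI (L v)} λ _ → refl)) (+-identityʳ _)
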